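{- For each fixed $k\ge 0$, the class of Eulerian digraphs of carving width at most $k$ is well-quasi-ordered by strong immersion: for every infinite sequence $G_1,G_2,\dots$ of Eulerian digraphs each of carving width at most $k$ there are $i<j$ such that $G_i$ strongly immerses into $G_j$.
   Context: All digraphs are finite and may contain loops and parallel edges; a digraph is Eulerian if every vertex has in-degree equal to out-degree. For $X\subseteq V(G)$, $\rho(X)$ denotes the set of edges with one end in $X$ and the other end in $V(G)\setminus X$ (loops are never in $\rho(X)$). A carving of $G$ is a pair $(T,\ell)$ where $T$ is a tree in which every non-leaf vertex has degree three and $\ell$ is an injective map from $V(G)$ into the set of leaves of $T$. For an edge $t_1t_2$ of $T$, let $T_1$ be the component of $T-t_1t_2$ containing $t_1$ and $X$ the set of vertices of $G$ mapped by $\ell$ to leaves of $T_1$; the width of $t_1t_2$ is $|\rho(X)|$. The width of $(T,\ell)$ is the maximum width of an edge of $T$, and the carving width of $G$ is the minimum width of a carving of $G$. A path is a sequence of pairwise distinct edges $(e_1,\dots,e_m)$ with $\mathrm{head}(e_i)=\mathrm{tail}(e_{i+1})$, with internal vertices $\mathrm{head}(e_1),\dots,\mathrm{head}(e_{m-1})$. A strong immersion of $H$ into $G$ maps vertices of $H$ injectively to vertices of $G$ and each edge $(u,v)$ of $H$ to a path from the image of $u$ to the image of $v$, with pairwise edge-disjoint paths for distinct edges, and no image of a vertex of $H$ internal to any such path. -}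

module Defs where

open import Data.Nat using (ℕ; _≤_; _<_; _+_)
open import Data.Fin using (Fin; _≟_)
open import Data.List using (List; []; _∷_; length; filter; allFin)
open import Data.List.Membership.Propositional using (_∈_; _∉_)
open import Data.List.Relation.Unary.Unique.Propositional using (Unique)
open import Data.Product using (Σ; ∃; ∃-syntax; _×_; _,_)
open import Data.Sum using (_⊎_)
open import Data.Unit using (⊤)
open import Relation.Nullary using (¬_)
open import Relation.Binary.PropositionalEquality using (_≡_; _≢_)
open import Function.Definitions using (Injective)

record Digraph : Set where
  field
    nV   : ℕ
    nE   : ℕ
    tail : Fin nE → Fin nV
    head : Fin nE → Fin nV
open Digraph public

inDeg : (G : Digraph) → Fin (nV G) → ℕ
inDeg G v = length (filter (λ e → head G e ≟ v) (allFin (nE G)))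

outDeg : (G : Digraph) → Fin (nV G) → ℕ
outDeg G v = length (filter (λ e → tail G e ≟ v) (allFin (nE G)))

Eulerian : Digraph → Set
Eulerian G = ∀ v → inDeg G v ≡ outDeg G v

record UGraph : Set where
  field
    tV   : ℕ
    tE   : ℕ
    end₁ : Fin tE → Fin tV
    end₂ : Fin tE → Fin tV
open UGraph public

deg : (T : UGraph) → Fin (tV T) → ℕ
deg T v = length (filter (λ e → end₁ T e ≟ v) (allFin (tE T)))
        + length (filter (λ e → end₂ T e ≟ v) (allFin (tE T)))

data Reach (T : UGraph) (P : Fin (tE T) → Set) : Fin (tV T) → Fin (tV T) → Set where
  here  : ∀ {a} → Reach T P a a
  step₁ : ∀ {a b} (e : Fin (tE T)) → P e → end₁ T e ≡ a → Reach T P (end₂ T e) b → Reach T P a b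
  step₂ : ∀ {a b} (e : Fin (tE T)) → P e → end₂ T e ≡ a → Reach T P (end₁ T e) b → Reach T P a b

record IsTree (T : UGraph) : Set where
  field
    connected : ∀ a b → Reach T (λ _ → ⊤) a b
    edgeCount : tE T + 1 ≡ tV T

Leaf : (T : UGraph) → Fin (tV T) → Set
Leaf T v = deg T v ≤ 1

record Carving (G : Digraph) : Set where
  field
    T       : UGraph
    isTree  : IsTree T
    cubic   : ∀ t → Leaf T t ⊎ deg T t ≡ 3
    ℓ       : Fin (nV G) → Fin (tV T)
    ℓ-inj   : Injective _≡_ _≡_ ℓ
    ℓ-leaf  : ∀ v → Leaf T (ℓ v)
open Carving public

CutAtMost : (G : Digraph) → (Fin (nV G) → Set) → ℕ → Set
CutAtMost G X k =
  ∃[ L ] (length L ≤ k ×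
          (∀ e → ((X (tail G e) × ¬ X (head G e)) ⊎ (¬ X (tail G e) × X (head G e))) → e ∈ L))

side : (G : Digraph) (C : Carving G) (x : Fin (tE (T C))) (t : Fin (tV (T C))) → Fin (nV G) → Set
side G C x t v = Reach (T C) (λ f → f ≢ x) t (ℓ C v)

WidthAtMost : (G : Digraph) → Carving G → ℕ → Set
WidthAtMost G C k = ∀ x → CutAtMost G (side G C x (end₁ (T C) x)) k
                        × CutAtMost G (side G C x (end₂ (T C) x)) k

CarvingWidthAtMost : ℕ → Digraph → Set
CarvingWidthAtMost k G = Σ (Carving G) λ C → WidthAtMost G C k

data Walk (G : Digraph) : Fin (nV G) → List (Fin (nE G)) → Fin (nV G) → Set where
  one  : ∀ {s t} e → tail G e ≡ s → head G e ≡ t → Walk G s (e ∷ []) t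
  more : ∀ {s t es} e → tail G e ≡ s → Walk G (head G e) es t → Walk G s (e ∷ es) t

IsPath : (G : Digraph) → Fin (nV G) → List (Fin (nE G)) → Fin (nV G) → Set
IsPath G s es t = Walk G s es t × Unique es

internal : (G : Digraph) → List (Fin (nE G)) → List (Fin (nV G))
internal G []             = []
internal G (e ∷ [])       = []
internal G (e ∷ e′ ∷ es)  = head G e ∷ internal G (e′ ∷ es)

record StrongImmersion (H G : Digraph) : Set where
  field
    φ        : Fin (nV H) → Fin (nV G)
    φ-inj    : Injective _≡_ _≡_ φ
    path     : Fin (nE H) → List (Fin (nE G))
    isPath   : ∀ f → IsPath G (φ (tail H f)) (path f) (φ (head H f))
    disjoint : ∀ f f′ → f ≢ f′ → ∀ e → e ∈ path f → e ∉ path f′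
    noInner  : ∀ f u → φ u ∉ internal G (path f)

{-# OPTIONS --safe #-}

-- A carving is turned into a rooted binary tree of vertex sets, and among these trees one is chosen that is linked: for nested sets Y ⊆ X
-- of the tree with the same width w, and no narrower set of the tree in between, every set between Y and X has width at least w. In an
-- Eulerian digraph splitting off then yields w paths from Y to the outside of X and w paths back, all edge-disjoint, so the boundary edges
-- of Y can be numbered along these paths as those of X are. With such numberings the part of the digraph inside Y immerses into the part
-- inside X, and immersions of two siblings glue along boundary edges with the same numbers. Hence the digraph immerses into another one
-- as soon as its tree, labelled by widths and by the finite gluing patterns, embeds into the other tree with Friedman's gap condition.
--
-- That gap embedding has no bad sequence is proved constructively, by residuals instead of minimal bad sequences. Trees with labels ≥ j are
-- a fixpoint μX of trees with labels > j and leaves in X, so gap trees are the values of an expression built from 0, 1, +, × and nested μ.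
-- The values of E not above a given value s embed into the residual of E at s, again such an expression, and passing to residuals
-- is a well-founded relation on expressions.
module Submission where

-- The label of a tree node is the number of edges leaving its set, half of the full boundary since
-- the digraph is Eulerian, so labels stay within the given bound. Numbered boundaries can be
-- compared only between sets of equal width, and by Menger's theorem a numbering passes from a set
-- to a smaller one of the same width only if no narrower cut separates them; this is where the gap
-- condition comes from. The trails that pass it on run outside the smaller set, where no image
-- vertex lies, so the immersion stays strong. A linked tree is not found by minimising: encoding of
-- a tree is attempted, and a failure exhibits a narrow cut, along which the tree is rebuilt into
-- one that is lower in a well-founded order. On the side of the order, the obstacle is that bodies
-- of fixpoints are open expressions: well-foundedness has to be stated with free variables, and a
-- free variable must allow as residual every well-founded expression that does not contain it.

module NestedFixpoints where

  open import Data.Nat using (ℕ; zero; suc; _<_; s≤s; z≤n)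
  open import Data.Product using (∃-syntax; Σ; _×_; _,_)
  open import Data.Sum using (_⊎_; inj₁; inj₂)
  open import Data.Empty using (⊥)
  open import Relation.Binary.PropositionalEquality using (_≡_; refl; sym; cong; cong₂)
  open import Induction.WellFounded using (Acc; acc)
  open import Function using (flip)

  -- Expressions with nested fixpoints and the well-foundedness of their residuals

  infixl 6 _⊕_
  infixl 7 _⊗_
  infixl 5 _▸_

  -- Weakening is a constructor, so that no substitution is ever performed.
  data Exp : ℕ → Set where
    vz  : ∀ {n} → Exp (suc n)
    wk  : ∀ {n} → Exp n → Exp (suc n)
    𝟘 𝟙 : ∀ {n} → Exp n
    _⊕_ _⊗_ : ∀ {n} → Exp n → Exp n → Exp n
    μ   : ∀ {n} → Exp (suc n) → Exp n

  -- A frame `F` gives the newest variable the meaning `μ F`; the `n` variables below the telescope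
  -- stay free. The telescope thus plays the role of a delayed substitution.
  data Tel (n : ℕ) : ℕ → Set where
    ε   : Tel n n
    _▸_ : ∀ {m} → Tel n m → Exp (suc m) → Tel n (suc m)

  -- The shape that is left of an expression once the values above a given one are removed. A pair
  -- is not above another as soon as one component fails, whence the sum in `pair`. In `roll` the
  -- variable survives in `F′` and now means `μ F′`, since a value that is not above the given one
  -- has no recursive part above it. In `top` the residual of the value stored at the variable is
  -- taken, and it lies in the context before the variable.
  data Res {n} (B : Exp n → Exp n → Set) : ∀ {m} → Tel n m → Exp m → Exp m → Set where
    base : ∀ {E E′} → B E E′ → Res B ε E E′
    top  : ∀ {m} {Γ : Tel n m} {F C} → Res B Γ (μ F) C → Res B (Γ ▸ F) vz (wk C)
    pop  : ∀ {m} {Γ : Tel n m} {F E E′} → Res B Γ E E′ → Res B (Γ ▸ F) (wk E) (wk E′)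
    unit : ∀ {m} {Γ : Tel n m} → Res B Γ 𝟙 𝟘
    left : ∀ {m} {Γ : Tel n m} {E E′ F} → Res B Γ E E′ → Res B Γ (E ⊕ F) (E′ ⊕ F)
    right : ∀ {m} {Γ : Tel n m} {E F F′} → Res B Γ F F′ → Res B Γ (E ⊕ F) (E ⊕ F′)
    pair : ∀ {m} {Γ : Tel n m} {E E′ F F′} → Res B Γ E E′ → Res B Γ F F′ →
           Res B Γ (E ⊗ F) ((E′ ⊗ F) ⊕ (E ⊗ F′))
    roll : ∀ {m} {Γ : Tel n m} {F F′} → Res B (Γ ▸ F) F F′ → Res B Γ (μ F) (μ F′)

  -- A residual of the last variable is any good expression in the preceding ones: it stands for the residual of whatever value is bound
  -- to the variable.
  data BStep {n} (R : Exp n → Exp n → Set) : Exp (suc n) → Exp (suc n) → Set where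
    bwk : ∀ {E E′} → R E E′ → BStep R (wk E) (wk E′)
    bvz : ∀ {C} → Acc (flip R) C → BStep R vz (wk C)

  Base : ∀ n → Exp n → Exp n → Set
  Base zero    _ _ = ⊥
  Base (suc n)     = BStep (Res (Base n) ε)

  _⊳_ : ∀ {n} → Exp n → Exp n → Set
  _⊳_ {n} = Res (Base n) ε

  Good : ∀ {n} → Exp n → Set
  Good = Acc (flip _⊳_)

  good-𝟘 : ∀ {n} → Good {n} 𝟘
  good-𝟘 {zero}  = acc λ { (base ()) }
  good-𝟘 {suc n} = acc λ { (base ()) }

  good-𝟙 : ∀ {n} → Good {n} 𝟙
  good-𝟙 {zero}  = acc λ { (base ()) ; unit → good-𝟘 }
  good-𝟙 {suc n} = acc λ { (base ()) ; unit → good-𝟘 }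

  good-wk : ∀ {n} {E : Exp n} → Good E → Good (wk E)
  good-wk (acc h) = acc λ { (base (bwk r)) → good-wk (h r) }

  good-vz : ∀ {n} → Good {suc n} vz
  good-vz = acc λ { (base (bvz g)) → good-wk g }

  good-⊕ : ∀ {n} {E F : Exp n} → Good E → Good F → Good (E ⊕ F)
  good-⊕ {zero} (acc g) (acc h) = acc λ
    { (base ()) ; (left r) → good-⊕ (g r) (acc h) ; (right r) → good-⊕ (acc g) (h r) }
  good-⊕ {suc n} (acc g) (acc h) = acc λ
    { (base ()) ; (left r) → good-⊕ (g r) (acc h) ; (right r) → good-⊕ (acc g) (h r) }

  good-⊗ : ∀ {n} {E F : Exp n} → Good E → Good F → Good (E ⊗ F)
  good-⊗ {zero} (acc g) (acc h) = acc λ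
    { (base ()) ; (pair r s) → good-⊕ (good-⊗ (g r) (acc h)) (good-⊗ (acc g) (h s)) }
  good-⊗ {suc n} (acc g) (acc h) = acc λ
    { (base ()) ; (pair r s) → good-⊕ (good-⊗ (g r) (acc h)) (good-⊗ (acc g) (h s)) }

  -- Forgets the outermost frame `F`, so that its variable becomes free.
  data Opened {n} (F : Exp (suc n)) : ∀ {m} → Tel n m → Tel (suc n) m → Set where
    here : Opened F (ε ▸ F) ε
    skip : ∀ {m} {Γ : Tel n m} {Γ′ H} → Opened F Γ Γ′ → Opened F (Γ ▸ H) (Γ′ ▸ H)

  -- Nested induction: outside on the accessibility of `F`, inside on the derivation of a residual.
  -- A residual of `μ F` is `μ F′` with `F′` derived inside the frame `F`; `open-res` turns this
  -- into a step from `F` with the variable free, and then the outer hypothesis applies to `F′`.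
  good-μ : ∀ {n} {F : Exp (suc n)} → Good F → Good (μ F)
  good-μ-step : ∀ {n} {F : Exp (suc n)} → Good F → ∀ {C} → μ F ⊳ C → Good C
  open-res : ∀ {n} {F : Exp (suc n)} → Good F → ∀ {m} {Γ : Tel n m} {Γ′} → Opened F Γ Γ′ →
             ∀ {E E′} → Res (Base n) Γ E E′ → Res (Base (suc n)) Γ′ E E′

  good-μ g = acc λ r → good-μ-step g r

  good-μ-step {zero} g (base ())
  good-μ-step {suc n} g (base ())
  good-μ-step (acc h) (roll r) = good-μ (h (open-res (acc h) here r))

  -- `r` is a smaller derivation, so its result is already known to be good, as `bvz` demands.
  open-res g here (top r)          = base (bvz (good-μ-step g r))
  open-res g here (pop r)          = base (bwk r)
  open-res g (skip o) (top r)      = top (open-res g o r)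
  open-res g (skip o) (pop r)      = pop (open-res g o r)
  open-res g o unit                = unit
  open-res g o (left r)            = left (open-res g o r)
  open-res g o (right r)           = right (open-res g o r)
  open-res g o (pair r s)          = pair (open-res g o r) (open-res g o s)
  open-res g o (roll r)            = roll (open-res g (skip o) r)

  good : ∀ {n} (E : Exp n) → Good E
  good vz      = good-vz
  good (wk E)  = good-wk (good E)
  good 𝟘       = good-𝟘
  good 𝟙       = good-𝟙
  good (E ⊕ F) = good-⊕ (good E) (good F)
  good (E ⊗ F) = good-⊗ (good E) (good F)
  good (μ F)   = good-μ (good F)

  -- Values, their embedding order and the comparison with a residual

  Ctx : ℕ → Set
  Ctx = Tel 0

  data Val : ∀ {m} → Ctx m → Exp m → Set where
    top  : ∀ {m} {Γ : Ctx m} {F} → Val Γ (μ F) → Val (Γ ▸ F) vz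
    pop  : ∀ {m} {Γ : Ctx m} {F E} → Val Γ E → Val (Γ ▸ F) (wk E)
    unit : ∀ {m} {Γ : Ctx m} → Val Γ 𝟙
    inl  : ∀ {m} {Γ : Ctx m} {E F} → Val Γ E → Val Γ (E ⊕ F)
    inr  : ∀ {m} {Γ : Ctx m} {E F} → Val Γ F → Val Γ (E ⊕ F)
    pair : ∀ {m} {Γ : Ctx m} {E F} → Val Γ E → Val Γ F → Val Γ (E ⊗ F)
    roll : ∀ {m} {Γ : Ctx m} {F} → Val (Γ ▸ F) F → Val Γ (μ F)

  residual : ∀ {m} {Γ : Ctx m} {E} → Val Γ E → Exp m
  residual (top a)            = wk (residual a)
  residual (pop a)            = wk (residual a)
  residual unit               = 𝟘
  residual (inl {F = F} a)    = residual a ⊕ F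
  residual (inr {E = E} a)    = E ⊕ residual a
  residual (pair {E = E} {F} a b) = (residual a ⊗ F) ⊕ (E ⊗ residual b)
  residual (roll a)           = μ (residual a)

  residual-⊳ : ∀ {m} {Γ : Ctx m} {E} (a : Val Γ E) → Res (Base 0) Γ E (residual a)
  residual-⊳ (top a)    = top (residual-⊳ a)
  residual-⊳ (pop a)    = pop (residual-⊳ a)
  residual-⊳ unit       = unit
  residual-⊳ (inl a)    = left (residual-⊳ a)
  residual-⊳ (inr a)    = right (residual-⊳ a)
  residual-⊳ (pair a b) = pair (residual-⊳ a) (residual-⊳ b)
  residual-⊳ (roll a)   = roll (residual-⊳ a)

  data _⊑_ {k} (Γ : Ctx k) : ∀ {m} → Ctx m → Set where
    ⊑-refl : Γ ⊑ Γ
    ⊑-snoc : ∀ {m} {Δ : Ctx m} {H} → Γ ⊑ Δ → Γ ⊑ (Δ ▸ H)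

  -- Occ x e v: x is the content of an occurrence in v of the variable bound by the μ at whose type x lives.
  data Occ {k} {Γ : Ctx k} {F} (x : Val Γ (μ F)) : ∀ {m} {Δ : Ctx m} → (Γ ▸ F) ⊑ Δ → ∀ {E} → Val Δ E → Set where
    here   : Occ x ⊑-refl (top x)
    top    : ∀ {m} {Δ : Ctx m} {e : (Γ ▸ F) ⊑ Δ} {H} {v : Val Δ (μ H)} → Occ x e v → Occ x (⊑-snoc e) (top v)
    pop    : ∀ {m} {Δ : Ctx m} {e : (Γ ▸ F) ⊑ Δ} {H E} {v : Val Δ E} → Occ x e v → Occ x (⊑-snoc {H = H} e) (pop v)
    inl    : ∀ {m} {Δ : Ctx m} {e : (Γ ▸ F) ⊑ Δ} {E H} {v : Val Δ E} → Occ x e v → Occ x e (inl {F = H} v)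
    inr    : ∀ {m} {Δ : Ctx m} {e : (Γ ▸ F) ⊑ Δ} {E H} {v : Val Δ H} → Occ x e v → Occ x e (inr {E = E} v)
    pairˡ  : ∀ {m} {Δ : Ctx m} {e : (Γ ▸ F) ⊑ Δ} {E H} {v : Val Δ E} {w : Val Δ H} → Occ x e v → Occ x e (pair v w)
    pairʳ  : ∀ {m} {Δ : Ctx m} {e : (Γ ▸ F) ⊑ Δ} {E H} {v : Val Δ E} {w : Val Δ H} → Occ x e w → Occ x e (pair v w)
    roll   : ∀ {m} {Δ : Ctx m} {e : (Γ ▸ F) ⊑ Δ} {H} {v : Val (Δ ▸ H) H} → Occ x (⊑-snoc e) v → Occ x e (roll v)

  -- Homeomorphic embedding: `sub` passes to a recursive part of the same fixpoint, which may sit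
  -- below the binders of further fixpoints. This generality is what later skips over the larger
  -- labels of a gap.
  data _≤_ : ∀ {m} {Γ : Ctx m} {E} → Val Γ E → Val Γ E → Set where
    top  : ∀ {m} {Γ : Ctx m} {F} {a b : Val Γ (μ F)} → a ≤ b → top a ≤ top b
    pop  : ∀ {m} {Γ : Ctx m} {F E} {a b : Val Γ E} → a ≤ b → pop {F = F} a ≤ pop b
    unit : ∀ {m} {Γ : Ctx m} → unit {Γ = Γ} ≤ unit
    inl  : ∀ {m} {Γ : Ctx m} {E F} {a b : Val Γ E} → a ≤ b → inl {F = F} a ≤ inl b
    inr  : ∀ {m} {Γ : Ctx m} {E F} {a b : Val Γ F} → a ≤ b → inr {E = E} a ≤ inr b
    pair : ∀ {m} {Γ : Ctx m} {E F} {a b : Val Γ E} {c d : Val Γ F} → a ≤ b → c ≤ d → pair a c ≤ pair b d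
    roll : ∀ {m} {Γ : Ctx m} {F} {a b : Val (Γ ▸ F) F} → a ≤ b → roll a ≤ roll b
    sub  : ∀ {m} {Γ : Ctx m} {F} {a x : Val Γ (μ F)} {b : Val (Γ ▸ F) F} → Occ x ⊑-refl b → a ≤ x → a ≤ roll b

  -- A frame of the context is either kept or replaced by its residual at a fixed ancestor value.
  data Anc : ∀ {m} → Ctx m → Set where
    ε    : Anc ε
    _▸_  : ∀ {m} {Γ : Ctx m} {F} → Anc Γ → Val (Γ ▸ F) F → Anc (Γ ▸ F)
    keep : ∀ {m} {Γ : Ctx m} {F} → Anc Γ → Anc (Γ ▸ F)

  shift : ∀ {m} {Γ : Ctx m} → Anc Γ → Ctx m
  shift ε                = ε
  shift (η ▸ s)          = shift η ▸ residual s
  shift (keep {F = F} η) = shift η ▸ F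

  -- Residual values are genuine values of the original expression. `back′` treats the
  -- subexpressions that the residual leaves alone: only the meaning of their variables has changed,
  -- so the work happens at `vz`.
  back  : ∀ {m} {Γ : Ctx m} {E} (s : Val Γ E) (η : Anc Γ) → Val (shift η) (residual s) → Val Γ E
  back′ : ∀ {m} {Γ : Ctx m} (E : Exp m) (η : Anc Γ) → Val (shift η) E → Val Γ E
  back (top s) (η ▸ _)  (pop v) = top (back s η v)
  back (top s) (keep η) (pop v) = top (back s η v)
  back (pop s) (η ▸ _)  (pop v) = pop (back s η v)
  back (pop s) (keep η) (pop v) = pop (back s η v)
  back unit η ()
  back (inl s) η (inl v) = inl (back s η v)
  back (inl s) η (inr v) = inr (back′ _ η v)
  back (inr s) η (inl v) = inl (back′ _ η v)
  back (inr s) η (inr v) = inr (back s η v)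
  back (pair s t) η (inl (pair v w)) = pair (back s η v) (back′ _ η w)
  back (pair s t) η (inr (pair v w)) = pair (back′ _ η v) (back t η w)
  back (roll s) η (roll v) = roll (back s (η ▸ s) v)
  back′ vz (η ▸ s)  (top v) = top (back (roll s) η v)
  back′ vz (keep η) (top v) = top (back′ _ η v)
  back′ (wk E) (η ▸ s)  (pop v) = pop (back′ _ η v)
  back′ (wk E) (keep η) (pop v) = pop (back′ _ η v)
  back′ 𝟙 η unit = unit
  back′ (E ⊕ F) η (inl v) = inl (back′ E η v)
  back′ (E ⊕ F) η (inr v) = inr (back′ F η v)
  back′ (E ⊗ F) η (pair v w) = pair (back′ E η v) (back′ F η w)
  back′ (μ F) η (roll v) = roll (back′ F (keep η) v)

  data Ext {k} {Γ₀ : Ctx k} (η₀ : Anc Γ₀) : ∀ {m} {Γ : Ctx m} → Anc Γ → Set where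
    ext-refl : Ext η₀ η₀
    ext-▸    : ∀ {m} {Γ : Ctx m} {η : Anc Γ} {F} {s : Val (Γ ▸ F) F} → Ext η₀ η → Ext η₀ (η ▸ s)
    ext-keep : ∀ {m} {Γ : Ctx m} {η : Anc Γ} {F} → Ext η₀ η → Ext η₀ (keep {F = F} η)

  before : ∀ {k} {Γ₀ : Ctx k} {η₀ : Anc Γ₀} {m} {Γ : Ctx m} {η : Anc Γ} → Ext η₀ η → Γ₀ ⊑ Γ
  before ext-refl     = ⊑-refl
  before (ext-▸ e)    = ⊑-snoc (before e)
  before (ext-keep e) = ⊑-snoc (before e)

  after : ∀ {k} {Γ₀ : Ctx k} {η₀ : Anc Γ₀} {m} {Γ : Ctx m} {η : Anc Γ} → Ext η₀ η → shift η₀ ⊑ shift η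
  after ext-refl     = ⊑-refl
  after (ext-▸ e)    = ⊑-snoc (after e)
  after (ext-keep e) = ⊑-snoc (after e)

  module _ {k} {Γ₀ : Ctx k} {F} {η₀ : Anc Γ₀} {s₀ : Val (Γ₀ ▸ F) F} {x : Val (shift η₀) (μ (residual s₀))} where
    -- The `sub` rule must survive reading back, so a recursive part has to remain one, with its
    -- content read back as well. Here the fixpoint was replaced by its residual; the next module
    -- treats a fixpoint that is kept.
    back-occ  : ∀ {m} {Γ : Ctx m} {η : Anc Γ} (e : Ext (η₀ ▸ s₀) η) {E} (s : Val Γ E) (v : Val (shift η) (residual s)) →
                Occ x (after e) v → Occ (back (roll s₀) η₀ x) (before e) (back s η v)
    back-occ′ : ∀ {m} {Γ : Ctx m} {η : Anc Γ} (e : Ext (η₀ ▸ s₀) η) {E} (v : Val (shift η) E) →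
                Occ x (after e) v → Occ (back (roll s₀) η₀ x) (before e) (back′ _ η v)
    back-occ (ext-▸ e) (top s) (pop v) (pop o) = top (back-occ e s v o)
    back-occ (ext-keep e) (top s) (pop v) (pop o) = top (back-occ e s v o)
    back-occ (ext-▸ e) (pop s) (pop v) (pop o) = pop (back-occ e s v o)
    back-occ (ext-keep e) (pop s) (pop v) (pop o) = pop (back-occ e s v o)
    back-occ e (inl s) (inl v) (inl o) = inl (back-occ e s v o)
    back-occ e (inl s) (inr v) (inr o) = inr (back-occ′ e v o)
    back-occ e (inr s) (inl v) (inl o) = inl (back-occ′ e v o)
    back-occ e (inr s) (inr v) (inr o) = inr (back-occ e s v o)
    back-occ e (pair s t) (inl (pair v w)) (inl (pairˡ o)) = pairˡ (back-occ e s v o)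
    back-occ e (pair s t) (inl (pair v w)) (inl (pairʳ o)) = pairʳ (back-occ′ e w o)
    back-occ e (pair s t) (inr (pair v w)) (inr (pairˡ o)) = pairˡ (back-occ′ e v o)
    back-occ e (pair s t) (inr (pair v w)) (inr (pairʳ o)) = pairʳ (back-occ e t w o)
    back-occ e (roll s) (roll v) (roll o) = roll (back-occ (ext-▸ e) s v o)
    back-occ′ ext-refl (top v) here = here
    back-occ′ (ext-▸ e) (top v) (top o) = top (back-occ e _ v o)
    back-occ′ (ext-keep e) (top v) (top o) = top (back-occ′ e v o)
    back-occ′ (ext-▸ e) (pop v) (pop o) = pop (back-occ′ e v o)
    back-occ′ (ext-keep e) (pop v) (pop o) = pop (back-occ′ e v o)
    back-occ′ e (inl v) (inl o) = inl (back-occ′ e v o)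
    back-occ′ e (inr v) (inr o) = inr (back-occ′ e v o)
    back-occ′ e (pair v w) (pairˡ o) = pairˡ (back-occ′ e v o)
    back-occ′ e (pair v w) (pairʳ o) = pairʳ (back-occ′ e w o)
    back-occ′ e (roll v) (roll o) = roll (back-occ′ (ext-keep e) v o)

  module _ {k} {Γ₀ : Ctx k} {F} {η₀ : Anc Γ₀} {x : Val (shift η₀) (μ F)} where
    keep-occ  : ∀ {m} {Γ : Ctx m} {η : Anc Γ} (e : Ext (keep {F = F} η₀) η) {E} (s : Val Γ E) (v : Val (shift η) (residual s)) →
                Occ x (after e) v → Occ (back′ _ η₀ x) (before e) (back s η v)
    keep-occ′ : ∀ {m} {Γ : Ctx m} {η : Anc Γ} (e : Ext (keep {F = F} η₀) η) {E} (v : Val (shift η) E) →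
                Occ x (after e) v → Occ (back′ _ η₀ x) (before e) (back′ _ η v)
    keep-occ (ext-▸ e) (top s) (pop v) (pop o) = top (keep-occ e s v o)
    keep-occ (ext-keep e) (top s) (pop v) (pop o) = top (keep-occ e s v o)
    keep-occ (ext-▸ e) (pop s) (pop v) (pop o) = pop (keep-occ e s v o)
    keep-occ (ext-keep e) (pop s) (pop v) (pop o) = pop (keep-occ e s v o)
    keep-occ e (inl s) (inl v) (inl o) = inl (keep-occ e s v o)
    keep-occ e (inl s) (inr v) (inr o) = inr (keep-occ′ e v o)
    keep-occ e (inr s) (inl v) (inl o) = inl (keep-occ′ e v o)
    keep-occ e (inr s) (inr v) (inr o) = inr (keep-occ e s v o)
    keep-occ e (pair s t) (inl (pair v w)) (inl (pairˡ o)) = pairˡ (keep-occ e s v o)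
    keep-occ e (pair s t) (inl (pair v w)) (inl (pairʳ o)) = pairʳ (keep-occ′ e w o)
    keep-occ e (pair s t) (inr (pair v w)) (inr (pairˡ o)) = pairˡ (keep-occ′ e v o)
    keep-occ e (pair s t) (inr (pair v w)) (inr (pairʳ o)) = pairʳ (keep-occ e t w o)
    keep-occ e (roll s) (roll v) (roll o) = roll (keep-occ (ext-▸ e) s v o)
    keep-occ′ ext-refl (top v) here = here
    keep-occ′ (ext-▸ e) (top v) (top o) = top (keep-occ e _ v o)
    keep-occ′ (ext-keep e) (top v) (top o) = top (keep-occ′ e v o)
    keep-occ′ (ext-▸ e) (pop v) (pop o) = pop (keep-occ′ e v o)
    keep-occ′ (ext-keep e) (pop v) (pop o) = pop (keep-occ′ e v o)
    keep-occ′ e (inl v) (inl o) = inl (keep-occ′ e v o)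
    keep-occ′ e (inr v) (inr o) = inr (keep-occ′ e v o)
    keep-occ′ e (pair v w) (pairˡ o) = pairˡ (keep-occ′ e v o)
    keep-occ′ e (pair v w) (pairʳ o) = pairʳ (keep-occ′ e w o)
    keep-occ′ e (roll v) (roll o) = roll (keep-occ′ (ext-keep e) v o)

  back-mono  : ∀ {m} {Γ : Ctx m} {E} (η : Anc Γ) (s : Val Γ E) {v w : Val (shift η) (residual s)} →
               v ≤ w → back s η v ≤ back s η w
  back-mono′ : ∀ {m} {Γ : Ctx m} {E} (η : Anc Γ) {v w : Val (shift η) E} → v ≤ w → back′ _ η v ≤ back′ _ η w
  back-mono (η ▸ _)  (top s) (pop p) = top (back-mono η s p)
  back-mono (keep η) (top s) (pop p) = top (back-mono η s p)
  back-mono (η ▸ _)  (pop s) (pop p) = pop (back-mono η s p)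
  back-mono (keep η) (pop s) (pop p) = pop (back-mono η s p)
  back-mono η (inl s) (inl p) = inl (back-mono η s p)
  back-mono η (inl s) (inr p) = inr (back-mono′ η p)
  back-mono η (inr s) (inl p) = inl (back-mono′ η p)
  back-mono η (inr s) (inr p) = inr (back-mono η s p)
  back-mono η (pair s t) (inl (pair p q)) = pair (back-mono η s p) (back-mono′ η q)
  back-mono η (pair s t) (inr (pair p q)) = pair (back-mono′ η p) (back-mono η t q)
  back-mono η (roll s) (roll p) = roll (back-mono (η ▸ s) s p)
  back-mono η (roll s) (sub {b = b} o p) = sub (back-occ ext-refl s b o) (back-mono η (roll s) p)
  back-mono′ (η ▸ s)  (top p) = top (back-mono η (roll s) p)
  back-mono′ (keep η) (top p) = top (back-mono′ η p)
  back-mono′ (η ▸ s)  (pop p) = pop (back-mono′ η p)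
  back-mono′ (keep η) (pop p) = pop (back-mono′ η p)
  back-mono′ η unit = unit
  back-mono′ η (inl p) = inl (back-mono′ η p)
  back-mono′ η (inr p) = inr (back-mono′ η p)
  back-mono′ η (pair p q) = pair (back-mono′ η p) (back-mono′ η q)
  back-mono′ η (roll p) = roll (back-mono′ (keep η) p)
  back-mono′ η (sub {b = b} o p) = sub (keep-occ′ ext-refl b o) (back-mono′ η p)

  -- A component may fail to move into the residual because a recursive part of an enclosing
  -- fixpoint is above the value compared there. This is reported upwards; at that fixpoint
  -- `exc-roll` makes it an instance of `sub`, hence a success.
  data Exc {m} {Γ : Ctx m} (η : Anc Γ) {E} (v : Val Γ E) : Set where
    exc : ∀ {k} {Γ₀ : Ctx k} {F} {η₀ : Anc Γ₀} {s₀ : Val (Γ₀ ▸ F) F} {x : Val Γ₀ (μ F)} (e : Ext (η₀ ▸ s₀) η) →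
          Occ x (before e) v → roll s₀ ≤ x → Exc η v

  exc-map : ∀ {m} {Γ : Ctx m} {η : Anc Γ} {E E′} {v : Val Γ E} {w : Val Γ E′} →
            (∀ {k} {Γ₀ : Ctx k} {F} {x : Val Γ₀ (μ F)} {e : (Γ₀ ▸ F) ⊑ Γ} → Occ x e v → Occ x e w) → Exc η v → Exc η w
  exc-map f (exc e o p) = exc e (f o) p

  exc-keep : ∀ {m} {Γ : Ctx m} {η : Anc Γ} {F} {u : Val (Γ ▸ F) F} → Exc (keep η) u → Exc η (roll u)
  exc-keep (exc (ext-keep e) o p) = exc e (roll o) p

  exc-roll : ∀ {m} {Γ : Ctx m} {η : Anc Γ} {F} {s u : Val (Γ ▸ F) F} → Exc (η ▸ s) u → Exc η (roll u) ⊎ roll s ≤ roll u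
  exc-roll (exc ext-refl o p)  = inj₂ (sub o p)
  exc-roll (exc (ext-▸ e) o p) = inj₁ (exc e (roll o) p)

  data Cmp {m} {Γ : Ctx m} (η : Anc Γ) {E} (s t : Val Γ E) : Set where
    raise : Exc η t → Cmp η s t
    above : s ≤ t → Cmp η s t
    below : (v : Val (shift η) (residual s)) → back s η v ≡ t → Cmp η s t

  data Mov {m} {Γ : Ctx m} (η : Anc Γ) {E} (t : Val Γ E) : Set where
    raise : Exc η t → Mov η t
    moved : (v : Val (shift η) E) → back′ E η v ≡ t → Mov η t

  -- Where excluded middle would ask whether `s ≤ t`, the recursion computes either the embedding or
  -- a residual value that reads back to `t`. `mov` handles a component that faces no comparison of
  -- its own: it can obstruct only at variables of replaced frames.
  cmp : ∀ {m} {Γ : Ctx m} (η : Anc Γ) {E} (s t : Val Γ E) → Cmp η s t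
  mov : ∀ {m} {Γ : Ctx m} (η : Anc Γ) {E} (t : Val Γ E) → Mov η t

  cmp (η ▸ _) (top s) (top t) with cmp η s t
  ... | raise (exc e o p) = raise (exc (ext-▸ e) (top o) p)
  ... | above p           = above (top p)
  ... | below v q         = below (pop v) (cong top q)
  cmp (keep η) (top s) (top t) with cmp η s t
  ... | raise (exc e o p) = raise (exc (ext-keep e) (top o) p)
  ... | above p           = above (top p)
  ... | below v q         = below (pop v) (cong top q)
  cmp (η ▸ _) (pop s) (pop t) with cmp η s t
  ... | raise (exc e o p) = raise (exc (ext-▸ e) (pop o) p)
  ... | above p           = above (pop p)
  ... | below v q         = below (pop v) (cong pop q)
  cmp (keep η) (pop s) (pop t) with cmp η s t
  ... | raise (exc e o p) = raise (exc (ext-keep e) (pop o) p)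
  ... | above p           = above (pop p)
  ... | below v q         = below (pop v) (cong pop q)
  cmp η unit unit = above unit
  cmp η (inl s) (inl t) with cmp η s t
  ... | raise x   = raise (exc-map inl x)
  ... | above p   = above (inl p)
  ... | below v q = below (inl v) (cong inl q)
  cmp η (inr s) (inr t) with cmp η s t
  ... | raise x   = raise (exc-map inr x)
  ... | above p   = above (inr p)
  ... | below v q = below (inr v) (cong inr q)
  cmp η (inl s) (inr t) with mov η t
  ... | raise x   = raise (exc-map inr x)
  ... | moved v q = below (inr v) (cong inr q)
  cmp η (inr s) (inl t) with mov η t
  ... | raise x   = raise (exc-map inl x)
  ... | moved v q = below (inl v) (cong inl q)
  cmp η (pair s s′) (pair t t′) with cmp η s t
  ... | raise x   = raise (exc-map pairˡ x)
  ... | below v q with mov η t′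
  ...   | raise x    = raise (exc-map pairʳ x)
  ...   | moved w q′ = below (inl (pair v w)) (cong₂ pair q q′)
  cmp η (pair s s′) (pair t t′) | above p with cmp η s′ t′
  ...   | raise x    = raise (exc-map pairʳ x)
  ...   | above p′   = above (pair p p′)
  ...   | below w q′ with mov η t
  ...     | raise x   = raise (exc-map pairˡ x)
  ...     | moved v q = below (inr (pair v w)) (cong₂ pair q q′)
  cmp η (roll s) (roll t) with cmp (η ▸ s) s t
  ... | above p   = above (roll p)
  ... | below v q = below (roll v) (cong roll q)
  ... | raise x with exc-roll x
  ...   | inj₁ y = raise y
  ...   | inj₂ p = above p

  mov (η ▸ s) (top t) with cmp η (roll s) t
  ... | raise (exc e o p) = raise (exc (ext-▸ e) (top o) p)
  -- The content of the variable is above the value of its frame: this is the source of every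
  -- exception.
  ... | above p           = raise (exc ext-refl here p)
  ... | below v q         = moved (top v) (cong top q)
  mov (keep η) (top t) with mov η t
  ... | raise (exc e o p) = raise (exc (ext-keep e) (top o) p)
  ... | moved v q         = moved (top v) (cong top q)
  mov (η ▸ _) (pop t) with mov η t
  ... | raise (exc e o p) = raise (exc (ext-▸ e) (pop o) p)
  ... | moved v q         = moved (pop v) (cong pop q)
  mov (keep η) (pop t) with mov η t
  ... | raise (exc e o p) = raise (exc (ext-keep e) (pop o) p)
  ... | moved v q         = moved (pop v) (cong pop q)
  mov η unit = moved unit refl
  mov η (inl t) with mov η t
  ... | raise x   = raise (exc-map inl x)
  ... | moved v q = moved (inl v) (cong inl q)
  mov η (inr t) with mov η t
  ... | raise x   = raise (exc-map inr x)
  ... | moved v q = moved (inr v) (cong inr q)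
  mov η (pair t t′) with mov η t
  ... | raise x   = raise (exc-map pairˡ x)
  ... | moved v q with mov η t′
  ...   | raise x    = raise (exc-map pairʳ x)
  ...   | moved w q′ = moved (pair v w) (cong₂ pair q q′)
  mov η (roll t) with mov (keep η) t
  ... | raise x   = raise (exc-keep x)
  ... | moved v q = moved (roll v) (cong roll q)

  compare : ∀ {E} (s t : Val ε E) → s ≤ t ⊎ (Σ (Val ε (residual s)) λ v → back s ε v ≡ t)
  compare s t with cmp ε s t
  ... | raise (exc () _ _)
  ... | above p   = inj₁ p
  ... | below v q = inj₂ (v , q)

  GoodPair : ∀ {E} {A : Set} → (ℕ → Val ε E ⊎ A) → Set
  GoodPair {E} f = ∃[ i ] ∃[ j ] ∃[ s ] ∃[ t ] (i < j × f i ≡ inj₁ s × f j ≡ inj₁ t × s ≤ t)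

  -- The exit type `A` carries the recursion: after the first value `s`, each later value either
  -- lies above `s`, which ends the search, or moves into the residual at `s`. Read in the residual,
  -- the sequence exits exactly when a pair with `s` has been found or the old exit is reached, so
  -- no bad sequence is ever spoken of.
  find : ∀ {E} → Good E → ∀ {A : Set} (f : ℕ → Val ε E ⊎ A) → GoodPair f ⊎ A
  find {E} (acc h) {A} f with f 0 in f0
  ... | inj₂ a = inj₂ a
  ... | inj₁ s = conclude (find (h (residual-⊳ s)) g)
    where
    step : (j : ℕ) (r : Val ε E ⊎ A) → f (suc j) ≡ r → Val ε (residual s) ⊎ (GoodPair f ⊎ A)
    step j (inj₂ a) eq = inj₂ (inj₂ a)
    step j (inj₁ t) eq with compare s t
    ... | inj₁ p       = inj₂ (inj₁ (0 , suc j , s , t , s≤s z≤n , f0 , eq , p))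
    ... | inj₂ (v , _) = inj₁ v
    g : ℕ → Val ε (residual s) ⊎ (GoodPair f ⊎ A)
    g j = step j (f (suc j)) refl
    step-back : ∀ j r (eq : f (suc j) ≡ r) {v} → step j r eq ≡ inj₁ v → r ≡ inj₁ (back s ε v)
    step-back j (inj₁ t) eq q with compare s t
    step-back j (inj₁ t) eq refl | inj₂ (v , q′) = cong inj₁ (sym q′)
    conclude : GoodPair g ⊎ (GoodPair f ⊎ A) → GoodPair f ⊎ A
    conclude (inj₂ r) = r
    conclude (inj₁ (i , j , v , w , i<j , gi , gj , p)) =
      inj₁ (suc i , suc j , back s ε v , back s ε w , s≤s i<j ,
            step-back i _ refl gi , step-back j _ refl gj , back-mono ε s p)

  kruskal : ∀ {E} (f : ℕ → Val ε E) → ∃[ i ] ∃[ j ] (i < j × f i ≤ f j)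
  kruskal {E} f with find (good E) {⊥} (λ i → inj₁ (f i))
  ... | inj₁ (i , j , _ , _ , i<j , refl , refl , p) = i , j , i<j , p

-- Trees under the gap embedding as values of nested fixpoints

module GapOrder where

  open NestedFixpoints
  open import Data.Nat as ℕ using (ℕ; zero; suc; _<_; s≤s; z≤n; _+_)
  open import Data.Nat.Properties as ℕₚ using (m≤n⇒m<n∨m≡n; +-suc; +-identityʳ; ≤-refl; m≤n⇒m≤1+n; ≤-trans)
  open import Data.Fin using (Fin; zero; suc; toℕ; fromℕ<)
  open import Data.Fin.Properties using (toℕ-fromℕ<)
  open import Data.Product using (∃-syntax; Σ; _×_; _,_; proj₁; proj₂)
  open import Data.Sum using (_⊎_; inj₁; inj₂)
  open import Data.Empty using (⊥; ⊥-elim)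
  open import Relation.Binary.PropositionalEquality using (_≡_; refl; sym; trans; cong; cong₂; subst; subst₂)

  data Tree (N : ℕ) : ℕ → Set where
    leaf : ∀ j → ℕ → Tree N j
    node : ∀ j {a b} → Fin N → Tree N a → Tree N b → Tree N j

  -- The gap condition: u is joined to the root of t by labels exceeding its own.
  data In {N j} (u : Tree N j) : ∀ {i} → Tree N i → Set where
    here : In u u
    inˡ  : ∀ {i a b τ} {l : Tree N a} {r : Tree N b} → j < i → In u l → In u (node i τ l r)
    inʳ  : ∀ {i a b τ} {l : Tree N a} {r : Tree N b} → j < i → In u r → In u (node i τ l r)

  -- A link goes from a root labelled `j` to another node labelled `j` across larger labels only. A
  -- chain of links thus descends through labels at least `j`, with equality at both ends, as
  -- Friedman's condition asks.
  data _≼_ {N} : ∀ {j} → Tree N j → Tree N j → Set where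
    leaf  : ∀ {j x y} → x ℕ.≤ y → leaf j x ≼ leaf j y
    node  : ∀ {j a b τ} {l l′ : Tree N a} {r r′ : Tree N b} → l ≼ l′ → r ≼ r′ → node j τ l r ≼ node j τ l′ r′
    linkˡ : ∀ {j a b τ} {s u : Tree N j} {l : Tree N a} {r : Tree N b} → In u l → s ≼ u → s ≼ node j τ l r
    linkʳ : ∀ {j a b τ} {s u : Tree N j} {l : Tree N a} {r : Tree N b} → In u r → s ≼ u → s ≼ node j τ l r

  data _≼Σ_ {N} : Σ ℕ (Tree N) → Σ ℕ (Tree N) → Set where
    same : ∀ {j} {s t : Tree N j} → s ≼ t → (j , s) ≼Σ (j , t)

  data Bounded {N} (K : ℕ) : ∀ {j} → Tree N j → Set where
    leaf : ∀ {j x} → j ℕ.≤ K → Bounded K (leaf j x)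
    node : ∀ {j a b τ} {l : Tree N a} {r : Tree N b} → j ℕ.≤ K → Bounded K l → Bounded K r → Bounded K (node j τ l r)

  fin : ∀ {n} → ℕ → Exp n
  fin zero    = 𝟘
  fin (suc k) = 𝟙 ⊕ fin k

  fin-decode : ∀ {m} {Γ : Ctx m} k → Val Γ (fin k) → Fin k
  fin-decode (suc k) (inl unit) = zero
  fin-decode (suc k) (inr v)    = suc (fin-decode k v)

  fin-encode : ∀ {m} {Γ : Ctx m} {k} → Fin k → Val Γ (fin k)
  fin-encode zero    = inl unit
  fin-encode (suc i) = inr (fin-encode i)

  fin-decode-encode : ∀ {m} {Γ : Ctx m} {k} (i : Fin k) → fin-decode {Γ = Γ} k (fin-encode i) ≡ i
  fin-decode-encode zero    = refl
  fin-decode-encode (suc i) = cong suc (fin-decode-encode i)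

  fin-mono : ∀ {m} {Γ : Ctx m} k {v w : Val Γ (fin k)} → v ≤ w → fin-decode k v ≡ fin-decode k w
  fin-mono (suc k) (inl unit) = refl
  fin-mono (suc k) (inr p)    = cong suc (fin-mono k p)

  nat : ∀ {n} → Exp n
  nat = μ (𝟙 ⊕ vz)

  nat-decode : ∀ {m} {Γ : Ctx m} → Val Γ nat → ℕ
  nat-decode (roll (inl unit))    = 0
  nat-decode (roll (inr (top v))) = suc (nat-decode v)

  nat-encode : ∀ {m} {Γ : Ctx m} → ℕ → Val Γ nat
  nat-encode zero    = roll (inl unit)
  nat-encode (suc x) = roll (inr (top (nat-encode x)))

  nat-decode-encode : ∀ {m} {Γ : Ctx m} x → nat-decode {Γ = Γ} (nat-encode x) ≡ x
  nat-decode-encode zero    = refl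
  nat-decode-encode (suc x) = cong suc (nat-decode-encode x)

  nat-mono : ∀ {m} {Γ : Ctx m} {v w : Val Γ nat} → v ≤ w → nat-decode v ℕ.≤ nat-decode w
  nat-mono (roll (inl unit))    = z≤n
  nat-mono (roll (inr (top p))) = s≤s (nat-mono p)
  nat-mono (sub (inr here) p)   = m≤n⇒m≤1+n (nat-mono p)

  fin-closed : ∀ {k} {Γ : Ctx k} {F} {x : Val Γ (μ F)} {m} {Δ : Ctx m} {e : (Γ ▸ F) ⊑ Δ} k′ {v : Val Δ (fin k′)} → Occ x e v → ⊥
  fin-closed (suc k′) (inl ())
  fin-closed (suc k′) (inr o) = fin-closed k′ o

  nat-closed : ∀ {k} {Γ : Ctx k} {F} {x : Val Γ (μ F)} {m} {Δ : Ctx m} {e : (Γ ▸ F) ⊑ Δ} {v : Val Δ nat} → Occ x e v → ⊥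
  nat-closed (roll (inl ()))
  nat-closed (roll (inr (top o))) = nat-closed o

  module GapTrees (K N : ℕ) where

    leafE : ∀ {n} → Exp n
    leafE = fin (suc K) ⊗ nat

    -- trees d j E: trees with root label in {j, …, j+d-1} or in E; rooted d j E: those with root label j.
    trees rooted : ∀ {n} → ℕ → ℕ → Exp n → Exp n
    frame : ∀ {n} → ℕ → ℕ → Exp n → Exp (suc n)
    trees zero    j E = E
    trees (suc d) j E = trees d (suc j) (E ⊕ rooted d j E)
    rooted d j E = μ (frame d j E)
    frame d j E = fin N ⊗ (trees d (suc j) (wk E ⊕ vz) ⊗ trees d (suc j) (wk E ⊕ vz))

    -- The expressions that stand for sets of trees. A derivation records the label `j` of each
    -- frame, which the bare expression does not show but `tree` must write at the root.
    data Ty : ∀ {m} → Ctx m → Exp m → Set where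
      leafT : ∀ {m} {Γ : Ctx m} → Ty Γ leafE
      wkT   : ∀ {m} {Γ : Ctx m} {F E} → Ty Γ E → Ty (Γ ▸ F) (wk E)
      vzT   : ∀ {m} {Γ : Ctx m} {E} d j → Ty Γ E → Ty (Γ ▸ frame d j E) vz
      sumT  : ∀ {m} {Γ : Ctx m} {E F} → Ty Γ E → Ty Γ F → Ty Γ (E ⊕ F)
      muT   : ∀ {m} {Γ : Ctx m} {E} d j → Ty Γ E → Ty Γ (rooted d j E)

    treesT : ∀ {m} {Γ : Ctx m} {E} d j → Ty Γ E → Ty Γ (trees d j E)
    treesT zero    j T = T
    treesT (suc d) j T = treesT d (suc j) (sumT T (muT d j T))

    innerT : ∀ {m} {Γ : Ctx m} {E} d j → Ty Γ E → Ty (Γ ▸ frame d j E) (trees d (suc j) (wk E ⊕ vz))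
    innerT d j T = treesT d (suc j) (sumT (wkT T) (vzT d j T))

    tree  : ∀ {m} {Γ : Ctx m} {E} → Ty Γ E → Val Γ E → Σ ℕ (Tree N)
    treeμ : ∀ {m} {Γ : Ctx m} {E} d j → Ty Γ E → Val Γ (rooted d j E) → Tree N j
    tree leafT (pair i x)      = toℕ (fin-decode (suc K) i) , leaf _ (nat-decode x)
    tree (wkT T) (pop v)       = tree T v
    tree (vzT d j T) (top v)   = j , treeμ d j T v
    tree (sumT T T′) (inl v)   = tree T v
    tree (sumT T T′) (inr v)   = tree T′ v
    tree (muT d j T) v         = j , treeμ d j T v
    treeμ d j T (roll (pair τ (pair l r))) =
      node j (fin-decode N τ) (proj₂ (tree (innerT d j T) l)) (proj₂ (tree (innerT d j T) r))

    -- Ensures that on the way to any occurrence of the variable of `frame d j E₀` only frames with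
    -- labels above `j` are passed. This is how occurrences turn into the gap relation `In`.
    data Safe {k} {Γ₀ : Ctx k} {E₀} (d j : ℕ) (T₀ : Ty Γ₀ E₀) :
              ∀ {m} {Δ : Ctx m} → (Γ₀ ▸ frame d j E₀) ⊑ Δ → ∀ {E} → Ty Δ E → Set where
      leafS  : ∀ {m} {Δ : Ctx m} {e : (Γ₀ ▸ frame d j E₀) ⊑ Δ} → Safe d j T₀ e leafT
      wk₀S   : ∀ {E} {T : Ty Γ₀ E} → Safe d j T₀ ⊑-refl (wkT T)
      vz₀S   : Safe d j T₀ ⊑-refl (vzT d j T₀)
      wkS    : ∀ {m} {Δ : Ctx m} {e : (Γ₀ ▸ frame d j E₀) ⊑ Δ} {F E} {T : Ty Δ E} → Safe d j T₀ e T → Safe d j T₀ (⊑-snoc {H = F} e) (wkT T)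
      vzS    : ∀ {m} {Δ : Ctx m} {e : (Γ₀ ▸ frame d j E₀) ⊑ Δ} {E} {T : Ty Δ E} {d′ j′} → j < j′ → Safe d j T₀ e T →
               Safe d j T₀ (⊑-snoc e) (vzT d′ j′ T)
      sumS   : ∀ {m} {Δ : Ctx m} {e : (Γ₀ ▸ frame d j E₀) ⊑ Δ} {E E′} {T : Ty Δ E} {T′ : Ty Δ E′} → Safe d j T₀ e T → Safe d j T₀ e T′ →
               Safe d j T₀ e (sumT T T′)
      muS    : ∀ {m} {Δ : Ctx m} {e : (Γ₀ ▸ frame d j E₀) ⊑ Δ} {E} {T : Ty Δ E} {d′ j′} → j < j′ → Safe d j T₀ e T →
               Safe d j T₀ e (muT d′ j′ T)

    trees-safe : ∀ {k} {Γ₀ : Ctx k} {E₀ d j} {T₀ : Ty Γ₀ E₀} {m} {Δ : Ctx m} {e : (Γ₀ ▸ frame d j E₀) ⊑ Δ} {E} {T : Ty Δ E} d′ {j′} →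
                 j < j′ → Safe d j T₀ e T → Safe d j T₀ e (treesT d′ j′ T)
    trees-safe zero    lt S = S
    trees-safe (suc d) lt S = trees-safe d (m≤n⇒m≤1+n lt) (sumS S (muS lt S))

    occ-in  : ∀ {k} {Γ₀ : Ctx k} {E₀ d j} {T₀ : Ty Γ₀ E₀} {x : Val Γ₀ (rooted d j E₀)} {m} {Δ : Ctx m}
              {e : (Γ₀ ▸ frame d j E₀) ⊑ Δ} {E} {T : Ty Δ E} {v : Val Δ E} →
              Safe d j T₀ e T → Occ x e v → In (treeμ d j T₀ x) (proj₂ (tree T v))
    occ-inμ : ∀ {k} {Γ₀ : Ctx k} {E₀ d j} {T₀ : Ty Γ₀ E₀} {x : Val Γ₀ (rooted d j E₀)} {m} {Δ : Ctx m}
              {e : (Γ₀ ▸ frame d j E₀) ⊑ Δ} {E} {T : Ty Δ E} {d′ j′} {v : Val Δ (rooted d′ j′ E)} →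
              j < j′ → Safe d j T₀ e T → Occ x e v → In (treeμ d j T₀ x) (treeμ d′ j′ T v)
    occ-in leafS (pairˡ o)          = ⊥-elim (fin-closed (suc K) o)
    occ-in leafS (pairʳ o)          = ⊥-elim (nat-closed o)
    occ-in wk₀S ()
    occ-in vz₀S here                = here
    occ-in (wkS S) (pop o)          = occ-in S o
    occ-in (vzS lt S) (top o)       = occ-inμ lt S o
    occ-in (sumS S S′) (inl o)      = occ-in S o
    occ-in (sumS S S′) (inr o)      = occ-in S′ o
    occ-in (muS lt S) o             = occ-inμ lt S o
    occ-inμ lt S (roll {v = pair _ (pair _ _)} (pairˡ o)) = ⊥-elim (fin-closed N o)
    occ-inμ {d′ = d′} lt S (roll {v = pair _ (pair _ _)} (pairʳ (pairˡ o))) =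
      inˡ lt (occ-in (trees-safe d′ (m≤n⇒m≤1+n lt) (sumS (wkS S) (vzS lt S))) o)
    occ-inμ {d′ = d′} lt S (roll {v = pair _ (pair _ _)} (pairʳ (pairʳ o))) =
      inʳ lt (occ-in (trees-safe d′ (m≤n⇒m≤1+n lt) (sumS (wkS S) (vzS lt S))) o)

    node-≼ : ∀ {j τ τ′} {p p′ q q′ : Σ ℕ (Tree N)} → τ ≡ τ′ → p ≼Σ p′ → q ≼Σ q′ →
             node j τ (proj₂ p) (proj₂ q) ≼ node j τ′ (proj₂ p′) (proj₂ q′)
    node-≼ refl (same p) (same q) = node p q

    leaf-≼ : ∀ {i i′ x x′} → i ≡ i′ → x ℕ.≤ x′ → _≼Σ_ {N} (i , leaf i x) (i′ , leaf i′ x′)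
    leaf-≼ refl p = same (leaf p)

    tree-mono  : ∀ {m} {Γ : Ctx m} {E} (T : Ty Γ E) {v w : Val Γ E} → v ≤ w → tree T v ≼Σ tree T w
    treeμ-mono : ∀ {m} {Γ : Ctx m} {E} d j (T : Ty Γ E) {v w : Val Γ (rooted d j E)} → v ≤ w → treeμ d j T v ≼ treeμ d j T w
    tree-mono leafT (pair p q)      = leaf-≼ (cong toℕ (fin-mono (suc K) p)) (nat-mono q)
    tree-mono (wkT T) (pop p)       = tree-mono T p
    tree-mono (vzT d j T) (top p)   = same (treeμ-mono d j T p)
    tree-mono (sumT T T′) (inl p)   = tree-mono T p
    tree-mono (sumT T T′) (inr p)   = tree-mono T′ p
    tree-mono (muT d j T) p         = same (treeμ-mono d j T p)
    treeμ-mono d j T (roll (pair p (pair q r))) =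
      node-≼ (fin-mono N p) (tree-mono (innerT d j T) q) (tree-mono (innerT d j T) r)
    treeμ-mono d j T (sub {b = pair _ (pair _ _)} (pairˡ o) p) = ⊥-elim (fin-closed N o)
    treeμ-mono d j T (sub {b = pair _ (pair _ _)} (pairʳ (pairˡ o)) p) =
      linkˡ (occ-in (trees-safe d ≤-refl (sumS wk₀S vz₀S)) o) (treeμ-mono d j T p)
    treeμ-mono d j T (sub {b = pair _ (pair _ _)} (pairʳ (pairʳ o)) p) =
      linkʳ (occ-in (trees-safe d ≤-refl (sumS wk₀S vz₀S)) o) (treeμ-mono d j T p)

    height : ∀ {i} → Tree N i → ℕ
    height (leaf j x)     = 0
    height (node j τ l r) = suc (height l ℕ.⊔ height r)

    -- Leaves count as low whatever their label, because `leafE` provides the leaves of all labels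
    -- before any node is built.
    data Low (j : ℕ) : ∀ {i} → Tree N i → Set where
      leaf : ∀ {i x} → Low j (leaf i x)
      node : ∀ {i a b τ} {l : Tree N a} {r : Tree N b} → i < j → Low j (node i τ l r)

    Covers : ∀ {m} {Γ : Ctx m} {E} → ℕ → ℕ → Ty Γ E → Set
    Covers {Γ = Γ} {E} j h T = ∀ {i} (t : Tree N i) → height t ℕ.≤ h → Bounded K t → Low j t → Σ (Val Γ E) λ v → tree T v ≡ (i , t)

    Coversμ : ∀ {m} {Γ : Ctx m} {E} → ℕ → ℕ → ℕ → Ty Γ E → Set
    Coversμ {Γ = Γ} {E} d j h T = (t : Tree N j) → height t ℕ.≤ h → Bounded K t → Low (suc j) t → (Low j t → ⊥) →
                                  Σ (Val Γ (rooted d j E)) λ v → treeμ d j T v ≡ t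

    leaf-covers : ∀ {m} {Γ : Ctx m} h → Covers {Γ = Γ} 0 h leafT
    leaf-covers h (leaf i x) _ (leaf i≤K) leaf =
      pair (fin-encode (fromℕ< (s≤s i≤K))) (nat-encode x) ,
      trans (cong₂ (λ a b → a , leaf a b) (trans (cong toℕ (fin-decode-encode (fromℕ< (s≤s i≤K)))) (toℕ-fromℕ< (s≤s i≤K))) (nat-decode-encode x)) refl

    low-split : ∀ {j i} {t : Tree N i} → Low (suc j) t → Low j t ⊎ (i ≡ j × (Low j t → ⊥))
    low-split leaf = inj₁ leaf
    low-split (node (s≤s i≤j)) with m≤n⇒m<n∨m≡n i≤j
    ... | inj₁ i<j = inj₁ (node i<j)
    ... | inj₂ i≡j = inj₂ (i≡j , λ { (node i<j) → ℕₚ.<-irrefl i≡j i<j })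

    bounded-low : ∀ {i} {t : Tree N i} → Bounded K t → Low (suc K) t
    bounded-low (leaf _)     = leaf
    bounded-low (node p _ _) = node (s≤s p)

    extend : ∀ {m} {Γ : Ctx m} {j h E} (S : Ty Γ E) → Covers j h S → ∀ {F} (S′ : Ty Γ F) →
             ((t : Tree N j) → height t ℕ.≤ h → Bounded K t → Low (suc j) t → (Low j t → ⊥) → Σ (Val Γ F) λ v → tree S′ v ≡ (j , t)) →
             Covers (suc j) h (sumT S S′)
    extend S c S′ c′ t ht bt lt with low-split lt
    ... | inj₁ low          = let v , eq = c t ht bt low in inl v , eq
    ... | inj₂ (refl , ¬low) = let v , eq = c′ t ht bt lt ¬low in inr v , eq

    -- Induction on the height, which drops when a root labelled `j` is unrolled, and then on the
    -- number `d` of labels still to be added. The equation `j + d ≡ suc K` says that these are the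
    -- labels from `j` to `K`.
    trees-cover  : ∀ {m} {Γ : Ctx m} {E} d j (T : Ty Γ E) → j + d ≡ suc K → ∀ h → Covers j h T → Covers (suc K) h (treesT d j T)
    rooted-cover : ∀ {m} {Γ : Ctx m} {E} d j (T : Ty Γ E) → suc j + d ≡ suc K → ∀ h → Covers j h T → Coversμ d j h T
    trees-cover zero j T eq h c = subst (λ k → Covers k h T) (trans (sym (+-identityʳ j)) eq) c
    trees-cover (suc d) j T eq h c =
      trees-cover d (suc j) (sumT T (muT d j T)) eq′ h
        (extend T c (muT d j T) λ t ht bt lt ¬low →
          let v , q = rooted-cover d j T eq′ h c t ht bt lt ¬low in v , cong (j ,_) q)
      where eq′ = trans (sym (+-suc j d)) eq
    rooted-cover d j T eq h c (leaf _ _) _ _ _ ¬low = ⊥-elim (¬low leaf)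
    rooted-cover d j T eq (suc h) c (node _ τ l r) (s≤s ht) (node _ bl br) _ _ =
      roll (pair (fin-encode τ) (pair (proj₁ vl) (proj₁ vr))) , rebuild (fin-decode-encode τ) (proj₂ vl) (proj₂ vr)
      where
      inner : Covers (suc K) h (innerT d j T)
      inner = trees-cover d (suc j) (sumT (wkT T) (vzT d j T)) eq h
                (extend (wkT T) (λ t ht bt lt → let v , q = c t (m≤n⇒m≤1+n ht) bt lt in pop v , q) (vzT d j T)
                  λ t ht bt lt ¬low →
                    let v , q = rooted-cover d j T eq h (λ t ht → c t (m≤n⇒m≤1+n ht)) t ht bt lt ¬low in top v , cong (j ,_) q)
      vl = inner l (≤-trans (ℕₚ.m≤m⊔n _ _) ht) bl (bounded-low bl)
      vr = inner r (≤-trans (ℕₚ.m≤n⊔m (height l) _) ht) br (bounded-low br)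
      rebuild : ∀ {τ τ′ p q} → τ ≡ τ′ → p ≡ (_ , l) → q ≡ (_ , r) → node j τ (proj₂ p) (proj₂ q) ≡ node j τ′ l r
      rebuild refl refl refl = refl

    all-trees : Ty ε (trees (suc K) 0 leafE)
    all-trees = treesT (suc K) 0 leafT

    encode : ∀ {i} (t : Tree N i) → Bounded K t → Σ (Val ε (trees (suc K) 0 leafE)) λ v → tree all-trees v ≡ (i , t)
    encode t bt = trees-cover (suc K) 0 leafT refl (height t) (leaf-covers (height t)) t ≤-refl bt (bounded-low bt)

    gap-kruskal : (f : ℕ → Σ ℕ (Tree N)) → (∀ i → Bounded K (proj₂ (f i))) → ∃[ i ] ∃[ j ] (i < j × f i ≼Σ f j)
    gap-kruskal f b with kruskal (λ i → proj₁ (encode (proj₂ (f i)) (b i)))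
    ... | i , j , i<j , p =
      i , j , i<j , subst₂ _≼Σ_ (proj₂ (encode (proj₂ (f i)) (b i))) (proj₂ (encode (proj₂ (f j)) (b j))) (tree-mono all-trees p)

open import Defs
open import Data.Nat using (ℕ; zero; suc; _+_; _≤_; _<_; z≤n; s≤s; _≤?_; _<?_; _*_; _^_)
open import Data.Nat.Solver using (module +-*-Solver)
open import Data.Bool using (Bool; true; false; _∧_; _∨_; not)
open import Data.Fin as Fin using (Fin; zero; suc; toℕ; fromℕ<; combine; remQuot; funToFin; finToFun; inject≤)
open import Data.Fin.Subset.Properties using (anySubset?)
import Data.Vec as Vec
open import Data.Vec.Properties using (lookup∘tabulate)
open import Data.List using (List; []; _∷_; _++_; length; map; allFin; filter; tabulate)
open import Data.List.Membership.Propositional using (_∈_; find; lose; _∉_)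
open import Data.List.Membership.Propositional.Properties using (∈-∃++; ∈-allFin; ∈-++⁻; ∈-++⁺ˡ; ∈-map⁺; ∈-map⁻; ∈-++⁺ʳ; ∈-filter⁺; ∈-filter⁻)
open import Data.List.Relation.Unary.Any using (here; there; any?)
open import Data.List.Relation.Unary.All as All using ([]; _∷_)
open import Data.List.Relation.Unary.AllPairs using ([]; _∷_)
open import Data.List.Relation.Unary.Unique.Propositional using (Unique)
open import Data.List.Relation.Unary.Unique.Propositional.Properties using (allFin⁺; ++⁺; filter⁺; map⁺)
open import Data.List.Relation.Binary.Permutation.Propositional as ↭ using (_↭_; ↭-trans)
open import Data.List.Relation.Binary.Permutation.Propositional.Properties using (shift; ∈-resp-↭; ↭-length)
open import Data.Product using (∃-syntax; _×_; _,_; proj₁; proj₂; Σ)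
open import Data.Sum using (_⊎_; inj₁; inj₂; [_,_]′)
open import Data.Empty using (⊥; ⊥-elim)
open import Data.Unit using (tt; ⊤)
open import Relation.Nullary using (Dec; yes; no; does; ¬_)
open import Relation.Nullary.Decidable using (toWitness; _×-dec_; _→-dec_; ¬?; map′; decidable-stable; dec-true; dec-false)
open import Relation.Binary.PropositionalEquality using (_≡_; _≢_; refl; sym; cong; cong₂; subst; _≗_; trans; subst₂; module ≡-Reasoning)
open import Function using (_∘_; id)
open import Data.Bool.Properties using (∨-comm; ∨-identityʳ)
open import Data.Fin.Properties using (inject≤-injective; remQuot-combine; finToFun-funToFin; fromℕ<-cong; fromℕ<-toℕ; toℕ-inject≤; toℕ<n)
open import Data.List.Properties using (++-identityʳ; ++-assoc; length-map; length-++; length-tabulate; ∷ʳ-injective; ∷-injectiveˡ)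
open import Axiom.UniquenessOfIdentityProofs.WithK using (uip)
open import Data.Nat.Induction using (<-wellFounded)
open import Induction.WellFounded using (Acc; acc)
open import Data.Maybe using (Maybe; just; nothing)
open import Relation.Binary.Definitions using (tri<; tri≈; tri>)
open import Data.Maybe.Properties using (≡-dec; just-injective)
open import Data.Nat.Properties
import Data.Bool.Properties as 𝔹
import Data.Fin.Properties as Finₚ

-- Finite sums, cuts and splitting off

∑ : {A : Set} → (A → ℕ) → List A → ℕ
∑ f []       = 0
∑ f (x ∷ xs) = f x + ∑ f xs

module _ {A : Set} where

  ∑-mono : {f g : A → ℕ} (xs : List A) → (∀ {x} → x ∈ xs → f x ≤ g x) → ∑ f xs ≤ ∑ g xs
  ∑-mono []       h = z≤n
  ∑-mono (x ∷ xs) h = +-mono-≤ (h (here refl)) (∑-mono xs (h ∘ there))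

  ∑-strict : {f g : A → ℕ} (xs : List A) → (∀ {x} → x ∈ xs → f x ≤ g x) → ∀ {y} → y ∈ xs → f y < g y → ∑ f xs < ∑ g xs
  ∑-strict (x ∷ xs) h (here refl) lt = +-mono-<-≤ lt (∑-mono xs (h ∘ there))
  ∑-strict (x ∷ xs) h (there y∈)  lt = +-mono-≤-< (h (here refl)) (∑-strict xs (h ∘ there) y∈ lt)

  ∑-tight : {f g : A → ℕ} (xs : List A) → (∀ {x} → x ∈ xs → f x ≤ g x) → ∑ g xs ≤ ∑ f xs → ∀ {y} → y ∈ xs → f y ≡ g y
  ∑-tight xs h le y∈ with m≤n⇒m<n∨m≡n (h y∈)
  ... | inj₁ lt = ⊥-elim (<⇒≱ (∑-strict xs h y∈ lt) le)
  ... | inj₂ eq = eq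

  ∑-cong : {f g : A → ℕ} (xs : List A) → (∀ x → f x ≡ g x) → ∑ f xs ≡ ∑ g xs
  ∑-cong []       h = refl
  ∑-cong (x ∷ xs) h = cong₂ _+_ (h x) (∑-cong xs h)

  ∑-+ : (f g : A → ℕ) (xs : List A) → ∑ (λ x → f x + g x) xs ≡ ∑ f xs + ∑ g xs
  ∑-+ f g []       = refl
  ∑-+ f g (x ∷ xs) = trans (cong (f x + g x +_) (∑-+ f g xs)) (interchange (f x) (g x) (∑ f xs) (∑ g xs))
    where
    interchange : ∀ a b c d → (a + b) + (c + d) ≡ (a + c) + (b + d)
    interchange = solve 4 (λ a b c d → (a :+ b) :+ (c :+ d) := (a :+ c) :+ (b :+ d)) refl
      where open +-*-Solver

  ∑-++ : (f : A → ℕ) (xs ys : List A) → ∑ f (xs ++ ys) ≡ ∑ f xs + ∑ f ys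
  ∑-++ f []       ys = refl
  ∑-++ f (x ∷ xs) ys = trans (cong (f x +_) (∑-++ f xs ys)) (sym (+-assoc (f x) _ _))

  ∑-↭ : (f : A → ℕ) {xs ys : List A} → xs ↭ ys → ∑ f xs ≡ ∑ f ys
  ∑-↭ f ↭.refl          = refl
  ∑-↭ f (↭.prep x p)    = cong (f x +_) (∑-↭ f p)
  ∑-↭ f {ys = _ ∷ _ ∷ ys} (↭.swap x y p)  = trans (cong (λ s → f x + (f y + s)) (∑-↭ f p))
    (trans (sym (+-assoc (f x) (f y) _)) (trans (cong (_+ ∑ f ys) (+-comm (f x) (f y))) (+-assoc (f y) (f x) _)))
  ∑-↭ f (↭.trans p q)   = trans (∑-↭ f p) (∑-↭ f q)

  ∑-member : (f : A → ℕ) (xs : List A) {y : A} → y ∈ xs → f y ≤ ∑ f xs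
  ∑-member f (x ∷ xs) (here refl) = m≤m+n (f x) _
  ∑-member f (x ∷ xs) (there y∈)  = ≤-trans (∑-member f xs y∈) (m≤n+m _ (f x))

  ∑-unique : (f : A → ℕ) (xs : List A) → ∑ f xs ≤ 1 → ∀ {x y} → x ∈ xs → y ∈ xs → 1 ≤ f x → 1 ≤ f y → x ≡ y
  ∑-unique f (z ∷ xs) le (here refl) (here refl) p q = refl
  ∑-unique f (z ∷ xs) le (there x∈) (there y∈) p q = ∑-unique f xs (≤-trans (m≤n+m _ (f z)) le) x∈ y∈ p q
  ∑-unique f (z ∷ xs) le (here refl) (there y∈) p q =
    ⊥-elim (<⇒≱ (+-mono-≤ p (≤-trans q (∑-member f xs y∈))) le)
  ∑-unique f (z ∷ xs) le (there x∈) (here refl) p q =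
    ⊥-elim (<⇒≱ (+-mono-≤ q (≤-trans p (∑-member f xs x∈))) le)

  ∑-positive : (f : A → ℕ) (xs : List A) → 1 ≤ ∑ f xs → ∃[ x ] (x ∈ xs × 1 ≤ f x)
  ∑-positive f (x ∷ xs) le with f x in eq
  ... | suc k = x , here refl , subst (1 ≤_) (sym eq) (s≤s z≤n)
  ... | zero  = let y , y∈ , q = ∑-positive f xs le in y , there y∈ , q

⟦_⟧ : Bool → ℕ
⟦ false ⟧ = 0
⟦ true ⟧  = 1

-- `∑ (δ x) xs` is the multiplicity of `x` in `xs`. Absence of repetitions is expressed by
-- multiplicities at most 1, which add up along concatenations.
δ : ∀ {n} → Fin n → Fin n → ℕ
δ x y = ⟦ does (x Fin.≟ y) ⟧

δ-refl : ∀ {n} (x : Fin n) → δ x x ≡ 1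
δ-refl x with x Fin.≟ x
... | yes _ = refl
... | no ¬p = ⊥-elim (¬p refl)

δ-≡ : ∀ {n} {x y : Fin n} → 1 ≤ δ x y → x ≡ y
δ-≡ {x = x} {y} p with x Fin.≟ y
... | yes q = q
... | no _ = ⊥-elim (1+n≰n p)

∑δ-∈ : ∀ {n} {x : Fin n} {xs} → x ∈ xs → 1 ≤ ∑ (δ x) xs
∑δ-∈ {x = x} {xs} x∈ = subst (_≤ ∑ (δ x) xs) (δ-refl x) (∑-member (δ x) xs x∈)

∈-∑δ : ∀ {n} {x : Fin n} xs → 1 ≤ ∑ (δ x) xs → x ∈ xs
∈-∑δ {x = x} xs p with ∑-positive (δ x) xs p
... | y , y∈ , q = subst (_∈ xs) (sym (δ-≡ q)) y∈

∑δ-unique : ∀ {n} (x : Fin n) {xs} → Unique xs → ∑ (δ x) xs ≤ 1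
∑δ-unique x {[]} [] = z≤n
∑δ-unique x {y ∷ ys} (h ∷ u) with x Fin.≟ y
... | no _ = ∑δ-unique x u
... | yes refl with ∑ (δ x) ys in eq
...   | zero  = s≤s z≤n
...   | suc k = ⊥-elim (All.lookup h (∈-∑δ ys (subst (1 ≤_) (sym eq) (s≤s z≤n))) refl)

∑δ-unique⁻ : ∀ {n} (xs : List (Fin n)) → (∀ x → ∑ (δ x) xs ≤ 1) → Unique xs
∑δ-unique⁻ []       h = []
∑δ-unique⁻ (x ∷ xs) h =
  All.tabulate (λ { {y} y∈ refl → <⇒≱ (+-mono-≤ (≤-reflexive (sym (δ-refl x))) (∑δ-∈ y∈)) (h x) })
  ∷ ∑δ-unique⁻ xs (λ y → ≤-trans (m≤n+m _ (δ y x)) (h y))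

∑δ-allFin : ∀ {n} (x : Fin n) → ∑ (δ x) (allFin n) ≡ 1
∑δ-allFin {n} x = ≤-antisym (∑δ-unique x (allFin⁺ n)) (∑δ-∈ (∈-allFin x))

-- Relations between cuts hold arc by arc, where they depend only on which sets contain the two
-- ends; checking all truth values then proves them.
∀𝔹? : {P : Bool → Set} → (∀ b → Dec (P b)) → Dec (∀ b → P b)
∀𝔹? P? = map′ (λ { (p , q) false → p ; (p , q) true → q }) (λ h → h false , h true) (P? false ×-dec P? true)

cross : Bool → Bool → ℕ
cross a b = ⟦ a ∧ not b ⟧

cross-submodular : ∀ a b c d → cross (a ∧ c) (b ∧ d) + cross (a ∨ c) (b ∨ d) ≤ cross a b + cross c d
cross-submodular = toWitness {a? = ∀𝔹? λ a → ∀𝔹? λ b → ∀𝔹? λ c → ∀𝔹? λ d → _ ≤? _} tt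

cross-triangle : ∀ a b c → cross a c ≤ cross a b + cross b c
cross-triangle = toWitness {a? = ∀𝔹? λ a → ∀𝔹? λ b → ∀𝔹? λ c → _ ≤? _} tt

cross-balance : ∀ a b → ⟦ a ⟧ ≡ ⟦ a ∧ b ⟧ + cross a b
cross-balance = toWitness {a? = ∀𝔹? λ a → ∀𝔹? λ b → _ ≟ _} tt

VSet : ℕ → Set
VSet n = Fin n → Bool

_⊆_ : ∀ {n} → VSet n → VSet n → Set
A ⊆ B = ∀ v → A v ≡ true → B v ≡ true

_∩_ _∪_ _∖_ : ∀ {n} → VSet n → VSet n → VSet n
(A ∩ B) v = A v ∧ B v
(A ∪ B) v = A v ∨ B v
(A ∖ B) v = A v ∧ not (B v)

⁅_⁆ : ∀ {n} → Fin n → VSet n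
⁅ v ⁆ u = does (u Fin.≟ v)

_⊆?_ : ∀ {n} (A B : VSet n) → Dec (A ⊆ B)
A ⊆? B = Finₚ.all? λ v → (A v 𝔹.≟ true) →-dec (B v 𝔹.≟ true)

-- Decides by exhaustion what a classical argument would decide by excluded middle. The property
-- must respect pointwise equality, since a set is tested through the table of its values.
anySet? : ∀ {n} {P : VSet n → Set} → (∀ S → Dec (P S)) → (∀ {S S′} → S ≗ S′ → P S → P S′) → Dec (∃[ S ] P S)
anySet? P? resp with anySubset? (λ s → P? (Vec.lookup s))
... | yes (s , p) = yes (Vec.lookup s , p)
... | no ¬p       = no λ { (S , p) → ¬p (Vec.tabulate S , resp (λ v → sym (lookup∘tabulate S v)) p) }

Between : ∀ {n} → VSet n → VSet n → VSet n → Set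
Between Y X S = Y ⊆ S × S ⊆ X

∧-true : ∀ {a b} → a ∧ b ≡ true → a ≡ true × b ≡ true
∧-true {true} {true} refl = refl , refl

between-∩ : ∀ {n} {Y X A B : VSet n} → Between Y X A → Between Y X B → Between Y X (A ∩ B)
between-∩ {A = A} (p , q) (p′ , q′) = (λ v h → cong₂ _∧_ (p v h) (p′ v h)) , (λ v h → q v (proj₁ (∧-true h)))

∨-true : ∀ {a b} → a ∨ b ≡ true → a ≡ true ⊎ b ≡ true
∨-true {true}  _ = inj₁ refl
∨-true {false} p = inj₂ p

∨-introˡ : ∀ {a} b → a ≡ true → a ∨ b ≡ true
∨-introˡ b refl = refl

∨-introʳ : ∀ a {b} → b ≡ true → a ∨ b ≡ true
∨-introʳ a refl = 𝔹.∨-zeroʳ a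

between-∪ : ∀ {n} {Y X A B : VSet n} → Between Y X A → Between Y X B → Between Y X (A ∪ B)
between-∪ {A = A} {B} (p , q) (p′ , q′) = (λ v h → ∨-introˡ (B v) (p v h)) , λ v h → [ q v , q′ v ]′ (∨-true h)

module Cuts {n : ℕ} {A : Set} (src dst : A → Fin n) where

  out : VSet n → A → ℕ
  out S a = cross (S (src a)) (S (dst a))

  inn : VSet n → A → ℕ
  inn S a = cross (S (dst a)) (S (src a))

  -- Equality of in-degree and out-degree, summed over a set. In this form a loop counts on both
  -- sides, and joining two arcs cancels a single term.
  Balanced : List A → Set
  Balanced as = ∀ (S : VSet n) → ∑ (λ a → ⟦ S (src a) ⟧) as ≡ ∑ (λ a → ⟦ S (dst a) ⟧) as

  balanced-cut : ∀ as → Balanced as → ∀ S → ∑ (out S) as ≡ ∑ (inn S) as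
  balanced-cut as bal S = +-cancelˡ-≡ (∑ both as) _ _ (begin
    ∑ both as + ∑ (out S) as          ≡⟨ sym (∑-+ both (out S) as) ⟩
    ∑ (λ a → both a + out S a) as     ≡⟨ ∑-cong as (λ a → sym (cross-balance (S (src a)) (S (dst a)))) ⟩
    ∑ (λ a → ⟦ S (src a) ⟧) as        ≡⟨ bal S ⟩
    ∑ (λ a → ⟦ S (dst a) ⟧) as        ≡⟨ ∑-cong as (λ a → trans (cross-balance (S (dst a)) (S (src a)))
                                           (cong (λ b → ⟦ b ⟧ + inn S a) (𝔹.∧-comm (S (dst a)) (S (src a))))) ⟩
    ∑ (λ a → both a + inn S a) as     ≡⟨ ∑-+ both (inn S) as ⟩
    ∑ both as + ∑ (inn S) as ∎)
    where
    open ≡-Reasoning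
    both : A → ℕ
    both a = ⟦ S (src a) ∧ S (dst a) ⟧

  cut-cong : ∀ {S S′} → S ≗ S′ → ∀ as → ∑ (out S) as ≡ ∑ (out S′) as
  cut-cong eq as = ∑-cong as λ a → cong₂ cross (eq (src a)) (eq (dst a))

  submodular : ∀ S S′ as → ∑ (out (S ∩ S′)) as + ∑ (out (S ∪ S′)) as ≤ ∑ (out S) as + ∑ (out S′) as
  submodular S S′ as = ≤-trans (≤-reflexive (sym (∑-+ _ _ as)))
    (≤-trans (∑-mono as (λ {a} _ → cross-submodular (S (src a)) (S (dst a)) (S′ (src a)) (S′ (dst a))))
             (≤-reflexive (∑-+ _ _ as)))

  -- Such an arc counts in the cut of `S`, but neither in that of the intersection, where its source
  -- is missing, nor in that of the union, which contains both ends.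
  submodular-strict : ∀ S S′ as {a} → a ∈ as → S (src a) ≡ true → S (dst a) ≡ false → S′ (src a) ≡ false → S′ (dst a) ≡ true →
                      ∑ (out (S ∩ S′)) as + ∑ (out (S ∪ S′)) as < ∑ (out S) as + ∑ (out S′) as
  submodular-strict S S′ as {a} a∈ p q p′ q′ = ≤-trans (s≤s (≤-reflexive (sym (∑-+ _ _ as))))
    (≤-trans (∑-strict as (λ {a} _ → cross-submodular (S (src a)) (S (dst a)) (S′ (src a)) (S′ (dst a))) a∈ lt)
             (≤-reflexive (∑-+ _ _ as)))
    where
    lt : cross (S (src a) ∧ S′ (src a)) (S (dst a) ∧ S′ (dst a)) + cross (S (src a) ∨ S′ (src a)) (S (dst a) ∨ S′ (dst a))
         < cross (S (src a)) (S (dst a)) + cross (S′ (src a)) (S′ (dst a))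
    lt rewrite p | q | p′ | q′ = s≤s z≤n

  -- Merging the consecutive arcs a and b lowers no cut between Y and X below w; the terms are moved so that no subtraction occurs.
  Splits : VSet n → VSet n → ℕ → List A → A → A → Set
  Splits Y X w as a b = ∀ S → Between Y X S →
    w + (out S a + out S b) ≤ cross (S (src a)) (S (dst b)) + ∑ (out S) as

  -- Replacing two consecutive arcs by one changes a cut only when it separates the middle vertex
  -- from both outer ends, and then by one.
  cross-tight : ∀ a b c → cross a b + cross b c ≤ cross a c ⊎
                (cross a b + cross b c ≤ suc (cross a c) × ((a ≡ false × b ≡ true × c ≡ false) ⊎ (a ≡ true × b ≡ false × c ≡ true)))
  cross-tight false false false = inj₁ z≤n
  cross-tight false false true  = inj₁ z≤n
  cross-tight false true  false = inj₂ (s≤s z≤n , inj₁ (refl , refl , refl))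
  cross-tight false true  true  = inj₁ z≤n
  cross-tight true  false false = inj₁ (s≤s z≤n)
  cross-tight true  false true  = inj₂ (s≤s z≤n , inj₂ (refl , refl , refl))
  cross-tight true  true  false = inj₁ (s≤s z≤n)
  cross-tight true  true  true  = inj₁ z≤n

  -- Splitting off at a vertex `v` between `Y` and `X`. If an arc `b` out of `v` cannot be merged
  -- with `a`, a set with exactly `w` outgoing arcs separates `v` from `src a` and `dst b`. Either
  -- all these sets contain `v` or none does, so their intersection or union serves all arcs `b` at
  -- once; moving `v` across it gives a cut that is too small.
  module Splitting (Y X : VSet n) (w : ℕ) (as : List A) (bal : Balanced as)
                   (large : ∀ S → Between Y X S → w ≤ ∑ (out S) as)
                   (v : Fin n) (Yv : Y v ≡ false) (Xv : X v ≡ true)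
                   (a : A) (a∈ : a ∈ as) (dst-a : dst a ≡ v) (src-a : src a ≢ v) where

    Violates : A → VSet n → Set
    Violates b S = Between Y X S × cross (S (src a)) (S (dst b)) + ∑ (out S) as < w + (out S a + out S b)

    violates? : ∀ b → Dec (∃[ S ] Violates b S)
    violates? b = anySet? (λ S → ((Y ⊆? S) ×-dec (S ⊆? X)) ×-dec (_ <? _)) resp
      where
      resp : ∀ {S S′} → S ≗ S′ → Violates b S → Violates b S′
      resp eq ((p , q) , lt) = ((λ v h → trans (sym (eq v)) (p v h)) , (λ v h → q v (trans (eq v) h))) ,
        subst₂ _<_ (cong₂ _+_ (cong₂ cross (eq (src a)) (eq (dst b))) (cut-cong eq as))
          (cong (w +_) (cong₂ _+_ (cong₂ cross (eq (src a)) (eq (dst a))) (cong₂ cross (eq (src b)) (eq (dst b))))) lt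

    Tight : VSet n → Set
    Tight S = Between Y X S × ∑ (out S) as ≤ w

    Enters Leaves : List A → VSet n → Set
    Enters bs S = Tight S × S (src a) ≡ false × S v ≡ true × (∀ {b} → b ∈ bs → src b ≡ v → S (dst b) ≡ false)
    Leaves bs S = Tight S × S (src a) ≡ true × S v ≡ false × (∀ {b} → b ∈ bs → src b ≡ v → S (dst b) ≡ true)

    tight-both : ∀ {S S′} → Tight S → Tight S′ → ∑ (out (S ∩ S′)) as ≤ w × ∑ (out (S ∪ S′)) as ≤ w
    tight-both {S} {S′} (p , q) (p′ , q′) =
      +-cancelʳ-≤ w _ _ (≤-trans (+-monoʳ-≤ _ (large _ (between-∪ p p′))) sum) ,
      +-cancelˡ-≤ w _ _ (≤-trans (+-monoˡ-≤ _ (large _ (between-∩ p p′))) sum)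
      where sum = ≤-trans (submodular S S′ as) (+-mono-≤ q q′)

    tight-∩ : ∀ {S S′} → Tight S → Tight S′ → Tight (S ∩ S′)
    tight-∩ t t′ = between-∩ (proj₁ t) (proj₁ t′) , proj₁ (tight-both t t′)

    tight-∪ : ∀ {S S′} → Tight S → Tight S′ → Tight (S ∪ S′)
    tight-∪ t t′ = between-∪ (proj₁ t) (proj₁ t′) , proj₂ (tight-both t t′)

    -- The arc `a` makes submodularity strict, so the intersection or the union would have fewer
    -- than `w` outgoing arcs.
    no-crossing : ∀ {S S′} → Tight S → Tight S′ → S (src a) ≡ true → S v ≡ false → S′ (src a) ≡ false → S′ v ≡ true → ⊥
    no-crossing {S} {S′} (p , q) (p′ , q′) h k h′ k′ =
      <⇒≱ (≤-trans (submodular-strict S S′ as a∈ h (subst (λ x → S x ≡ false) (sym dst-a) k) h′ (subst (λ x → S′ x ≡ true) (sym dst-a) k′))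
                   (+-mono-≤ q q′))
          (+-mono-≤ (large _ (between-∩ p p′)) (large _ (between-∪ p p′)))

    violation : ∀ b {S} → src b ≡ v → Violates b S → Tight S ×
      ((S (src a) ≡ false × S v ≡ true × S (dst b) ≡ false) ⊎ (S (src a) ≡ true × S v ≡ false × S (dst b) ≡ true))
    violation b {S} refl (bt , lt) rewrite dst-a with cross-tight (S (src a)) (S (src b)) (S (dst b))
    ... | inj₁ le = ⊥-elim (<⇒≱ lt (≤-trans (+-mono-≤ (large S bt) le) (≤-reflexive (+-comm (∑ (out S) as) _))))
    ... | inj₂ (le , c) = (bt , +-cancelˡ-≤ (cross (S (src a)) (S (dst b))) _ _ (≤-pred (≤-trans lt (≤-trans (+-monoʳ-≤ w le)
            (≤-reflexive (trans (+-suc w _) (cong suc (+-comm w _)))))))) , c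

    data Search (bs : List A) : Set where
      found  : ∀ {b} → b ∈ bs → src b ≡ v → Splits Y X w as a b → Search bs
      enters : ∀ {S} → Enters bs S → Search bs
      leaves : ∀ {S} → Leaves bs S → Search bs
      none   : (∀ {b} → b ∈ bs → src b ≢ v) → Search bs

    search : ∀ bs → Search bs
    search [] = none λ ()
    search (b ∷ bs) with search bs | src b Fin.≟ v
    ... | found b∈ q s | _ = found (there b∈) q s
    ... | enters (t , p , q , h) | no ¬eq = enters (t , p , q , λ { (here refl) eq → ⊥-elim (¬eq eq) ; (there b∈) → h b∈ })
    ... | leaves (t , p , q , h) | no ¬eq = leaves (t , p , q , λ { (here refl) eq → ⊥-elim (¬eq eq) ; (there b∈) → h b∈ })
    ... | none h | no ¬eq = none λ { (here refl) → ¬eq ; (there b∈) → h b∈ }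
    ... | r | yes eq with violates? b
    ...   | no ¬viol = found (here refl) eq λ S bt → ≮⇒≥ λ lt → ¬viol (S , bt , lt)
    ...   | yes (S , viol) with violation b eq viol | r
    ...     | _ | found b∈ q s = found (there b∈) q s
    ...     | t , inj₁ (p , q , x) | none h = enters (t , p , q , λ { (here refl) _ → x ; (there b∈) e → ⊥-elim (h b∈ e) })
    ...     | t , inj₂ (p , q , x) | none h = leaves (t , p , q , λ { (here refl) _ → x ; (there b∈) e → ⊥-elim (h b∈ e) })
    ...     | t , inj₁ (p , q , x) | leaves (t′ , p′ , q′ , _) = ⊥-elim (no-crossing t′ t p′ q′ p q)
    ...     | t , inj₂ (p , q , x) | enters (t′ , p′ , q′ , _) = ⊥-elim (no-crossing t t′ p q p′ q′)
    ...     | t , inj₁ (p , q , x) | enters {S′} (t′ , p′ , q′ , h) = enters {S = S ∩ S′} (tight-∩ t t′ ,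
                cong₂ _∧_ p p′ , cong₂ _∧_ q q′ ,
                λ { (here refl) _ → cong (_∧ S′ _) x ; (there b∈) e → trans (cong (S _ ∧_) (h b∈ e)) (𝔹.∧-zeroʳ _) })
    ...     | t , inj₂ (p , q , x) | leaves {S′} (t′ , p′ , q′ , h) = leaves {S = S ∪ S′} (tight-∪ t t′ ,
                cong₂ _∨_ p p′ , cong₂ _∨_ q q′ ,
                λ { (here refl) _ → cong (_∨ S′ _) x ; (there b∈) e → ∨-introʳ (S _) (h b∈ e) })

    -- All arcs out of `v` leave `S`, so without `v` no new arc enters, while `a` no longer does.
    -- Balance turns the count of entering arcs into one of leaving arcs.
    ¬enters : ∀ {S} → Enters as S → ⊥
    ¬enters {S} (((p , q) , t) , ¬u , Sv , h) =
      <⇒≱ (≤-trans (s≤s (≤-reflexive (balanced-cut as bal S′))) (≤-trans (∑-strict as le a∈ lt)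
            (≤-trans (≤-reflexive (sym (balanced-cut as bal S))) t))) (large S′ (Y⊆ , λ u e → q u (proj₁ (∧-true e))))
      where
      S′ = S ∖ ⁅ v ⁆
      Y⊆ : Y ⊆ S′
      Y⊆ u e with u Fin.≟ v
      ... | yes refl with trans (sym e) Yv
      ...   | ()
      Y⊆ u e | no _ = trans (𝔹.∧-identityʳ (S u)) (p u e)
      le : ∀ {b} → b ∈ as → inn S′ b ≤ inn S b
      le {b} b∈ with src b Fin.≟ v
      ... | yes e rewrite h b∈ e = z≤n
      ... | no _ rewrite 𝔹.∧-identityʳ (S (src b)) = mono (S (dst b)) (not (does (dst b Fin.≟ v))) (S (src b))
        where
        mono : ∀ x y z → cross (x ∧ y) z ≤ cross x z
        mono = toWitness {a? = ∀𝔹? λ x → ∀𝔹? λ y → ∀𝔹? λ z → _ ≤? _} tt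
      lt : inn S′ a < inn S a
      lt with dst a Fin.≟ v
      ... | no ¬e = ⊥-elim (¬e dst-a)
      ... | yes e rewrite e | Sv | ¬u = s≤s z≤n

    -- All arcs out of `v` end in `S`, so adding `v` creates no leaving arc, and `a` ceases to be
    -- one.
    ¬leaves : ∀ {S} → Leaves as S → ⊥
    ¬leaves {S} (((p , q) , t) , Su , ¬v , h) =
      <⇒≱ (≤-trans (∑-strict as le a∈ lt) t) (large S′ ((λ u e → ∨-introˡ _ (p u e)) , ⊆X))
      where
      S′ = S ∪ ⁅ v ⁆
      ⊆X : S′ ⊆ X
      ⊆X u e with u Fin.≟ v
      ... | yes refl = Xv
      ... | no _ = q u (trans (sym (𝔹.∨-identityʳ (S u))) e)
      le : ∀ {b} → b ∈ as → out S′ b ≤ out S b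
      le {b} b∈ with src b Fin.≟ v
      ... | yes e rewrite h b∈ e | 𝔹.∧-zeroʳ (S (src b) ∨ true) = z≤n
      ... | no _ rewrite 𝔹.∨-identityʳ (S (src b)) = mono (S (src b)) (S (dst b)) (does (dst b Fin.≟ v))
        where
        mono : ∀ x y z → cross x (y ∨ z) ≤ cross x y
        mono = toWitness {a? = ∀𝔹? λ x → ∀𝔹? λ y → ∀𝔹? λ z → _ ≤? _} tt
      lt : out S′ a < out S a
      lt with dst a Fin.≟ v
      ... | no ¬e = ⊥-elim (¬e dst-a)
      ... | yes e rewrite e | Su | ¬v = s≤s z≤n

    ¬none : (∀ {b} → b ∈ as → src b ≢ v) → ⊥
    ¬none h with ∑-positive (λ b → ⟦ ⁅ v ⁆ (src b) ⟧) as
                   (subst (1 ≤_) (sym (bal ⁅ v ⁆)) (≤-trans (≤-reflexive (sym here-a)) (∑-member (λ b → ⟦ ⁅ v ⁆ (dst b) ⟧) as a∈)))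
      where
      here-a : ⟦ ⁅ v ⁆ (dst a) ⟧ ≡ 1
      here-a = trans (cong (λ x → δ x v) dst-a) (δ-refl v)
    ... | b , b∈ , q = h b∈ (δ-≡ q)

    split : ∃[ b ] (b ∈ as × src b ≡ v × Splits Y X w as a b)
    split with search as
    ... | found b∈ q s = _ , b∈ , q , s
    ... | enters e     = ⊥-elim (¬enters e)
    ... | leaves l     = ⊥-elim (¬leaves l)
    ... | none h       = ⊥-elim (¬none h)

-- Trails and Menger's theorem by repeated splitting off

walk-++ : ∀ {G s t u xs ys} → Walk G s xs t → Walk G t ys u → Walk G s (xs ++ ys) u
walk-++ (one e p refl) w = more e p w
walk-++ (more e p w′) w  = more e p (walk-++ w′ w)

internal-++ : ∀ {G s t u xs ys v} → Walk G s xs t → Walk G t ys u → v ∈ internal G (xs ++ ys) →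
              v ∈ internal G xs ⊎ v ≡ t ⊎ v ∈ internal G ys
internal-++ (one e p refl) (one _ _ _) (here q)    = inj₂ (inj₁ q)
internal-++ (one e p refl) (more _ _ _) (here q)   = inj₂ (inj₁ q)
internal-++ (one e p refl) (more _ _ _) (there v∈) = inj₂ (inj₂ v∈)
internal-++ (more e p (one _ _ _)) w (here q)      = inj₁ (here q)
internal-++ (more e p (more _ _ _)) w (here q)     = inj₁ (here q)
internal-++ (more e p w′@(one _ _ _)) w (there v∈) with internal-++ w′ w v∈
... | inj₁ ()
... | inj₂ r = inj₂ r
internal-++ (more e p w′@(more _ _ _)) w (there v∈) with internal-++ w′ w v∈
... | inj₁ r = inj₁ (there r)
... | inj₂ r = inj₂ r

record Trail (G : Digraph) (P : Fin (nV G) → Set) : Set where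
  constructor trail
  field
    {src dst} : Fin (nV G)
    {edges}   : List (Fin (nE G))
    walk      : Walk G src edges dst
    inside    : ∀ {v} → v ∈ internal G edges → P v

module Menger (G : Digraph) (Y X : VSet (nV G)) (w : ℕ) where

  open Trail

  Mid : Fin (nV G) → Set
  Mid v = Y v ≡ false × X v ≡ true

  Arc : Set
  Arc = Trail G Mid

  open module C = Cuts {A = Arc} src dst using (out; inn; Balanced; Splits)

  -- `weight`, required for every function `f` on the edges, says that the trails use each edge
  -- exactly once: the indicator of an edge yields edge-disjointness, and the indicator of a cut
  -- compares the trails with the digraph.
  record Routing (as : List Arc) : Set where
    field
      balanced : Balanced as
      large    : ∀ S → Between Y X S → w ≤ ∑ (out S) as
      weight   : ∀ f → ∑ (∑ f ∘ edges) as ≡ ∑ f (allFin (nE G))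

  -- Only closed trails may end strictly between `Y` and `X`; a trail that is not idle can still be
  -- prolonged by splitting off at its last vertex.
  Idle : Arc → Set
  Idle a = Mid (dst a) → src a ≡ dst a

  join : (a b : Arc) → src b ≡ dst a → Mid (dst a) → Arc
  join a (trail w′ i) refl m = trail (walk-++ (walk a) w′) inside′
    where
    inside′ : ∀ {v} → v ∈ internal G (edges a ++ _) → Mid v
    inside′ v∈ with internal-++ (walk a) w′ v∈
    ... | inj₁ q           = inside a q
    ... | inj₂ (inj₁ refl) = m
    ... | inj₂ (inj₂ q)    = i q

  extract : ∀ {a : Arc} {as} → a ∈ as → ∃[ bs ] as ↭ a ∷ bs
  extract a∈ with ∈-∃++ a∈
  ... | xs , ys , refl = xs ++ ys , shift _ xs ys

  join-routing : ∀ {as rest a b} (q : src b ≡ dst a) (m : Mid (dst a)) → as ↭ a ∷ b ∷ rest → Routing as → Splits Y X w as a b →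
                 Routing (join a b q m ∷ rest)
  join-routing {as} {rest} {a} {b} refl m p r s = record { balanced = bal ; large = lar ; weight = wei }
    where
    open Routing r
    bal : Balanced (join a b refl m ∷ rest)
    bal S = +-cancelˡ-≡ ⟦ S (src b) ⟧ _ _ (begin
      ⟦ S (src b) ⟧ + (⟦ S (src a) ⟧ + ∑ (λ c → ⟦ S (src c) ⟧) rest) ≡⟨ exch ⟦ S (src b) ⟧ ⟦ S (src a) ⟧ _ ⟩
      ⟦ S (src a) ⟧ + (⟦ S (src b) ⟧ + ∑ (λ c → ⟦ S (src c) ⟧) rest) ≡⟨ sym (∑-↭ (λ c → ⟦ S (src c) ⟧) p) ⟩
      ∑ (λ c → ⟦ S (src c) ⟧) as ≡⟨ balanced S ⟩
      ∑ (λ c → ⟦ S (dst c) ⟧) as ≡⟨ ∑-↭ (λ c → ⟦ S (dst c) ⟧) p ⟩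
      ⟦ S (dst a) ⟧ + (⟦ S (dst b) ⟧ + ∑ (λ c → ⟦ S (dst c) ⟧) rest) ∎)
      where
      open ≡-Reasoning
      exch : ∀ x y z → x + (y + z) ≡ y + (x + z)
      exch x y z = trans (sym (+-assoc x y z)) (trans (cong (_+ z) (+-comm x y)) (+-assoc y x z))
    lar : ∀ S → Between Y X S → w ≤ cross (S (src a)) (S (dst b)) + ∑ (out S) rest
    lar S bt = +-cancelʳ-≤ (out S a + out S b) _ _ (≤-trans (s S bt) (≤-reflexive
      (trans (cong (cross (S (src a)) (S (dst b)) +_) (trans (∑-↭ (out S) p) (trans (sym (+-assoc (out S a) (out S b) _)) (+-comm (out S a + out S b) _))))
        (sym (+-assoc (cross (S (src a)) (S (dst b))) _ _)))))
    wei : ∀ f → ∑ f (edges a ++ edges b) + ∑ (∑ f ∘ edges) rest ≡ ∑ f (allFin (nE G))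
    wei f = trans (cong (_+ ∑ (∑ f ∘ edges) rest) (∑-++ f (edges a) (edges b)))
      (trans (+-assoc (∑ f (edges a)) _ _) (trans (sym (∑-↭ (∑ f ∘ edges) p)) (weight f)))

  Result : Set
  Result = ∃[ as ] (Routing as × (∀ {a} → a ∈ as → Idle a))

  route : ∀ k as → length as ≤ k → Routing as → Result
  step : ∀ k as → length as ≤ k → Routing as → ∀ {a} → a ∈ as → Mid (dst a) → src a ≢ dst a → Result
  route k as len r with any? (λ a → (((Y (dst a)) 𝔹.≟ false) ×-dec (X (dst a) 𝔹.≟ true)) ×-dec ¬? (src a Fin.≟ dst a)) as
  ... | yes p = let a , a∈ , m , ne = find p in step k as len r a∈ m ne
  ... | no ¬p = as , r , λ {a} a∈ m → decidable-stable (src a Fin.≟ dst a) (λ ne → ¬p (lose a∈ (m , ne)))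
  step k as len r {a} a∈ m ne
    with C.Splitting.split Y X w as (Routing.balanced r) (Routing.large r) (dst a) (proj₁ m) (proj₂ m) a a∈ refl ne
  ... | b , b∈ , q , s with extract a∈
  ...   | bs , p with ∈-resp-↭ p b∈
  ...     | here refl = ⊥-elim (ne q)
  ...     | there b∈′ with extract b∈′
  -- A join replaces two arcs by one, so the length of the list bounds the number of joins.
  ...       | cs , p′ with k | ≤-trans (≤-reflexive (sym (↭-length (↭-trans p (↭.prep a p′))))) len
  ...         | suc k′ | s≤s len′ = route k′ (join a b q m ∷ cs) len′ (join-routing q m (↭-trans p (↭.prep a p′)) r s)

  module E = Cuts {A = Fin (nE G)} (tail G) (head G)

  menger : E.Balanced (allFin (nE G)) → (∀ S → Between Y X S → w ≤ ∑ (E.out S) (allFin (nE G))) → Result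
  menger bal large = route (length start) start ≤-refl record
    { balanced = λ S → trans (∑-map (λ a → ⟦ S (src a) ⟧) es₀) (trans (bal S) (sym (∑-map (λ a → ⟦ S (dst a) ⟧) es₀)))
    ; large    = λ S bt → ≤-trans (large S bt) (≤-reflexive (sym (∑-map (out S) es₀)))
    ; weight   = λ f → trans (∑-map (∑ f ∘ edges) es₀) (∑-cong (allFin (nE G)) (λ e → +-identityʳ (f e)))
    }
    where
    single : Fin (nE G) → Arc
    single e = trail (one e refl refl) λ ()
    es₀ = allFin (nE G)
    start = map single es₀
    ∑-map : ∀ (f : Arc → ℕ) es → ∑ f (map single es) ≡ ∑ (f ∘ single) es
    ∑-map f []    = refl
    ∑-map f (e ∷ es) = cong (f (single e) +_) (∑-map f es)

-- Immersions of pieces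

clash : ∀ {b} → b ≡ true → b ≡ false → ⊥
clash refl ()

¬true : ∀ {b} → ¬ (b ≡ true) → b ≡ false
¬true {false} h = refl
¬true {true}  h = ⊥-elim (h refl)

walk-splice : ∀ {G s s′ t t′} xs {g ys} → Walk G s (xs ++ g ∷ []) t′ → Walk G s′ (g ∷ ys) t → Walk G s (xs ++ g ∷ ys) t
walk-splice [] (one e p q) (one _ _ q′)      = one e p q′
walk-splice [] (one e p q) (more _ _ w)      = more e p w
walk-splice [] (more e p ()) _
walk-splice (x ∷ []) (more e p w) w′          = more e p (walk-splice [] w w′)
walk-splice (x ∷ y ∷ xs) (more e p w) w′      = more e p (walk-splice (y ∷ xs) w w′)

internal-splice : ∀ {G v} xs {g ys} → v ∈ internal G (xs ++ g ∷ ys) → v ∈ internal G (xs ++ g ∷ []) ⊎ v ∈ internal G (g ∷ ys)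
internal-splice [] v∈ = inj₂ v∈
internal-splice (x ∷ []) (here q) = inj₁ (here q)
internal-splice (x ∷ []) (there v∈) = inj₂ v∈
internal-splice (x ∷ y ∷ xs) (here q) = inj₁ (here q)
internal-splice (x ∷ y ∷ xs) (there v∈) = [ (λ p → inj₁ (there p)) , inj₂ ]′ (internal-splice (y ∷ xs) v∈)

internal-head : ∀ {G v} xs → v ∈ internal G xs → ∃[ g ] (g ∈ xs × v ≡ head G g)
internal-head (x ∷ y ∷ xs) (here q)   = x , here refl , q
internal-head (x ∷ y ∷ xs) (there v∈) = let g , g∈ , q = internal-head (y ∷ xs) v∈ in g , there g∈ , q

internal-head-init : ∀ {G v o} xs → v ∈ internal G (xs ++ o ∷ []) → ∃[ g ] (g ∈ xs × v ≡ head G g)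
internal-head-init (x ∷ []) (here q) = x , here refl , q
internal-head-init (x ∷ y ∷ xs) (here q)   = x , here refl , q
internal-head-init (x ∷ y ∷ xs) (there v∈) = let g , g∈ , q = internal-head-init (y ∷ xs) v∈ in g , there g∈ , q

head-internal : ∀ {G o g} xs → g ∈ xs → head G g ∈ internal G (xs ++ o ∷ [])
head-internal (x ∷ [])     (here refl) = here refl
head-internal (x ∷ y ∷ xs) (here refl) = here refl
head-internal (x ∷ y ∷ xs) (there g∈)  = there (head-internal (y ∷ xs) g∈)

walk-head : ∀ {G s es t g} → Walk G s es t → g ∈ es → head G g ≡ t ⊎ head G g ∈ internal G es
walk-head (one e p q) (here refl) = inj₁ q
walk-head (more e p (one _ _ _)) (here refl) = inj₂ (here refl)
walk-head (more e p (more _ _ _)) (here refl) = inj₂ (here refl)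
walk-head (more e p w@(one _ _ _)) (there g∈) with walk-head w g∈
... | inj₁ q = inj₁ q
walk-head (more e p w@(more _ _ _)) (there g∈) with walk-head w g∈
... | inj₁ q = inj₁ q
... | inj₂ q = inj₂ (there q)

walk-tail : ∀ {G s e es t g} → Walk G s (e ∷ es) t → g ∈ es → tail G g ∈ internal G (e ∷ es)
walk-tail (more e p (one _ q _)) (here refl) = here q
walk-tail (more e p (more _ q _)) (here refl) = here q
walk-tail (more e p w@(more _ _ _)) (there g∈) = there (walk-tail w g∈)

-- The two numberings are the interface along which immersions are glued; in an Eulerian digraph
-- equally many edges leave and enter a set, so one `w` serves both.
record Piece (G : Digraph) (w : ℕ) : Set where
  field
    set : VSet (nV G)
    o i : Fin w → Fin (nE G)
    o-cut : ∀ a → set (tail G (o a)) ≡ true × set (head G (o a)) ≡ false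
    i-cut : ∀ b → set (tail G (i b)) ≡ false × set (head G (i b)) ≡ true
    o-inj : ∀ {a b} → o a ≡ o b → a ≡ b
    i-inj : ∀ {a b} → i a ≡ i b → a ≡ b
    o-sur : ∀ e → set (tail G e) ≡ true → set (head G e) ≡ false → ∃[ a ] o a ≡ e
    i-sur : ∀ e → set (tail G e) ≡ false → set (head G e) ≡ true → ∃[ a ] i a ≡ e
open Piece public

module _ {H G : Digraph} {w : ℕ} (P : Piece H w) (Q : Piece G w) (φ : ∀ v → set P v ≡ true → Fin (nV G)) where

  -- The image of an edge that enters `P` begins with the equally numbered edge that enters `Q`;
  -- otherwise it begins at the image of the tail. An edge with both ends outside `P` has no start.
  data Start (f : Fin (nE H)) : Fin (nV G) → List (Fin (nE G)) → Set where
    vtx : (p : set P (tail H f) ≡ true) → Start f (φ _ p) []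
    bdy : ∀ b → i P b ≡ f → Start f (tail G (i Q b)) (i Q b ∷ [])

  data End (f : Fin (nE H)) : Fin (nV G) → List (Fin (nE G)) → Set where
    vtx : (p : set P (head H f) ≡ true) → End f (φ _ p) []
    bdy : ∀ a → o P a ≡ f → End f (head G (o Q a)) (o Q a ∷ [])

-- An immersion of the part inside `P`. `mid f` is the stretch inside `Q`, kept apart from the
-- boundary edges at its ends, because an edge between two siblings is a boundary edge of both and
-- must occur once after gluing.
record _⊑_ {H G : Digraph} {w : ℕ} (P : Piece H w) (Q : Piece G w) : Set where
  field
    φ      : ∀ v → set P v ≡ true → Fin (nV G)
    φ-in   : ∀ v p → set Q (φ v p) ≡ true
    φ-inj  : ∀ {u v} p q → φ u p ≡ φ v q → u ≡ v
    mid    : Fin (nE H) → List (Fin (nE G))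
    walk   : ∀ {f s t st en} → Start P Q φ f s st → End P Q φ f t en → Walk G s (st ++ mid f ++ en) t
    strong : ∀ {f s t st en} → Start P Q φ f s st → End P Q φ f t en → ∀ v p → φ v p ∉ internal G (st ++ mid f ++ en)
    inside : ∀ {f g} → g ∈ mid f → set Q (tail G g) ≡ true × set Q (head G g) ≡ true
    unique : ∀ f → Unique (mid f)
    disj   : ∀ {f f′ g} → g ∈ mid f → g ∈ mid f′ → f ≡ f′
    idle   : ∀ f → set P (tail H f) ≡ false → set P (head H f) ≡ false → mid f ≡ []

module _ {H G : Digraph} {w : ℕ} {P : Piece H w} {Q : Piece G w} (m : P ⊑ Q) where
  open _⊑_ m

  internal-inside : ∀ {f s t st en} → Start P Q φ f s st → End P Q φ f t en → ∀ {v} →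
                    v ∈ internal G (st ++ mid f ++ en) → set Q v ≡ true
  internal-inside {f} (vtx _) (vtx _) v∈ with internal-head (mid f ++ []) v∈
  ... | g , g∈ , refl = proj₂ (inside (subst (g ∈_) (++-identityʳ (mid f)) g∈))
  internal-inside {f} (vtx _) (bdy _ _) v∈ with internal-head-init (mid f) v∈
  ... | g , g∈ , refl = proj₂ (inside g∈)
  internal-inside {f} (bdy b _) (vtx _) v∈ with internal-head (i Q b ∷ mid f ++ []) v∈
  ... | g , here refl , refl = proj₂ (i-cut Q b)
  ... | g , there g∈ , refl = proj₂ (inside (subst (g ∈_) (++-identityʳ (mid f)) g∈))
  internal-inside {f} (bdy b _) (bdy _ _) v∈ with internal-head-init (i Q b ∷ mid f) v∈
  ... | g , here refl , refl = proj₂ (i-cut Q b)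
  ... | g , there g∈ , refl = proj₂ (inside g∈)

record Splits {G w w₁ w₂} (P : Piece G w) (P₁ : Piece G w₁) (P₂ : Piece G w₂) : Set where
  field
    union : ∀ v → set P v ≡ set P₁ v ∨ set P₂ v
    apart : ∀ v → set P₁ v ≡ true → set P₂ v ≡ false

-- Gluing patterns carry over from `H` to `G`. An edge leaving one sibling either leaves the parent
-- or enters the other sibling, and likewise for entering edges, which accounts for the six pairs.
record Compatible {H G w w₁ w₂} (P : Piece H w) (P₁ : Piece H w₁) (P₂ : Piece H w₂)
                  (Q : Piece G w) (Q₁ : Piece G w₁) (Q₂ : Piece G w₂) : Set where
  field
    o₁o : ∀ {a c} → o P₁ a ≡ o P c → o Q₁ a ≡ o Q c
    i₁i : ∀ {a c} → i P₁ a ≡ i P c → i Q₁ a ≡ i Q c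
    o₂o : ∀ {a c} → o P₂ a ≡ o P c → o Q₂ a ≡ o Q c
    i₂i : ∀ {a c} → i P₂ a ≡ i P c → i Q₂ a ≡ i Q c
    o₁i₂ : ∀ {a c} → o P₁ a ≡ i P₂ c → o Q₁ a ≡ i Q₂ c
    o₂i₁ : ∀ {a c} → o P₂ a ≡ i P₁ c → o Q₂ a ≡ i Q₁ c

splits-swap : ∀ {G w w₁ w₂} {P : Piece G w} {P₁ : Piece G w₁} {P₂ : Piece G w₂} → Splits P P₁ P₂ → Splits P P₂ P₁
splits-swap {P₁ = P₁} {P₂} S = record
  { union = λ v → trans (union v) (∨-comm (set P₁ v) (set P₂ v))
  ; apart = λ v p → ¬true (λ q → clash p (apart v q)) }
  where open Splits S

compatible-swap : ∀ {H G w w₁ w₂} {P : Piece H w} {P₁ : Piece H w₁} {P₂ : Piece H w₂} {Q : Piece G w} {Q₁ : Piece G w₁} {Q₂ : Piece G w₂} →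
                  Compatible P P₁ P₂ Q Q₁ Q₂ → Compatible P P₂ P₁ Q Q₂ Q₁
compatible-swap C = record { o₁o = o₂o ; i₁i = i₂i ; o₂o = o₁o ; i₂i = i₁i ; o₁i₂ = o₂i₁ ; o₂i₁ = o₁i₂ }
  where open Compatible C

-- The facts about the first of two siblings; those about the second follow by `splits-swap` and
-- `compatible-swap`.
module Half {H G w w₁ w₂} {P : Piece H w} {P₁ : Piece H w₁} {P₂ : Piece H w₂} {Q : Piece G w} {Q₁ : Piece G w₁} {Q₂ : Piece G w₂}
            (S : Splits P P₁ P₂) (S′ : Splits Q Q₁ Q₂) (C : Compatible P P₁ P₂ Q Q₁ Q₂) (m₁ : P₁ ⊑ Q₁) (m₂ : P₂ ⊑ Q₂)
            (φ : ∀ v → set P v ≡ true → Fin (nV G))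
            (φ₁ : ∀ v p p₁ → φ v p ≡ _⊑_.φ m₁ v p₁) (φ₂ : ∀ v p p₂ → φ v p ≡ _⊑_.φ m₂ v p₂) where
  open Splits S
  open Compatible C
  module M₁ = _⊑_ m₁
  module M₂ = _⊑_ m₂

  only-left : ∀ {v b} → set P₂ v ≡ false → set P v ≡ b → set P₁ v ≡ b
  only-left {v} q p with union v
  ... | u rewrite q = trans (sym (trans u (∨-identityʳ (set P₁ v)))) p

  in-left : ∀ {v} → set P₁ v ≡ true → set P v ≡ true
  in-left {v} p = trans (union v) (∨-introˡ _ p)

  start-left : ∀ {f s st} → set P₂ (tail H f) ≡ false → set P₂ (head H f) ≡ false → Start P Q φ f s st → Start P₁ Q₁ M₁.φ f s st
  start-left {f} q q′ (vtx p) = subst (λ x → Start P₁ Q₁ M₁.φ f x []) (sym (φ₁ _ p (only-left q p))) (vtx (only-left q p))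
  start-left {f} q q′ (bdy b refl) with i-sur P₁ f (only-left q (proj₁ (i-cut P b))) (only-left q′ (proj₂ (i-cut P b)))
  ... | b₁ , e = subst (λ x → Start P₁ Q₁ M₁.φ f (tail G x) (x ∷ [])) (i₁i e) (bdy b₁ e)

  end-left : ∀ {f t en} → set P₂ (tail H f) ≡ false → set P₂ (head H f) ≡ false → End P Q φ f t en → End P₁ Q₁ M₁.φ f t en
  end-left {f} q q′ (vtx p) = subst (λ x → End P₁ Q₁ M₁.φ f x []) (sym (φ₁ _ p (only-left q′ p))) (vtx (only-left q′ p))
  end-left {f} q q′ (bdy a refl) with o-sur P₁ f (only-left q (proj₁ (o-cut P a))) (only-left q′ (proj₂ (o-cut P a)))
  ... | a₁ , e = subst (λ x → End P₁ Q₁ M₁.φ f (head G x) (x ∷ [])) (o₁o e) (bdy a₁ e)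

  avoid-left : ∀ {f s t st en} → Start P₁ Q₁ M₁.φ f s st → End P₁ Q₁ M₁.φ f t en → ∀ v p → φ v p ∉ internal G (st ++ M₁.mid f ++ en)
  avoid-left {f} {st = st} {en} s e v p v∈ with ∨-true (trans (sym (union v)) p)
  ... | inj₁ p₁ = M₁.strong s e v p₁ (subst (_∈ internal G (st ++ M₁.mid f ++ en)) (φ₁ v p p₁) v∈)
  ... | inj₂ p₂ = clash (M₂.φ-in v p₂) (subst (λ x → set Q₂ x ≡ false) (φ₂ v p p₂) (Splits.apart S′ _ (internal-inside m₁ s e v∈)))

  module _ {f a b} (oa : o P₁ a ≡ f) (ib : i P₂ b ≡ f) where

    tail-left : set P₁ (tail H f) ≡ true
    tail-left = subst (λ x → set P₁ (tail H x) ≡ true) oa (proj₁ (o-cut P₁ a))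

    head-right : set P₂ (head H f) ≡ true
    head-right = subst (λ x → set P₂ (head H x) ≡ true) ib (proj₂ (i-cut P₂ b))

    in-right : set P (head H f) ≡ true
    in-right = trans (union _) (∨-introʳ _ head-right)

    cross-start : ∀ {s st} → Start P Q φ f s st → st ≡ [] × Start P₁ Q₁ M₁.φ f s []
    cross-start (vtx p) = refl , subst (λ x → Start P₁ Q₁ M₁.φ f x []) (sym (φ₁ _ p tail-left)) (vtx tail-left)
    cross-start (bdy b′ refl) = ⊥-elim (clash (in-left tail-left) (proj₁ (i-cut P b′)))

    cross-end : ∀ {t en} → End P Q φ f t en → en ≡ [] × End P₂ Q₂ M₂.φ f t []
    cross-end (vtx p) = refl , subst (λ x → End P₂ Q₂ M₂.φ f x []) (sym (φ₂ _ p head-right)) (vtx head-right)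
    cross-end (bdy a′ refl) = ⊥-elim (clash in-right (proj₂ (o-cut P a′)))

    same-edge : i Q₂ b ≡ o Q₁ a
    same-edge = sym (o₁i₂ (trans oa (sym ib)))

    right-start : Start P₂ Q₂ M₂.φ f (tail G (o Q₁ a)) (o Q₁ a ∷ [])
    right-start = subst (λ x → Start P₂ Q₂ M₂.φ f (tail G x) (x ∷ [])) same-edge (bdy b ib)

    reassoc : (o Q₁ a ∷ M₂.mid f ++ []) ≡ o Q₁ a ∷ M₂.mid f
    reassoc = cong (o Q₁ a ∷_) (++-identityʳ (M₂.mid f))

    cross-walk : ∀ {s t st en} → Start P Q φ f s st → End P Q φ f t en → Walk G s (st ++ (M₁.mid f ++ o Q₁ a ∷ M₂.mid f) ++ en) t
    cross-walk {t = t} s e with cross-start s | cross-end e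
    ... | refl , s₁ | refl , e₂ = subst (λ es → Walk G _ es _) (sym (++-identityʳ (M₁.mid f ++ o Q₁ a ∷ M₂.mid f)))
      (walk-splice (M₁.mid f) (M₁.walk s₁ (bdy a oa)) (subst (λ es → Walk G (tail G (o Q₁ a)) es t) reassoc (M₂.walk right-start e₂)))

    cross-unique : Unique (M₁.mid f ++ o Q₁ a ∷ M₂.mid f)
    cross-unique = ++⁺ (M₁.unique f) (All.tabulate (λ { g∈ refl → clash (proj₁ (o-cut Q₁ a)) (¬true λ t → clash (proj₁ (M₂.inside g∈)) (Splits.apart S′ _ t)) }) ∷ M₂.unique f)
      λ { (g∈ , here refl) → clash (proj₂ (M₁.inside g∈)) (proj₂ (o-cut Q₁ a))
        ; (g∈ , there g∈′) → clash (proj₁ (M₂.inside g∈′)) (Splits.apart S′ _ (proj₁ (M₁.inside g∈))) }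

  module Right (avoid-right : ∀ {f s t st en} → Start P₂ Q₂ M₂.φ f s st → End P₂ Q₂ M₂.φ f t en → ∀ v p → φ v p ∉ internal G (st ++ M₂.mid f ++ en)) where

    cross-strong : ∀ {f a b} (oa : o P₁ a ≡ f) (ib : i P₂ b ≡ f) {s t st en} → Start P Q φ f s st → End P Q φ f t en → ∀ v p →
                   φ v p ∉ internal G (st ++ (M₁.mid f ++ o Q₁ a ∷ M₂.mid f) ++ en)
    cross-strong {f} {a} oa ib s e v p v∈ with cross-start oa ib s | cross-end oa ib e
    ... | refl , s₁ | refl , e₂ with internal-splice (M₁.mid f) (subst (λ es → φ v p ∈ internal G es) (++-identityʳ (M₁.mid f ++ o Q₁ a ∷ M₂.mid f)) v∈)
    ...   | inj₁ q = avoid-left s₁ (bdy a oa) v p q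
    ...   | inj₂ q = avoid-right (right-start oa ib) e₂ v p (subst (λ es → φ v p ∈ internal G es) (sym (reassoc oa ib)) q)

module Glue {H G w w₁ w₂} {P : Piece H w} {P₁ : Piece H w₁} {P₂ : Piece H w₂} {Q : Piece G w} {Q₁ : Piece G w₁} {Q₂ : Piece G w₂}
            (S : Splits P P₁ P₂) (S′ : Splits Q Q₁ Q₂) (C : Compatible P P₁ P₂ Q Q₁ Q₂) (m₁ : P₁ ⊑ Q₁) (m₂ : P₂ ⊑ Q₂) where
  open Splits S
  module N₁ = _⊑_ m₁
  module N₂ = _⊑_ m₂

  φ-cases : ∀ v → set P v ≡ true → ∀ b → set P₁ v ≡ b → Fin (nV G)
  φ-cases v p true  q = N₁.φ v q
  φ-cases v p false q = N₂.φ v (trans (sym (trans (union v) (cong (_∨ set P₂ v) q))) p)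

  φ : ∀ v → set P v ≡ true → Fin (nV G)
  φ v p = φ-cases v p (set P₁ v) refl

  φ₁ : ∀ v p p₁ → φ v p ≡ N₁.φ v p₁
  φ₁ v p p₁ = go (set P₁ v) refl
    where
    go : ∀ b q → φ-cases v p b q ≡ N₁.φ v p₁
    go true q  = cong (N₁.φ v) (uip q p₁)
    go false q = ⊥-elim (clash p₁ q)

  φ₂ : ∀ v p p₂ → φ v p ≡ N₂.φ v p₂
  φ₂ v p p₂ = go (set P₁ v) refl
    where
    go : ∀ b q → φ-cases v p b q ≡ N₂.φ v p₂
    go true q  = ⊥-elim (clash p₂ (apart v q))
    go false q = cong (N₂.φ v) (uip _ p₂)

  module L = Half S S′ C m₁ m₂ φ φ₁ φ₂
  module R = Half (splits-swap S) (splits-swap S′) (compatible-swap C) m₂ m₁ φ φ₂ φ₁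

  data Kind (f : Fin (nE H)) : Set where
    cross₁₂ : ∀ a b → o P₁ a ≡ f → i P₂ b ≡ f → Kind f
    cross₂₁ : ∀ a b → o P₂ a ≡ f → i P₁ b ≡ f → Kind f
    only₁   : set P₂ (tail H f) ≡ false → set P₂ (head H f) ≡ false → Kind f
    only₂   : set P₁ (tail H f) ≡ false → set P₁ (head H f) ≡ false → Kind f

  kind : ∀ f → Kind f
  kind f = go _ _ _ _ refl refl refl refl
    where
    go : ∀ a b c d → set P₁ (tail H f) ≡ a → set P₁ (head H f) ≡ b → set P₂ (tail H f) ≡ c → set P₂ (head H f) ≡ d → Kind f
    go false false c d p q r s = only₂ p q
    go true true c d p q r s = only₁ (apart _ p) (apart _ q)
    go true false c false p q r s = only₁ (apart _ p) s
    go false true false d p q r s = only₁ r (apart _ q)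
    go true false c true p q r s =
      let a , e = o-sur P₁ f p q ; b , e′ = i-sur P₂ f (apart _ p) s in cross₁₂ a b e e′
    go false true true d p q r s =
      let a , e = o-sur P₂ f r (apart _ q) ; b , e′ = i-sur P₁ f p q in cross₂₁ a b e e′

  mid′ : ∀ f → Kind f → List (Fin (nE G))
  -- By compatibility the edge that leaves `Q₁` and the edge that enters `Q₂` with the numbers of
  -- `f` are one edge, so it is inserted once.
  mid′ f (cross₁₂ a b _ _) = N₁.mid f ++ o Q₁ a ∷ N₂.mid f
  mid′ f (cross₂₁ a b _ _) = N₂.mid f ++ o Q₂ a ∷ N₁.mid f
  mid′ f (only₁ _ _) = N₁.mid f
  mid′ f (only₂ _ _) = N₂.mid f

  walk : ∀ {f s t st en} (k : Kind f) → Start P Q φ f s st → End P Q φ f t en → Walk G s (st ++ mid′ f k ++ en) t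
  walk (cross₁₂ a b p q) s e = L.cross-walk p q s e
  walk (cross₂₁ a b p q) s e = R.cross-walk p q s e
  walk (only₁ p q) s e = N₁.walk (L.start-left p q s) (L.end-left p q e)
  walk (only₂ p q) s e = N₂.walk (R.start-left p q s) (R.end-left p q e)

  strong : ∀ {f s t st en} (k : Kind f) → Start P Q φ f s st → End P Q φ f t en → ∀ v p → φ v p ∉ internal G (st ++ mid′ f k ++ en)
  strong (cross₁₂ a b p q) s e = L.Right.cross-strong R.avoid-left p q s e
  strong (cross₂₁ a b p q) s e = R.Right.cross-strong L.avoid-left p q s e
  strong (only₁ p q) s e = L.avoid-left (L.start-left p q s) (L.end-left p q e)
  strong (only₂ p q) s e = R.avoid-left (R.start-left p q s) (R.end-left p q e)

  unique : ∀ {f} (k : Kind f) → Unique (mid′ f k)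
  unique (cross₁₂ a b p q) = L.cross-unique p q
  unique (cross₂₁ a b p q) = R.cross-unique p q
  unique (only₁ p q) = N₁.unique _
  unique (only₂ p q) = N₂.unique _

  -- An edge of the target is placed by which of its ends lie on the first side.
  Place : Fin (nE G) → Bool → Bool → Set
  Place g x y = set Q₁ (tail G g) ≡ x × set Q₁ (head G g) ≡ y × set Q₂ (tail G g) ≡ not x × set Q₂ (head G g) ≡ not y

  data Loc (f : Fin (nE H)) (g : Fin (nE G)) : Bool → Bool → Set where
    loc₁  : g ∈ N₁.mid f → Loc f g true true
    loc₂  : g ∈ N₂.mid f → Loc f g false false
    loc₁₂ : ∀ a → o P₁ a ≡ f → o Q₁ a ≡ g → Loc f g true false
    loc₂₁ : ∀ a → o P₂ a ≡ f → o Q₂ a ≡ g → Loc f g false true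

  apart′ : ∀ v → set Q₂ v ≡ true → set Q₁ v ≡ false
  apart′ = Splits.apart (splits-swap S′)

  locate : ∀ {f g} (k : Kind f) → g ∈ mid′ f k → ∃[ x ] ∃[ y ] (Place g x y × Loc f g x y)
  locate₁ : ∀ {f g} → g ∈ N₁.mid f → ∃[ x ] ∃[ y ] (Place g x y × Loc f g x y)
  locate₁ g∈ = let t , h = N₁.inside g∈ in true , true , (t , h , Splits.apart S′ _ t , Splits.apart S′ _ h) , loc₁ g∈
  locate₂ : ∀ {f g} → g ∈ N₂.mid f → ∃[ x ] ∃[ y ] (Place g x y × Loc f g x y)
  locate₂ g∈ = let t , h = N₂.inside g∈ in false , false , (apart′ _ t , apart′ _ h , t , h) , loc₂ g∈
  locate (only₁ _ _) g∈ = locate₁ g∈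
  locate (only₂ _ _) g∈ = locate₂ g∈
  locate {f} (cross₁₂ a b p q) g∈ with ∈-++⁻ (N₁.mid f) g∈
  ... | inj₁ g∈′ = locate₁ g∈′
  ... | inj₂ (there g∈′) = locate₂ g∈′
  ... | inj₂ (here refl) = true , false , (proj₁ (o-cut Q₁ a) , proj₂ (o-cut Q₁ a) , Splits.apart S′ _ (proj₁ (o-cut Q₁ a)) ,
          subst (λ x → set Q₂ (head G x) ≡ true) (L.same-edge p q) (proj₂ (i-cut Q₂ b))) , loc₁₂ a p refl
  locate {f} (cross₂₁ a b p q) g∈ with ∈-++⁻ (N₂.mid f) g∈
  ... | inj₁ g∈′ = locate₂ g∈′
  ... | inj₂ (there g∈′) = locate₁ g∈′
  ... | inj₂ (here refl) = false , true , (apart′ _ (proj₁ (o-cut Q₂ a)) ,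
          subst (λ x → set Q₁ (head G x) ≡ true) (R.same-edge p q) (proj₂ (i-cut Q₁ b)) , proj₁ (o-cut Q₂ a) , proj₂ (o-cut Q₂ a)) , loc₂₁ a p refl

  loc-unique : ∀ {f f′ g x y} → Loc f g x y → Loc f′ g x y → f ≡ f′
  loc-unique (loc₁ p) (loc₁ q) = N₁.disj p q
  loc-unique (loc₂ p) (loc₂ q) = N₂.disj p q
  loc-unique (loc₁₂ a p q) (loc₁₂ b p′ q′) = trans (sym p) (trans (cong (o P₁) (o-inj Q₁ (trans q (sym q′)))) p′)
  loc-unique (loc₂₁ a p q) (loc₂₁ b p′ q′) = trans (sym p) (trans (cong (o P₂) (o-inj Q₂ (trans q (sym q′)))) p′)

  -- The sides on which the ends of a target edge lie tell in which of four places a path can use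
  -- it: inside either sibling, or crossing in either direction. Within each place the edge
  -- determines `f`.
  disj : ∀ {f f′ g} (k : Kind f) (k′ : Kind f′) → g ∈ mid′ f k → g ∈ mid′ f′ k′ → f ≡ f′
  disj k k′ g∈ g∈′ with locate k g∈ | locate k′ g∈′
  ... | x , y , (p , q , _) , l | x′ , y′ , (p′ , q′ , _) , l′ with trans (sym p) p′ | trans (sym q) q′
  ...   | refl | refl = loc-unique l l′

  inside : ∀ {f g} (k : Kind f) → g ∈ mid′ f k → set Q (tail G g) ≡ true × set Q (head G g) ≡ true
  inside {g = g} k g∈ with locate k g∈
  ... | x , y , (p , q , r , s) , _ = whole p r , whole q s
    where
    whole : ∀ {v b} → set Q₁ v ≡ b → set Q₂ v ≡ not b → set Q v ≡ true
    whole {v} {true}  p r = trans (Splits.union S′ v) (∨-introˡ _ p)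
    whole {v} {false} p r = trans (Splits.union S′ v) (∨-introʳ _ r)

  φ-in : ∀ v p → set Q (φ v p) ≡ true
  φ-in v p with ∨-true (trans (sym (union v)) p)
  ... | inj₁ q = trans (Splits.union S′ _) (∨-introˡ _ (subst (λ x → set Q₁ x ≡ true) (sym (φ₁ v p q)) (N₁.φ-in v q)))
  ... | inj₂ q = trans (Splits.union S′ _) (∨-introʳ _ (subst (λ x → set Q₂ x ≡ true) (sym (φ₂ v p q)) (N₂.φ-in v q)))

  φ-inj : ∀ {u v} p q → φ u p ≡ φ v q → u ≡ v
  φ-inj {u} {v} p q e with ∨-true (trans (sym (union u)) p) | ∨-true (trans (sym (union v)) q)
  ... | inj₁ p′ | inj₁ q′ = N₁.φ-inj p′ q′ (trans (sym (φ₁ u p p′)) (trans e (φ₁ v q q′)))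
  ... | inj₂ p′ | inj₂ q′ = N₂.φ-inj p′ q′ (trans (sym (φ₂ u p p′)) (trans e (φ₂ v q q′)))
  ... | inj₁ p′ | inj₂ q′ = ⊥-elim (clash (N₂.φ-in v q′) (subst (λ x → set Q₂ x ≡ false) (trans (sym (φ₁ u p p′)) (trans e (φ₂ v q q′))) (Splits.apart S′ _ (N₁.φ-in u p′))))
  ... | inj₂ p′ | inj₁ q′ = ⊥-elim (clash (N₂.φ-in u p′) (subst (λ x → set Q₂ x ≡ false) (trans (sym (φ₁ v q q′)) (trans (sym e) (φ₂ u p p′))) (Splits.apart S′ _ (N₁.φ-in v q′))))

  idle : ∀ f (k : Kind f) → set P (tail H f) ≡ false → set P (head H f) ≡ false → mid′ f k ≡ []
  idle f (cross₁₂ a b p q) t h = ⊥-elim (clash (L.in-left (L.tail-left p q)) t)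
  idle f (cross₂₁ a b p q) t h = ⊥-elim (clash (R.in-left (R.tail-left p q)) t)
  idle f (only₁ p q) t h = N₁.idle f (L.only-left p t) (L.only-left q h)
  idle f (only₂ p q) t h = N₂.idle f (R.only-left p t) (R.only-left q h)

  glue : P ⊑ Q
  glue = record
    { φ = φ ; φ-in = φ-in ; φ-inj = φ-inj ; mid = λ f → mid′ f (kind f)
    ; walk = walk (kind _) ; strong = strong (kind _) ; inside = inside (kind _) ; unique = λ f → unique (kind f)
    ; disj = disj (kind _) (kind _) ; idle = λ f → idle f (kind f) }

-- Disjoint trails between the boundaries of `P` and `Q` that respect the numbers. Each trail
-- contains both boundary edges, which may be the same edge; therefore it is described once without
-- its last and once without its first edge.
record Link {G w} (P Q : Piece G w) : Set where
  Mid : Fin (nV G) → Set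
  Mid v = set P v ≡ false × set Q v ≡ true
  field
    sub      : set P ⊆ set Q
    o-init   : Fin w → List (Fin (nE G))
    o-rest   : Fin w → List (Fin (nE G))
    o-starts : ∀ a → o-init a ++ o Q a ∷ [] ≡ o P a ∷ o-rest a
    o-walk   : ∀ a → Walk G (tail G (o P a)) (o-init a ++ o Q a ∷ []) (head G (o Q a))
    o-mid    : ∀ a {v} → v ∈ internal G (o-init a ++ o Q a ∷ []) → Mid v
    i-rest   : Fin w → List (Fin (nE G))
    i-init   : Fin w → List (Fin (nE G))
    i-ends   : ∀ b → i Q b ∷ i-rest b ≡ i-init b ++ i P b ∷ []
    i-walk   : ∀ b → Walk G (tail G (i Q b)) (i Q b ∷ i-rest b) (head G (i P b))
    i-mid    : ∀ b {v} → v ∈ internal G (i Q b ∷ i-rest b) → Mid v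
    o-unique : ∀ a → Unique (o-init a)
    i-unique : ∀ b → Unique (i-rest b)
    oo-disj  : ∀ {a a′ g} → g ∈ o-init a → g ∈ o-init a′ → a ≡ a′
    ii-disj  : ∀ {b b′ g} → g ∈ i-rest b → g ∈ i-rest b′ → b ≡ b′
    oi-disj  : ∀ {a b g} → g ∈ o-init a → g ∈ i-rest b → ⊥

-- Every path that leaves or enters `P` is prolonged along the trail with its number. The new
-- interior vertices lie outside `P` and hence are no images, which keeps the immersion strong.
module Extend {H G w} {P₀ : Piece H w} {P Q : Piece G w} (m : P₀ ⊑ P) (ℓ : Link P Q) where
  open Link ℓ
  module M = _⊑_ m

  data Kind (f : Fin (nE H)) : Set where
    outgoing : ∀ a → o P₀ a ≡ f → Kind f
    incoming : ∀ b → i P₀ b ≡ f → Kind f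
    neither  : set P₀ (tail H f) ≡ set P₀ (head H f) → Kind f

  kind : ∀ f → Kind f
  kind f = go _ _ refl refl
    where
    go : ∀ a b → set P₀ (tail H f) ≡ a → set P₀ (head H f) ≡ b → Kind f
    go false false p q = neither (trans p (sym q))
    go true true p q   = neither (trans p (sym q))
    go true false p q  = let a , e = o-sur P₀ f p q in outgoing a e
    go false true p q  = let b , e = i-sur P₀ f p q in incoming b e

  mid′ : ∀ f → Kind f → List (Fin (nE G))
  mid′ f (outgoing a _) = M.mid f ++ o-init a
  mid′ f (incoming b _) = i-rest b ++ M.mid f
  mid′ f (neither _)    = M.mid f

  start-out : ∀ {f a s st} → o P₀ a ≡ f → Start P₀ Q M.φ f s st → st ≡ [] × Start P₀ P M.φ f s []
  start-out e (vtx p) = refl , vtx p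
  start-out {a = a} refl (bdy b q) = ⊥-elim (clash (proj₁ (o-cut P₀ a)) (subst (λ f → set P₀ (tail H f) ≡ false) q (proj₁ (i-cut P₀ b))))

  end-out : ∀ {f a t en} → o P₀ a ≡ f → End P₀ Q M.φ f t en → t ≡ head G (o Q a) × en ≡ o Q a ∷ []
  end-out {a = a} refl (vtx p) = ⊥-elim (clash p (proj₂ (o-cut P₀ a)))
  end-out {a = a} refl (bdy a′ q) with o-inj P₀ q
  ... | refl = refl , refl

  start-in : ∀ {f b s st} → i P₀ b ≡ f → Start P₀ Q M.φ f s st → s ≡ tail G (i Q b) × st ≡ i Q b ∷ []
  start-in {b = b} refl (vtx p) = ⊥-elim (clash p (proj₁ (i-cut P₀ b)))
  start-in {b = b} refl (bdy b′ q) with i-inj P₀ q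
  ... | refl = refl , refl

  end-in : ∀ {f b t en} → i P₀ b ≡ f → End P₀ Q M.φ f t en → en ≡ [] × End P₀ P M.φ f t []
  end-in e (vtx p) = refl , vtx p
  end-in {b = b} refl (bdy a q) = ⊥-elim (clash (proj₂ (i-cut P₀ b)) (subst (λ f → set P₀ (head H f) ≡ false) q (proj₂ (o-cut P₀ a))))

  start-neither : ∀ {f s st} → set P₀ (tail H f) ≡ set P₀ (head H f) → Start P₀ Q M.φ f s st → Start P₀ P M.φ f s st
  start-neither e (vtx p) = vtx p
  start-neither e (bdy b refl) = ⊥-elim (clash (trans e (proj₂ (i-cut P₀ b))) (proj₁ (i-cut P₀ b)))

  end-neither : ∀ {f t en} → set P₀ (tail H f) ≡ set P₀ (head H f) → End P₀ Q M.φ f t en → End P₀ P M.φ f t en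
  end-neither e (vtx p) = vtx p
  end-neither e (bdy a refl) = ⊥-elim (clash (proj₁ (o-cut P₀ a)) (trans e (proj₂ (o-cut P₀ a))))

  regroup-out : ∀ f a → (M.mid f ++ o-init a) ++ o Q a ∷ [] ≡ M.mid f ++ o P a ∷ o-rest a
  regroup-out f a = trans (++-assoc (M.mid f) (o-init a) _) (cong (M.mid f ++_) (o-starts a))

  regroup-in : ∀ f b → i Q b ∷ (i-rest b ++ M.mid f) ++ [] ≡ i-init b ++ i P b ∷ M.mid f
  regroup-in f b = trans (cong (i Q b ∷_) (++-identityʳ (i-rest b ++ M.mid f)))
    (trans (cong (_++ M.mid f) (i-ends b)) (++-assoc (i-init b) _ _))

  in-walk : ∀ {f b t} → i P₀ b ≡ f → End P₀ P M.φ f t [] → Walk G (tail G (i P b)) (i P b ∷ M.mid f) t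
  in-walk {f} {b} q e = subst (λ es → Walk G (tail G (i P b)) (i P b ∷ es) _) (++-identityʳ (M.mid f)) (M.walk (bdy b q) e)

  walk : ∀ {f s t st en} (k : Kind f) → Start P₀ Q M.φ f s st → End P₀ Q M.φ f t en → Walk G s (st ++ mid′ f k ++ en) t
  walk (neither q) s e = M.walk (start-neither q s) (end-neither q e)
  walk {f} (outgoing a q) s e with start-out q s | end-out q e
  ... | refl , s′ | refl , refl = subst (λ es → Walk G _ es (head G (o Q a))) (sym (regroup-out f a))
    (walk-splice (M.mid f) (M.walk s′ (bdy a q)) (subst (λ es → Walk G (tail G (o P a)) es (head G (o Q a))) (o-starts a) (o-walk a)))
  walk {f} {t = t} (incoming b q) s e with start-in q s | end-in q e
  ... | refl , refl | refl , e′ = subst (λ es → Walk G (tail G (i Q b)) es t) (sym (regroup-in f b))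
    (walk-splice (i-init b) (subst (λ es → Walk G (tail G (i Q b)) es (head G (i P b))) (i-ends b) (i-walk b)) (in-walk q e′))

  avoid-mid : ∀ {v p x} → M.φ v p ≡ x → Mid x → ⊥
  avoid-mid {v} {p} refl (q , _) = clash (M.φ-in v p) q

  strong : ∀ {f s t st en} (k : Kind f) → Start P₀ Q M.φ f s st → End P₀ Q M.φ f t en → ∀ v p → M.φ v p ∉ internal G (st ++ mid′ f k ++ en)
  strong (neither q) s e = M.strong (start-neither q s) (end-neither q e)
  strong {f} (outgoing a q) s e v p v∈ with start-out q s | end-out q e
  ... | refl , s′ | refl , refl with internal-splice (M.mid f) (subst (λ es → M.φ v p ∈ internal G es) (regroup-out f a) v∈)
  ...   | inj₁ r = M.strong s′ (bdy a q) v p r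
  ...   | inj₂ r = avoid-mid refl (o-mid a (subst (λ es → M.φ v p ∈ internal G es) (sym (o-starts a)) r))
  strong {f} (incoming b q) s e v p v∈ with start-in q s | end-in q e
  ... | refl , refl | refl , e′ with internal-splice (i-init b) (subst (λ es → M.φ v p ∈ internal G es) (regroup-in f b) v∈)
  ...   | inj₁ r = avoid-mid refl (i-mid b (subst (λ es → M.φ v p ∈ internal G es) (sym (i-ends b)) r))
  ...   | inj₂ r = M.strong (bdy b q) e′ v p (subst (λ es → M.φ v p ∈ internal G (i P b ∷ es)) (sym (++-identityʳ (M.mid f))) r)

  data Loc (f : Fin (nE H)) (g : Fin (nE G)) : Set where
    old  : g ∈ M.mid f → Loc f g
    outL : ∀ a → o P₀ a ≡ f → g ∈ o-init a → Loc f g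
    inL  : ∀ b → i P₀ b ≡ f → g ∈ i-rest b → Loc f g

  locate : ∀ {f g} (k : Kind f) → g ∈ mid′ f k → Loc f g
  locate (neither _) g∈ = old g∈
  locate {f} (outgoing a q) g∈ = [ old , outL a q ]′ (∈-++⁻ (M.mid f) g∈)
  locate {f} (incoming b q) g∈ = [ inL b q , old ]′ (∈-++⁻ (i-rest b) g∈)

  init-head : ∀ {a g} → g ∈ o-init a → Mid (head G g)
  init-head {a} g∈ = o-mid a (head-internal (o-init a) g∈)

  rest-tail : ∀ {b g} → g ∈ i-rest b → Mid (tail G g)
  rest-tail {b} g∈ = i-mid b (walk-tail (i-walk b) g∈)

  init-tail : ∀ {a g} → g ∈ o-init a → set Q (tail G g) ≡ true
  init-tail {a} {g} g∈ with subst (g ∈_) (o-starts a) (∈-++⁺ˡ {ys = o Q a ∷ []} g∈)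
  ... | here refl = sub _ (proj₁ (o-cut P a))
  ... | there g∈′ = proj₂ (o-mid a (subst (λ es → tail G g ∈ internal G es) (sym (o-starts a))
                      (walk-tail (subst (λ es → Walk G (tail G (o P a)) es (head G (o Q a))) (o-starts a) (o-walk a)) g∈′)))

  rest-head : ∀ {b g} → g ∈ i-rest b → set Q (head G g) ≡ true
  rest-head {b} {g} g∈ with walk-head (i-walk b) (there g∈)
  ... | inj₁ q = trans (cong (set Q) q) (sub _ (proj₂ (i-cut P b)))
  ... | inj₂ q = proj₂ (i-mid b q)

  loc-inside : ∀ {f g} → Loc f g → set Q (tail G g) ≡ true × set Q (head G g) ≡ true
  loc-inside (old g∈)     = let p , q = M.inside g∈ in sub _ p , sub _ q
  loc-inside (outL a _ g∈) = init-tail g∈ , proj₂ (init-head g∈)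
  loc-inside (inL b _ g∈)  = proj₂ (rest-tail g∈) , rest-head g∈

  loc-unique : ∀ {f f′ g} → Loc f g → Loc f′ g → f ≡ f′
  loc-unique (old p) (old q) = M.disj p q
  loc-unique (old p) (outL a _ q) = ⊥-elim (clash (proj₂ (M.inside p)) (proj₁ (init-head q)))
  loc-unique (old p) (inL b _ q) = ⊥-elim (clash (proj₁ (M.inside p)) (proj₁ (rest-tail q)))
  loc-unique (outL a _ p) (old q) = ⊥-elim (clash (proj₂ (M.inside q)) (proj₁ (init-head p)))
  loc-unique (outL a e p) (outL a′ e′ q) = trans (sym e) (trans (cong (o P₀) (oo-disj p q)) e′)
  loc-unique (outL a _ p) (inL b _ q) = ⊥-elim (oi-disj p q)
  loc-unique (inL b _ p) (old q) = ⊥-elim (clash (proj₁ (M.inside q)) (proj₁ (rest-tail p)))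
  loc-unique (inL b _ p) (outL a _ q) = ⊥-elim (oi-disj q p)
  loc-unique (inL b e p) (inL b′ e′ q) = trans (sym e) (trans (cong (i P₀) (ii-disj p q)) e′)

  unique : ∀ {f} (k : Kind f) → Unique (mid′ f k)
  unique (neither _) = M.unique _
  unique (outgoing a _) = ++⁺ (M.unique _) (o-unique a) λ { (p , q) → clash (proj₂ (M.inside p)) (proj₁ (init-head q)) }
  unique (incoming b _) = ++⁺ (i-unique b) (M.unique _) λ { (q , p) → clash (proj₁ (M.inside p)) (proj₁ (rest-tail q)) }

  idle : ∀ f (k : Kind f) → set P₀ (tail H f) ≡ false → set P₀ (head H f) ≡ false → mid′ f k ≡ []
  idle f (neither _) t h = M.idle f t h
  idle f (outgoing a refl) t h = ⊥-elim (clash (proj₁ (o-cut P₀ a)) t)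
  idle f (incoming b refl) t h = ⊥-elim (clash (proj₂ (i-cut P₀ b)) h)

  extend : P₀ ⊑ Q
  extend = record
    { φ = M.φ ; φ-in = λ v p → sub _ (M.φ-in v p) ; φ-inj = M.φ-inj ; mid = λ f → mid′ f (kind f)
    ; walk = walk (kind _) ; strong = strong (kind _) ; inside = λ {f} g∈ → loc-inside (locate (kind f) g∈)
    ; unique = λ f → unique (kind f) ; disj = λ {f} {f′} p q → loc-unique (locate (kind f) p) (locate (kind f′) q)
    ; idle = λ f → idle f (kind f) }

-- 0 encodes an empty leaf and 1 + m a vertex with m loops.
data LeafPiece {G w} (P : Piece G w) : ℕ → Set where
  empty  : (∀ v → set P v ≡ false) → LeafPiece P 0
  single : ∀ {m} v → set P v ≡ true → (∀ u → set P u ≡ true → u ≡ v) → (loop : Fin m → Fin (nE G)) →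
           (∀ a → tail G (loop a) ≡ v × head G (loop a) ≡ v) → (∀ {a b} → loop a ≡ loop b → a ≡ b) →
           (∀ e → tail G e ≡ v → head G e ≡ v → ∃[ a ] loop a ≡ e) → LeafPiece P (suc m)

module LeafImmersion {H G w} {P : Piece H w} {Q : Piece G w} where

  empty-⊑ : (∀ v → set P v ≡ false) → P ⊑ Q
  empty-⊑ none = record
    { φ = φ ; φ-in = λ v p → ⊥-elim (clash p (none v)) ; φ-inj = λ p _ _ → ⊥-elim (clash p (none _)) ; mid = λ _ → []
    ; walk = λ s e → ⊥-elim (start-no s e) ; strong = λ s e → ⊥-elim (start-no s e)
    ; inside = λ () ; unique = λ _ → [] ; disj = λ () ; idle = λ _ _ _ → refl }
    where
    φ : ∀ v → set P v ≡ true → Fin (nV G)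
    φ v p = ⊥-elim (clash p (none v))
    start-no : ∀ {f s st t en} → Start P Q φ f s st → End P Q φ f t en → ⊥
    start-no (vtx p) _   = clash p (none _)
    start-no (bdy b _) _ = clash (proj₂ (i-cut P b)) (none _)

  module _ {m m′} (m≤m′ : m ≤ m′)
           (v : Fin (nV H)) (Pv : set P v ≡ true) (only-v : ∀ u → set P u ≡ true → u ≡ v)
           (idx : ∀ e → tail H e ≡ v → head H e ≡ v → Fin m)
           (idx-inj : ∀ {e e′ p q p′ q′} → idx e p q ≡ idx e′ p′ q′ → e ≡ e′)
           (u : Fin (nV G)) (Qu : set Q u ≡ true) (only-u : ∀ x → set Q x ≡ true → x ≡ u)
           (loop : Fin m′ → Fin (nE G)) (loop-u : ∀ a → tail G (loop a) ≡ u × head G (loop a) ≡ u)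
           (loop-inj : ∀ {a b} → loop a ≡ loop b → a ≡ b) where

    image : ∀ x → set P x ≡ true → Fin (nV G)
    image _ _ = u

    data IsLoop (f : Fin (nE H)) : Set where
      loop-at : tail H f ≡ v → head H f ≡ v → IsLoop f
      no-loop : (set P (tail H f) ≡ true → set P (head H f) ≡ true → ⊥) → IsLoop f

    isLoop : ∀ f → IsLoop f
    isLoop f = go _ _ refl refl
      where
      go : ∀ a b → set P (tail H f) ≡ a → set P (head H f) ≡ b → IsLoop f
      go true true p q = loop-at (only-v _ p) (only-v _ q)
      go false _ p q = no-loop λ p′ _ → clash p′ p
      go true false p q = no-loop λ _ q′ → clash q′ q

    mid′ : ∀ f → IsLoop f → List (Fin (nE G))
    mid′ f (loop-at p q) = loop (Fin.inject≤ (idx f p q) m≤m′) ∷ []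
    mid′ f (no-loop _) = []

    walk : ∀ {f s t st en} (k : IsLoop f) → Start P Q image f s st → End P Q image f t en → Walk G s (st ++ mid′ f k ++ en) t
    walk (loop-at p q) (vtx _) (vtx _) = one _ (proj₁ (loop-u _)) (proj₂ (loop-u _))
    walk (loop-at refl q) (bdy b refl) _ = ⊥-elim (clash Pv (proj₁ (i-cut P b)))
    walk (loop-at p refl) _ (bdy a refl) = ⊥-elim (clash Pv (proj₂ (o-cut P a)))
    walk (no-loop n) (vtx p) (vtx q) = ⊥-elim (n p q)
    walk (no-loop n) (vtx p) (bdy a refl) = one _ (only-u _ (proj₁ (o-cut Q a))) refl
    walk (no-loop n) (bdy b refl) (vtx q) = one _ refl (only-u _ (proj₂ (i-cut Q b)))
    walk (no-loop n) (bdy b refl) (bdy a q) = ⊥-elim (clash (proj₁ (o-cut P a)) (subst (λ f → set P (tail H f) ≡ false) (sym q) (proj₁ (i-cut P b))))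

    strong : ∀ {f s t st en} (k : IsLoop f) → Start P Q image f s st → End P Q image f t en → ∀ x p → image x p ∉ internal G (st ++ mid′ f k ++ en)
    strong (loop-at p q) (vtx _) (vtx _) _ _ ()
    strong (loop-at refl q) (bdy b refl) _ _ _ _ = ⊥-elim (clash Pv (proj₁ (i-cut P b)))
    strong (loop-at p refl) _ (bdy a refl) _ _ _ = ⊥-elim (clash Pv (proj₂ (o-cut P a)))
    strong (no-loop n) (vtx p) (vtx q) _ _ _ = n p q
    strong (no-loop n) (vtx p) (bdy a _) _ _ ()
    strong (no-loop n) (bdy b _) (vtx q) _ _ ()
    strong (no-loop n) (bdy b refl) (bdy a q) _ _ _ = ⊥-elim (clash (proj₁ (o-cut P a)) (subst (λ f → set P (tail H f) ≡ false) (sym q) (proj₁ (i-cut P b))))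

    inside : ∀ {f g} (k : IsLoop f) → g ∈ mid′ f k → set Q (tail G g) ≡ true × set Q (head G g) ≡ true
    inside (loop-at p q) (here refl) = trans (cong (set Q) (proj₁ (loop-u _))) Qu , trans (cong (set Q) (proj₂ (loop-u _))) Qu

    unique : ∀ {f} (k : IsLoop f) → Unique (mid′ f k)
    unique (loop-at _ _) = [] ∷ []
    unique (no-loop _)    = []

    disj : ∀ {f f′ g} (k : IsLoop f) (k′ : IsLoop f′) → g ∈ mid′ f k → g ∈ mid′ f′ k′ → f ≡ f′
    disj (loop-at _ _) (loop-at _ _) (here p) (here q) = idx-inj (inject≤-injective m≤m′ m≤m′ _ _ (loop-inj (trans (sym p) q)))

    idle : ∀ f (k : IsLoop f) → set P (tail H f) ≡ false → set P (head H f) ≡ false → mid′ f k ≡ []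
    idle f (loop-at refl q) t h = ⊥-elim (clash Pv t)
    idle f (no-loop _) t h = refl

    single-⊑ : P ⊑ Q
    single-⊑ = record
      { φ = image ; φ-in = λ _ _ → Qu ; φ-inj = λ p q _ → trans (only-v _ p) (sym (only-v _ q)) ; mid = λ f → mid′ f (isLoop f)
      ; walk = walk (isLoop _) ; strong = strong (isLoop _) ; inside = λ {f} → inside (isLoop f) ; unique = λ f → unique (isLoop f)
      ; disj = λ {f} {f′} → disj (isLoop f) (isLoop f′) ; idle = λ f → idle f (isLoop f) }

-- Loops go to distinct loops, of which the target has enough, and boundary edges to those of the
-- same number with nothing in between. An empty piece has neither a vertex nor a boundary edge.
leaf-⊑ : ∀ {H G w} {P : Piece H w} {Q : Piece G w} {x y} → x ≤ y → LeafPiece P x → LeafPiece Q y → P ⊑ Q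
leaf-⊑ le (empty none) _ = LeafImmersion.empty-⊑ none
leaf-⊑ (s≤s le) (single v Pv only-v loop loop-v loop-inj idx) (single u Qu only-u loop′ loop-u loop-inj′ _) =
  LeafImmersion.single-⊑ le v Pv only-v (λ e p q → proj₁ (idx e p q))
    (λ {e} {e′} {p} {q} {p′} {q′} r → trans (sym (proj₂ (idx e p q))) (trans (cong loop r) (proj₂ (idx e′ p′ q′))))
    u Qu only-u loop′ loop-u loop-inj′

strong-immersion : ∀ {H G w} {P : Piece H w} {Q : Piece G w} → (∀ v → set P v ≡ true) → P ⊑ Q → StrongImmersion H G
strong-immersion {H} {G} {P = P} {Q} all m = record
  { φ        = λ v → M.φ v (all v)
  ; φ-inj    = M.φ-inj _ _
  ; path     = M.mid
  ; isPath   = λ f → subst (λ es → Walk G _ es (M.φ _ (all (head H f)))) (++-identityʳ (M.mid f)) (M.walk (vtx {f = f} (all _)) (vtx (all _))) , M.unique f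
  ; disjoint = λ f f′ ne e p q → ne (M.disj p q)
  ; noInner  = λ f u p → M.strong (vtx {f = f} (all _)) (vtx (all _)) u (all u)
                 (subst (λ es → M.φ u (all u) ∈ internal G es) (sym (++-identityʳ (M.mid f))) p) }
  where module M = _⊑_ m

-- Linked carvings

infix 4 _≺[_]_
-- Lexicographic, with the largest index first. Level 0 is absent: a rebuilt tree improves at a
-- level above the width of the cut, hence at a positive one.
_≺[_]_ : (ℕ → ℕ) → ℕ → (ℕ → ℕ) → Set
f ≺[ zero ] g  = ⊥
f ≺[ suc k ] g = f (suc k) < g (suc k) ⊎ (f (suc k) ≡ g (suc k) × f ≺[ k ] g)

module _ {A : Set} (μ : A → ℕ → ℕ) where

  ≺-acc : ∀ k x → Acc (λ y x → μ y ≺[ k ] μ x) x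
  ≺-acc zero x = acc λ ()
  ≺-acc (suc k) x = go (<-wellFounded (μ x (suc k))) refl (≺-acc k x)
    where
    go  : ∀ {N x} → Acc _<_ N → μ x (suc k) ≡ N → Acc (λ y x → μ y ≺[ k ] μ x) x → Acc (λ y x → μ y ≺[ suc k ] μ x) x
    go′ : ∀ {N x y} → Acc _<_ N → μ x (suc k) ≡ N → Acc (λ y x → μ y ≺[ k ] μ x) x → μ y ≺[ suc k ] μ x → Acc (λ y x → μ y ≺[ suc k ] μ x) y
    go a e b = acc λ lt → go′ a e b lt
    go′ (acc h) refl b (inj₁ lt) = go (h lt) refl (≺-acc k _)
    go′ (acc h) refl (acc h′) (inj₂ (eq , lt)) = go (acc h) eq (h′ lt)

≺-suc : ∀ k {f g} → f (suc k) ≤ g (suc k) → f ≺[ k ] g → f ≺[ suc k ] g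
≺-suc k le lt with m≤n⇒m<n∨m≡n le
... | inj₁ lt′ = inj₁ lt′
... | inj₂ eq  = inj₂ (eq , lt)

argmin : ∀ {n} {P : VSet n → Set} (f : VSet n → ℕ) → (∀ S → Dec (P S)) → (∀ {S S′} → S ≗ S′ → P S → P S′) → (∀ {S S′} → S ≗ S′ → f S ≡ f S′) →
         ∃[ S ] P S → ∃[ S ] (P S × (∀ S′ → P S′ → f S ≤ f S′))
argmin {P = P} f P? P-resp f-resp (S , p) = go S p (<-wellFounded (f S))
  where
  go : ∀ S → P S → Acc _<_ (f S) → ∃[ S ] (P S × (∀ S′ → P S′ → f S ≤ f S′))
  go S p (acc h) with anySet? {P = λ S′ → P S′ × f S′ < f S} (λ S′ → P? S′ ×-dec (f S′ <? f S))
                        (λ { eq (q , lt) → P-resp eq q , subst (_< f S) (f-resp eq) lt })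
  ... | yes (S′ , q , lt) = go S′ q (h lt)
  ... | no ¬q = S , p , λ S′ q → ≮⇒≥ λ lt → ¬q (S′ , q , lt)

-- Rooted at an edge, a carving becomes such a tree. Empty leaves stand for carving leaves without a
-- vertex and for what restriction removes.
data CarvTree (n : ℕ) : Set where
  leaf : Maybe (Fin n) → CarvTree n
  node : CarvTree n → CarvTree n → CarvTree n

module _ {n : ℕ} where

  setOf : CarvTree n → VSet n
  setOf (leaf nothing)  = λ _ → false
  setOf (leaf (just v)) = ⁅ v ⁆
  setOf (node l r)      = setOf l ∪ setOf r

  Apart : VSet n → VSet n → Set
  Apart A B = ∀ v → A v ≡ true → B v ≡ false

  Disjoint : CarvTree n → Set
  Disjoint (leaf _)   = ⊤
  Disjoint (node l r) = Apart (setOf l) (setOf r) × Disjoint l × Disjoint r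

  All : (VSet n → Set) → CarvTree n → Set
  All P (leaf x)   = P (setOf (leaf x))
  All P (node l r) = P (setOf (node l r)) × All P l × All P r

  All-root : ∀ {P} T → All P T → P (setOf T)
  All-root (leaf _) p         = p
  All-root (node _ _) (p , _) = p

  data Child (c d : CarvTree n) : CarvTree n → Set where
    left  : Child c d (node c d)
    right : Child c d (node d c)

  infixr 5 _◂_
  data Path : CarvTree n → CarvTree n → Set where
    stop  : ∀ {X} → Path X X
    _◂_ : ∀ {c d X Y} → Child c d X → Path c Y → Path X Y

  snoc : ∀ {X c d t} → Path X t → Child c d t → Path X c
  snoc stop ch       = ch ◂ stop
  snoc (ch′ ◂ π) ch = ch′ ◂ snoc π ch

  child-set : ∀ {c d t} → Child c d t → setOf t ≗ setOf c ∪ setOf d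
  child-set left v          = refl
  child-set {c} {d} right v = 𝔹.∨-comm (setOf d v) (setOf c v)

  child-⊆ : ∀ {c d t} → Child c d t → setOf c ⊆ setOf t
  child-⊆ ch v p = trans (child-set ch v) (∨-introˡ _ p)

  sibling-⊆ : ∀ {c d t} → Child c d t → setOf d ⊆ setOf t
  sibling-⊆ ch v p = trans (child-set ch v) (∨-introʳ _ p)

  apart-sym : ∀ {A B} → Apart A B → Apart B A
  apart-sym h v p = ¬true λ q → clash p (h v q)

  child-disjoint : ∀ {c d t} → Child c d t → Disjoint t → Apart (setOf c) (setOf d) × Disjoint c × Disjoint d
  child-disjoint left x            = x
  child-disjoint right (a , d , e) = apart-sym a , e , d

  All-child : ∀ {P c d t} → Child c d t → All P t → P (setOf t) × All P c × All P d
  All-child left x            = x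
  All-child right (p , q , s) = p , s , q

  All-path : ∀ {P} S → (∀ {W} → Path S W → P (setOf W)) → All P S
  All-path (leaf x)   h = h stop
  All-path (node l r) h = h stop , All-path l (h ∘ (left ◂_)) , All-path r (h ∘ (right ◂_))

  All-below : ∀ {P S W} → All P S → Path S W → All P W
  All-below p stop       = p
  All-below p (ch ◂ π) = All-below (proj₁ (proj₂ (All-child ch p))) π

  All-at : ∀ {P S W} → All P S → Path S W → P (setOf W)
  All-at {W = W} p π = All-root W (All-below p π)

  path-⊆ : ∀ {S W} → Path S W → setOf W ⊆ setOf S
  path-⊆ stop v p       = p
  path-⊆ (ch ◂ π) v p = child-⊆ ch v (path-⊆ π v p)

  disjoint-at : ∀ {S W} → Disjoint S → Path S W → Disjoint W
  disjoint-at d stop       = d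
  disjoint-at d (ch ◂ π) = disjoint-at (proj₁ (proj₂ (child-disjoint ch d))) π

  replace : ∀ {T X} → Path T X → CarvTree n → CarvTree n
  replace stop X′               = X′
  replace (_◂_ {d = d} _ π) X′ = node (replace π X′) d

  replace-set : ∀ {T X} (π : Path T X) X′ → setOf X′ ≗ setOf X → setOf (replace π X′) ≗ setOf T
  replace-set stop X′ eq v                = eq v
  replace-set (_◂_ {d = d} ch π) X′ eq v = trans (cong (_∨ setOf d v) (replace-set π X′ eq v)) (sym (child-set ch v))

  replace-disjoint : ∀ {T X} (π : Path T X) X′ → setOf X′ ≗ setOf X → Disjoint T → Disjoint X′ → Disjoint (replace π X′)
  replace-disjoint stop X′ eq d d′ = d′
  replace-disjoint (ch ◂ π) X′ eq dT d′ with child-disjoint ch dT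
  ... | a , d , e = (λ v p → a v (trans (sym (replace-set π X′ eq v)) p)) , replace-disjoint π X′ eq d d′ , e

  restrict : CarvTree n → VSet n → CarvTree n
  restrict (leaf nothing) S = leaf nothing
  restrict (leaf (just v)) S with S v
  ... | true  = leaf (just v)
  ... | false = leaf nothing
  restrict (node l r) S = node (restrict l S) (restrict r S)

  restrict-set : ∀ T S → setOf (restrict T S) ≗ setOf T ∩ S
  restrict-set (leaf nothing) S u = refl
  restrict-set (leaf (just v)) S u with S v in eq
  restrict-set (leaf (just v)) S u | true with u Fin.≟ v
  ... | yes refl = sym eq
  ... | no _ = refl
  restrict-set (leaf (just v)) S u | false with u Fin.≟ v
  ... | yes refl = sym eq
  ... | no _ = refl
  restrict-set (node l r) S u = trans (cong₂ _∨_ (restrict-set l S u) (restrict-set r S u)) (sym (𝔹.∧-distribʳ-∨ (S u) (setOf l u) (setOf r u)))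

  restrict-disjoint : ∀ T S → Disjoint T → Disjoint (restrict T S)
  restrict-disjoint (leaf nothing) S d = tt
  restrict-disjoint (leaf (just v)) S d with S v
  ... | true  = tt
  ... | false = tt
  restrict-disjoint (node l r) S (a , d , e) =
    (λ v p → trans (restrict-set r S v) (cong (_∧ S v) (a v (proj₁ (∧-true (trans (sym (restrict-set l S v)) p)))))) ,
    restrict-disjoint l S d , restrict-disjoint r S e

  restrict-child : ∀ {c d t} S → Child c d t → Child (restrict c S) (restrict d S) (restrict t S)
  restrict-child S left  = left
  restrict-child S right = right

  ∁ : VSet n → VSet n
  ∁ S v = not (S v)

  -- The path from X to Y with its side trees restricted to the complement of Z, and in place of Y the tree B, which will be the
  -- restriction of X to Z.
  cutout : ∀ {X Y} → Path X Y → VSet n → CarvTree n → CarvTree n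
  cutout stop Z B                = B
  cutout (_◂_ {d = d} _ π) Z B = node (cutout π Z B) (restrict d (∁ Z))

  cutout-set : ∀ {X Y} (π : Path X Y) Z B → setOf Y ⊆ Z → setOf B ≗ Z → setOf (cutout π Z B) ≗ setOf X ∪ Z
  cutout-set {Y = Y} stop Z B Y⊆ eq v = trans (eq v) (absorb (setOf Y v) (Z v) (Y⊆ v))
    where
    absorb : ∀ a b → (a ≡ true → b ≡ true) → b ≡ a ∨ b
    absorb true b h  = h refl
    absorb false b h = refl
  cutout-set (_◂_ {c} {d} ch π) Z B Y⊆ eq v = trans (cong₂ _∨_ (cutout-set π Z B Y⊆ eq v) (restrict-set d (∁ Z) v))
    (trans (merge (setOf c v) (setOf d v) (Z v)) (cong (_∨ Z v) (sym (child-set ch v))))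
    where
    merge : ∀ a b c → (a ∨ c) ∨ (b ∧ not c) ≡ (a ∨ b) ∨ c
    merge = toWitness {a? = ∀𝔹? λ a → ∀𝔹? λ b → ∀𝔹? λ c → _ 𝔹.≟ _} tt

  cutout-disjoint : ∀ {X Y} (π : Path X Y) Z B → setOf Y ⊆ Z → setOf B ≗ Z → Disjoint X → Disjoint B → Disjoint (cutout π Z B)
  cutout-disjoint stop Z B Y⊆ eq d e = e
  cutout-disjoint (_◂_ {c} {d} ch π) Z B Y⊆ eq dX e with child-disjoint ch dX
  ... | a , d₁ , d₂ =
    (λ v p → trans (restrict-set d (∁ Z) v) (sep (setOf c v) (setOf d v) (Z v) (a v) (trans (sym (cutout-set π Z B Y⊆ eq v)) p))) ,
    cutout-disjoint π Z B Y⊆ eq d₁ e , restrict-disjoint d (∁ Z) d₂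
    where
    sep : ∀ x y z → (x ≡ true → y ≡ false) → x ∨ z ≡ true → y ∧ not z ≡ false
    sep x y true h p = 𝔹.∧-zeroʳ y
    sep true y false h p rewrite h refl = refl
    sep false y false h ()

  meets? : ∀ (A B : VSet n) → Dec (∃[ v ] (A v ≡ true × B v ≡ true))
  meets? A B = Finₚ.any? λ v → (A v 𝔹.≟ true) ×-dec (B v 𝔹.≟ true)

  Crosses : VSet n → VSet n → Set
  Crosses W Z = (∃[ v ] (W v ≡ true × Z v ≡ true)) × (∃[ v ] (W v ≡ true × Z v ≡ false))

  crosses? : ∀ W Z → Dec (Crosses W Z)
  crosses? W Z = meets? W Z ×-dec Finₚ.any? λ v → (W v 𝔹.≟ true) ×-dec (Z v 𝔹.≟ false)

  -- The tie-breaker among cuts of least width, applied to the trees off a path: it makes the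
  -- uncrossing inequalities strict.
  crossings : CarvTree n → VSet n → ℕ
  crossings (leaf x) Z   = ⟦ does (crosses? (setOf (leaf x)) Z) ⟧
  crossings (node l r) Z = ⟦ does (crosses? (setOf (node l r)) Z) ⟧ + (crossings l Z + crossings r Z)

  does-mono : ∀ {P Q : Set} (p? : Dec P) (q? : Dec Q) → (P → Q) → ⟦ does p? ⟧ ≤ ⟦ does q? ⟧
  does-mono (no _) q? h = z≤n
  does-mono (yes p) (yes q) h = s≤s z≤n
  does-mono (yes p) (no ¬q) h = ⊥-elim (¬q (h p))

  does-yes : ∀ {P : Set} (p? : Dec P) → P → ⟦ does p? ⟧ ≡ 1
  does-yes (yes _) p = refl
  does-yes (no ¬p) p = ⊥-elim (¬p p)

  does-no : ∀ {P : Set} (p? : Dec P) → ¬ P → ⟦ does p? ⟧ ≡ 0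
  does-no (yes p) ¬p = ⊥-elim (¬p p)
  does-no (no _) ¬p = refl

  AgreeOn : VSet n → VSet n → VSet n → Set
  AgreeOn W Z Z′ = ∀ v → W v ≡ true → Z v ≡ Z′ v

  crosses-agree : ∀ {W Z Z′} → AgreeOn W Z Z′ → Crosses W Z → Crosses W Z′
  crosses-agree h ((v , p , q) , (u , p′ , q′)) = (v , p , trans (sym (h v p)) q) , (u , p′ , trans (sym (h u p′)) q′)

  crossings-agree : ∀ S {Z Z′} → AgreeOn (setOf S) Z Z′ → crossings S Z ≤ crossings S Z′
  crossings-agree (leaf x) h = does-mono (crosses? _ _) (crosses? _ _) (crosses-agree h)
  crossings-agree (node l r) h = +-mono-≤ (does-mono (crosses? _ _) (crosses? _ _) (crosses-agree h))
    (+-mono-≤ (crossings-agree l λ v p → h v (∨-introˡ _ p)) (crossings-agree r λ v p → h v (∨-introʳ _ p)))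

  crossings-const : ∀ S {Z} b → (∀ v → setOf S v ≡ true → Z v ≡ b) → crossings S Z ≡ 0
  crossings-const S {Z} b h = go S h
    where
    no-cross : ∀ {W} → (∀ v → W v ≡ true → Z v ≡ b) → ¬ Crosses W Z
    no-cross h ((v , p , q) , (u , p′ , q′)) with trans (sym q) (trans (h v p) (trans (sym (h u p′)) q′))
    ... | ()
    go : ∀ S → (∀ v → setOf S v ≡ true → Z v ≡ b) → crossings S Z ≡ 0
    go (leaf x) h = does-no (crosses? _ _) (no-cross h)
    go (node l r) h = cong₂ _+_ (does-no (crosses? _ _) (no-cross h)) (cong₂ _+_ (go l λ v p → h v (∨-introˡ _ p)) (go r λ v p → h v (∨-introʳ _ p)))

  root≤crossings : ∀ S Z → ⟦ does (crosses? (setOf S) Z) ⟧ ≤ crossings S Z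
  root≤crossings (leaf x) Z = ≤-refl
  root≤crossings (node l r) Z = m≤m+n _ _

  crosses-⊆ : ∀ {A B Z} → A ⊆ B → Crosses A Z → Crosses B Z
  crosses-⊆ h ((v , p , q) , (u , p′ , q′)) = (v , h v p , q) , (u , h u p′ , q′)

  -- Both `W ∪ Z` and `Z` without `W` are of this form, two of the sets that uncrossing `Z` with `W`
  -- produces.
  record Flattens (W Z Z′ : VSet n) : Set where
    field
      b     : Bool
      const : ∀ v → W v ≡ true → Z′ v ≡ b
      agree : ∀ v → W v ≡ false → Z v ≡ Z′ v

  crossings-apart : ∀ S {W Z Z′} → Flattens W Z Z′ → Apart W (setOf S) → crossings S Z′ ≤ crossings S Z
  crossings-apart S f ap = crossings-agree S λ v p → sym (Flattens.agree f v (apart-sym ap v p))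

  child-crossings : ∀ {c d t} Z → Child c d t → crossings t Z ≡ ⟦ does (crosses? (setOf t) Z) ⟧ + (crossings c Z + crossings d Z)
  child-crossings Z left          = refl
  child-crossings {c} {d} Z right = cong (⟦ does (crosses? (setOf (node d c)) Z) ⟧ +_) (+-comm (crossings d Z) (crossings c Z))

  -- Inside `W` all crossings disappear, ancestors of `W` already cross `Z`, and sets disjoint from
  -- `W` see no change.
  crossings-flatten : ∀ {S W Z Z′} → Disjoint S → Path S W → Crosses (setOf W) Z → Flattens (setOf W) Z Z′ → crossings S Z′ < crossings S Z
  crossings-flatten {S} {W} {Z} d stop c f rewrite crossings-const S _ (Flattens.const f) =
    ≤-trans (≤-reflexive (sym (does-yes (crosses? (setOf S) Z) c))) (root≤crossings S Z)
  crossings-flatten {S} {W} {Z} {Z′} dS (_◂_ {d = s} ch π) c f rewrite child-crossings Z ch | child-crossings Z′ ch with child-disjoint ch dS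
  ... | a , d , e = +-mono-≤-< (does-mono (crosses? _ _) (crosses? _ _) (λ _ → crosses-⊆ (path-⊆ (ch ◂ π)) c))
    (+-mono-<-≤ (crossings-flatten d π c f) (crossings-apart s f λ v p → a v (path-⊆ π v p)))

  data Off : ∀ {X Y} → Path X Y → CarvTree n → Set where
    here  : ∀ {c d X Y W} {ch : Child c d X} {π : Path c Y} → Path d W → Off (ch ◂ π) W
    there : ∀ {c d X Y W} {ch : Child c d X} {π : Path c Y} → Off π W → Off (ch ◂ π) W

  off-⊆ : ∀ {X Y W} {π : Path X Y} → Off π W → setOf W ⊆ setOf X
  off-⊆ {π = ch ◂ _} (here ρ) v p  = sibling-⊆ ch v (path-⊆ ρ v p)
  off-⊆ {π = ch ◂ _} (there o) v p = child-⊆ ch v (off-⊆ o v p)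

  off-apart : ∀ {X Y W} {π : Path X Y} → Disjoint X → Off π W → Apart (setOf W) (setOf Y)
  off-apart {π = ch ◂ π} dX (here ρ) v p = ¬true λ q → clash (path-⊆ ρ v p) (proj₁ (child-disjoint ch dX) v (path-⊆ π v q))
  off-apart {π = ch ◂ π} dX (there o)    = off-apart (proj₁ (proj₂ (child-disjoint ch dX))) o

  offCrossings : ∀ {X Y} → Path X Y → VSet n → ℕ
  offCrossings stop Z                = 0
  offCrossings (_◂_ {d = d} _ π) Z = crossings d Z + offCrossings π Z

  offCrossings-agree : ∀ {X Y} (π : Path X Y) {Z Z′} → AgreeOn (setOf X) Z Z′ → offCrossings π Z ≤ offCrossings π Z′
  offCrossings-agree stop h = z≤n
  offCrossings-agree (_◂_ {d = d} ch π) h =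
    +-mono-≤ (crossings-agree d λ v p → h v (sibling-⊆ ch v p)) (offCrossings-agree π λ v p → h v (child-⊆ ch v p))

  offCrossings-flatten : ∀ {X Y W Z Z′} {π : Path X Y} → Disjoint X → Off π W → Crosses (setOf W) Z → Flattens (setOf W) Z Z′ →
                         offCrossings π Z′ < offCrossings π Z
  offCrossings-flatten {π = _◂_ {d = s} ch π} dX o c f with child-disjoint ch dX | o
  ... | a , d , e | here ρ  = +-mono-<-≤ (crossings-flatten e ρ c f)
    (offCrossings-agree π λ v p → sym (Flattens.agree f v (¬true λ q → clash (path-⊆ ρ v q) (a v p))))
  ... | a , d , e | there o = +-mono-≤-< (crossings-apart s f λ v p → a v (off-⊆ o v p)) (offCrossings-flatten d o c f)

  AllPath : (VSet n → Set) → (VSet n → Set) → ∀ {X Y} → Path X Y → Set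
  AllPath P Q stop                        = ⊤
  AllPath P Q {X} (_◂_ {d = d} ch π) = P (setOf X) × AllPath P Q π × All Q d

  All-map : ∀ {P Q : VSet n → Set} → (∀ {W} → P W → Q W) → ∀ S → All P S → All Q S
  All-map f (leaf x) p              = f p
  All-map f (node l r) (p , q , q′) = f p , All-map f l q , All-map f r q′

  AllPath-map : ∀ {P Q P′ Q′ : VSet n → Set} → (∀ {W} → P W → P′ W) → (∀ {W} → Q W → Q′ W) → ∀ {X Y} (π : Path X Y) → AllPath P Q π → AllPath P′ Q′ π
  AllPath-map f g stop _                               = tt
  AllPath-map f g (_◂_ {d = d} ch π) (p , q , s) = f p , AllPath-map f g π q , All-map g d s

  ChainAll : (VSet n → Set) → ∀ {X Y} → Path X Y → Set
  ChainAll P {X} stop       = P (setOf X)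
  ChainAll P {X} (ch ◂ π) = P (setOf X) × ChainAll P π

  allPath : ∀ {P Q : VSet n → Set} {X Y} (π : Path X Y) → ChainAll P π → (∀ {W} → Off π W → Q (setOf W)) → AllPath P Q π
  allPath stop c h                         = tt
  allPath (_◂_ {d = d} ch π) (p , c) h = p , allPath π c (h ∘ there) , All-path d (h ∘ here)

  chainAll : ∀ {P : VSet n → Set} {X Y} (π : Path X Y) → (∀ W → setOf Y ⊆ W → W ⊆ setOf X → P W) → ChainAll P π
  chainAll {X = X} stop h       = h (setOf X) (λ _ p → p) (λ _ p → p)
  chainAll {X = X} (ch ◂ π) h = h (setOf X) (path-⊆ (ch ◂ π)) (λ _ p → p) , chainAll π λ W p q → h W p λ v x → child-⊆ ch v (q v x)

  ChainAll-map : ∀ {P Q : VSet n → Set} → (∀ {W} → P W → Q W) → ∀ {X Y} (π : Path X Y) → ChainAll P π → ChainAll Q π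
  ChainAll-map f stop p             = f p
  ChainAll-map f (ch ◂ π) (p , c) = f p , ChainAll-map f π c

  ChainAll-zip : ∀ {P Q : VSet n → Set} {X Y} (π : Path X Y) → ChainAll P π → ChainAll Q π → ChainAll (λ W → P W × Q W) π
  ChainAll-zip stop p q                   = p , q
  ChainAll-zip (ch ◂ π) (p , c) (q , e) = (p , q) , ChainAll-zip π c e

  ChainAll-top : ∀ {P : VSet n → Set} {X Y} (π : Path X Y) → ChainAll P π → P (setOf X)
  ChainAll-top stop p             = p
  ChainAll-top (ch ◂ π) (p , _) = p

  ChainAll-snoc : ∀ {P : VSet n → Set} {X c d t} (π : Path X t) (ch : Child c d t) → ChainAll P π → P (setOf c) → ChainAll P (snoc π ch)
  ChainAll-snoc stop ch p q              = p , q
  ChainAll-snoc (ch′ ◂ π) ch (p , c) q = p , ChainAll-snoc π ch c q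

  All-chain : ∀ {P : VSet n → Set} {X Y} (π : Path X Y) → All P X → ChainAll P π
  All-chain {X = X} stop p = All-root X p
  All-chain (ch ◂ π) p with All-child ch p
  ... | q , a , _ = q , All-chain π a

  All-off : ∀ {P : VSet n → Set} {X Y W} {π : Path X Y} → All P X → Off π W → P (setOf W)
  All-off {π = ch ◂ _} p (here ρ)  = All-at (proj₂ (proj₂ (All-child ch p))) ρ
  All-off {π = ch ◂ _} p (there o) = All-off (proj₁ (proj₂ (All-child ch p))) o

  module _ {P : VSet n → Set} (resp : ∀ {S S′} → S ≗ S′ → P S → P S′) where

    replace-all : ∀ {T X} (ρ : Path T X) X′ → setOf X′ ≗ setOf X → All P T → All P X′ → All P (replace ρ X′)
    replace-all stop X′ eq a b = b
    replace-all (ch ◂ ρ) X′ eq a b with All-child ch a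
    ... | p , q , s = resp (λ v → sym (replace-set (ch ◂ ρ) X′ eq v)) p , replace-all ρ X′ eq q b , s

    restrict-all : ∀ T S → All (λ W → P (W ∩ S)) T → All P (restrict T S)
    restrict-all (leaf nothing) S p = p
    restrict-all (leaf (just v)) S p with S v | restrict-set (leaf (just v)) S
    ... | true  | e = resp (λ u → sym (e u)) p
    ... | false | e = resp (λ u → sym (e u)) p
    restrict-all (node l r) S (p , q , q′) = resp (λ v → sym (restrict-set (node l r) S v)) p , restrict-all l S q , restrict-all r S q′

    cutout-all : ∀ {X Y} (π : Path X Y) Z B → setOf Y ⊆ Z → setOf B ≗ Z → AllPath (λ W → P (W ∪ Z)) (λ W → P (W ∩ ∁ Z)) π → All P B → All P (cutout π Z B)
    cutout-all stop Z B Y⊆ eq _ b = b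
    cutout-all (_◂_ {d = d} ch π) Z B Y⊆ eq (p , q , s) b =
      resp (λ v → sym (cutout-set (ch ◂ π) Z B Y⊆ eq v)) p , cutout-all π Z B Y⊆ eq q b , restrict-all d (∁ Z) s

-- The cost of a tree and its change edge by edge

big : ℕ → ℕ → Bool
big n p = does (n ≤? p)

-- Summed over a tree this counts the edges of width at least n and the parent-child pairs of such edges; b is the flag of the parent.
headCost : ℕ → Bool → ℕ → ℕ
headCost n b p = ⟦ big n p ⟧ + ⟦ big n p ∧ b ⟧

big-yes : ∀ {n p} → n ≤ p → big n p ≡ true
big-yes {n} {p} le = dec-true (n ≤? p) le

big-no : ∀ {n p} → p < n → big n p ≡ false
big-no {n} {p} lt = dec-false (n ≤? p) (<⇒≱ lt)

big-mono : ∀ n {p q} → p ≤ q → ⟦ big n p ⟧ ≤ ⟦ big n q ⟧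
big-mono n {p} {q} le = does′ (n ≤? p) (n ≤? q)
  where
  does′ : (d : Dec (n ≤ p)) (e : Dec (n ≤ q)) → ⟦ does d ⟧ ≤ ⟦ does e ⟧
  does′ (no _)  e       = z≤n
  does′ (yes _) (yes _) = s≤s z≤n
  does′ (yes a) (no ¬b) = ⊥-elim (¬b (≤-trans a le))

⟦∧⟧-mono : ∀ {a b c d} → ⟦ a ⟧ ≤ ⟦ c ⟧ → ⟦ b ⟧ ≤ ⟦ d ⟧ → ⟦ a ∧ b ⟧ ≤ ⟦ c ∧ d ⟧
⟦∧⟧-mono {false} h k = z≤n
⟦∧⟧-mono {true} {b} {true} h k = k
⟦∧⟧-mono {true} {b} {false} () k

headCost-mono : ∀ n {b b′ p p′} → ⟦ b ⟧ ≤ ⟦ b′ ⟧ → p ≤ p′ → headCost n b p ≤ headCost n b′ p′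
headCost-mono n h le = +-mono-≤ (big-mono n le) (⟦∧⟧-mono (big-mono n le) h)

-- The argument runs from large widths down: at each level either the two copies together cost less
-- than the original, which decides the comparison, or they cost no more and `A` is known for the
-- next level.
data Drop (x y z : ℕ) (A : Set) : Set where
  less : x + y < z → Drop x y z A
  even : x + y ≤ z → A → Drop x y z A

-- The widths a and c of the two copies of a tree edge of width p, in a tree rebuilt along a cut of width m.
record Copies (m p a c : ℕ) : Set where
  constructor copies
  field
    a≤p  : a ≤ p
    c≤p  : c ≤ p
    type : a ≤ m ⊎ c ≤ m ⊎ (a < p × c < p)

-- An edge wider than `n` survives in only one copy, the other having width at most `m`. At level
-- `K` this is vacuous, as no edge is wider than `K`.
Intact : ℕ → ℕ → ℕ → ℕ → ℕ → Set
Intact n m p a c = n < p → a ≤ m ⊎ c ≤ m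

module _ {m n p a c : ℕ} (m≤n : m ≤ n) (C : Copies m p a c) where
  open Copies C

  one-big : a ≤ m ⊎ c ≤ m → ⟦ big (suc n) a ⟧ + ⟦ big (suc n) c ⟧ ≤ ⟦ big (suc n) p ⟧
  one-big (inj₁ le) rewrite big-no {suc n} {a} (s≤s (≤-trans le m≤n)) = big-mono (suc n) c≤p
  one-big (inj₂ le) rewrite big-no {suc n} {c} (s≤s (≤-trans le m≤n)) = ≤-trans (≤-reflexive (+-identityʳ _)) (big-mono (suc n) a≤p)

  head-intact : ∀ {b₁ b₂ b} → ⟦ b₁ ⟧ + ⟦ b₂ ⟧ ≤ ⟦ b ⟧ → a ≤ m ⊎ c ≤ m →
                headCost (suc n) b₁ a + headCost (suc n) b₂ c ≤ headCost (suc n) b p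
  head-intact {b₁} {b₂} h (inj₁ le) rewrite big-no {suc n} {a} (s≤s (≤-trans le m≤n)) =
    headCost-mono (suc n) (≤-trans (m≤n+m _ ⟦ b₁ ⟧) h) c≤p
  head-intact {b₁} {b₂} h (inj₂ le) rewrite big-no {suc n} {c} (s≤s (≤-trans le m≤n)) =
    ≤-trans (≤-reflexive (+-identityʳ _)) (headCost-mono (suc n) (≤-trans (m≤m+n _ ⟦ b₂ ⟧) h) a≤p)

  -- An edge of width exactly `suc n` both of whose copies are narrower vanishes from this level, so
  -- the cost drops. Otherwise intactness extends from widths above `suc n` to widths above `n`. The
  -- hypothesis on the flags says that at most one copy of the parent is wide, and only if the
  -- parent is.
  head-step : ∀ {b₁ b₂ b} → ⟦ b₁ ⟧ + ⟦ b₂ ⟧ ≤ ⟦ b ⟧ → Intact (suc n) m p a c →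
    Drop (headCost (suc n) b₁ a) (headCost (suc n) b₂ c) (headCost (suc n) b p) (Intact n m p a c)
  flags : Intact (suc n) m p a c → ⟦ big (suc n) a ⟧ + ⟦ big (suc n) c ⟧ ≤ ⟦ big (suc n) p ⟧
  flags g with type
  ... | inj₁ le = one-big (inj₁ le)
  ... | inj₂ (inj₁ le) = one-big (inj₂ le)
  ... | inj₂ (inj₂ (a<p , c<p)) with suc n <? p
  ...   | yes lt = one-big (g lt)
  ...   | no ¬lt rewrite big-no {suc n} {a} (≤-trans a<p (≮⇒≥ ¬lt)) | big-no {suc n} {c} (≤-trans c<p (≮⇒≥ ¬lt)) = z≤n
  head-step {b = b} h g with type
  ... | inj₁ le = even (head-intact h (inj₁ le)) (λ _ → inj₁ le)
  ... | inj₂ (inj₁ le) = even (head-intact h (inj₂ le)) (λ _ → inj₂ le)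
  ... | inj₂ (inj₂ (a<p , c<p)) with <-cmp (suc n) p
  ...   | tri< lt _ _ = even (head-intact h (g lt)) (λ _ → g lt)
  ...   | tri≈ _ refl _ rewrite big-no a<p | big-no c<p | big-yes (≤-refl {suc n}) = less (s≤s z≤n)
  ...   | tri> _ _ lt rewrite big-no (≤-trans a<p (<⇒≤ lt)) | big-no (≤-trans c<p (<⇒≤ lt)) = even z≤n (λ lt′ → ⊥-elim (<⇒≱ lt lt′))

infixr 5 _⊞_
_⊞_ : ∀ {x x′ y y′ z z′} {A B : Set} → Drop x y z A → Drop x′ y′ z′ B → Drop (x + x′) (y + y′) (z + z′) (A × B)
_⊞_ {x} {x′} {y} {y′} {z} {z′} = go
  where
  eq : (x + x′) + (y + y′) ≡ (x + y) + (x′ + y′)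
  eq = solve 4 (λ x x′ y y′ → (x :+ x′) :+ (y :+ y′) := (x :+ y) :+ (x′ :+ y′)) refl x x′ y y′
    where open +-*-Solver
  le : ∀ {u v} → u ≡ v → v ≤ z + z′ → u ≤ z + z′
  le refl h = h
  go : ∀ {A B : Set} → Drop x y z A → Drop x′ y′ z′ B → Drop (x + x′) (y + y′) (z + z′) (A × B)
  go (less lt)  (less lt′)  = less (le (cong suc eq) (+-mono-<-≤ lt (<⇒≤ lt′)))
  go (less lt)  (even h _)  = less (le (cong suc eq) (+-mono-<-≤ lt h))
  go (even h _) (less lt)   = less (le (cong suc eq) (+-mono-≤-< h lt))
  go (even h a) (even h′ b) = even (le eq (+-mono-≤ h h′)) (a , b)

drop-map : ∀ {x y z} {A B : Set} → (A → B) → Drop x y z A → Drop x y z B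
drop-map f (less lt)  = less lt
drop-map f (even h a) = even h (f a)

drop-< : ∀ {x y z} → Drop x y z ⊥ → x + y < z
drop-< (less lt) = lt

module Improve {n : ℕ} (width : VSet n → ℕ) (width-cong : ∀ {S S′} → S ≗ S′ → width S ≡ width S′)
               (width-sub : ∀ A B → width (A ∩ B) + width (A ∪ B) ≤ width A + width B)
               (width-∁ : ∀ A → width (∁ A) ≡ width A) where

  cost : ℕ → Bool → CarvTree n → ℕ
  costs : ℕ → Bool → ℕ → CarvTree n → CarvTree n → ℕ
  cost k b (leaf x)   = headCost k b (width (setOf (leaf x)))
  cost k b (node l r) = costs k b (width (setOf (node l r))) l r
  costs k b p l r     = headCost k b p + (cost k (big k p) l + cost k (big k p) r)

  child-cost : ∀ k b {c d t} → Child c d t → cost k b t ≡ costs k b (width (setOf t)) c d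
  child-cost k b left              = refl
  child-cost k b {c} {d} {t} right = cong (headCost k b (width (setOf t)) +_) (+-comm (cost k (big k (width (setOf t))) d) _)

  restrict-cost : ∀ k b {c d t} S → Child c d t → cost k b (restrict t S) ≡ costs k b (width (setOf t ∩ S)) (restrict c S) (restrict d S)
  restrict-cost k b {c} {d} {t} S ch = trans (child-cost k b (restrict-child S ch))
    (cong (λ p → costs k b p (restrict c S) (restrict d S)) (width-cong (restrict-set t S)))

  cost-leaf : ∀ k b x S → cost k b (restrict (leaf x) S) ≡ headCost k b (width (setOf (leaf x) ∩ S))
  cost-leaf k b nothing S = refl
  cost-leaf k b (just v) S = trans (is-leaf k b v S) (cong (headCost k b) (width-cong (restrict-set (leaf (just v)) S)))
    where
    is-leaf : ∀ k b v S → cost k b (restrict (leaf (just v)) S) ≡ headCost k b (width (setOf (restrict (leaf (just v)) S)))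
    is-leaf k b v S with S v
    ... | true  = refl
    ... | false = refl

  ∩-⊆ : ∀ {A B : VSet n} → A ⊆ B → A ∩ B ≗ A
  ∩-⊆ {A} {B} h v = go (A v) refl
    where
    go : ∀ a → A v ≡ a → A v ∧ B v ≡ A v
    go true p  rewrite p = h v p
    go false p rewrite p = refl

  cost-agree : ∀ k {b b′} T S → setOf T ⊆ S → ⟦ b ⟧ ≤ ⟦ b′ ⟧ → cost k b (restrict T S) ≤ cost k b′ T
  cost-agree k {b} (leaf x) S h le rewrite cost-leaf k b x S | width-cong (∩-⊆ {setOf (leaf x)} {S} h) = headCost-mono k le ≤-refl
  cost-agree k {b} (node l r) S h le rewrite restrict-cost k b S (left {c = l} {d = r}) | width-cong (∩-⊆ {setOf (node l r)} {S} h) =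
    +-mono-≤ (headCost-mono k le ≤-refl)
      (+-mono-≤ (cost-agree k l S (λ v p → h v (∨-introˡ _ p)) ≤-refl) (cost-agree k r S (λ v p → h v (∨-introʳ _ p)) ≤-refl))

  cost-small : ∀ k b T → width (setOf T) < k → cost k b T ≡ cost k false T
  cost-small k b (leaf x) lt rewrite big-no lt = refl
  cost-small k b (node l r) lt rewrite big-no lt = refl

  pull : ∀ h c x r → h + ((c + x) + r) ≡ (h + (c + r)) + x
  pull = solve 4 (λ h c x r → h :+ ((c :+ x) :+ r) := (h :+ (c :+ r)) :+ x) refl
    where open +-*-Solver

  -- The edges outside the rebuilt subtree keep their sets, and its parent keeps its flag, so they
  -- contribute the same amount `C` to both costs.
  replace-cost : ∀ k b {T X} (π : Path T X) X′ → setOf X′ ≗ setOf X →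
    ∃[ C ] ∃[ b₁ ] (cost k b (replace π X′) ≡ C + cost k b₁ X′ × cost k b T ≡ C + cost k b₁ X)
  replace-cost k b stop X′ eq = 0 , b , refl , refl
  replace-cost k b {T} {X} (_◂_ {d = d} ch π) X′ eq rewrite width-cong (replace-set (ch ◂ π) X′ eq) | child-cost k b ch
    with replace-cost k (big k (width (setOf T))) π X′ eq
  ... | C , b₁ , p , q = h + (C + r) , b₁ , trans (cong (λ x → h + (x + r)) p) (pull h C (cost k b₁ X′) r) ,
                                            trans (cong (λ x → h + (x + r)) q) (pull h C (cost k b₁ X) r)
    where
    h = headCost k b (width (setOf T))
    r = cost k (big k (width (setOf T))) d

  module _ (m : ℕ) (Z : VSet n) where

    OffCopies ChainCopies : VSet n → Set
    OffCopies W   = Copies m (width W) (width (W ∩ Z)) (width (W ∩ ∁ Z))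
    ChainCopies W = Copies m (width W) (width (W ∩ Z)) (width (W ∪ Z))

    OffIntact ChainIntact : ℕ → VSet n → Set
    OffIntact k W   = Intact k m (width W) (width (W ∩ Z)) (width (W ∩ ∁ Z))
    ChainIntact k W = Intact k m (width W) (width (W ∩ Z)) (width (W ∪ Z))

    chainCost : ℕ → Bool → ∀ {X Y} → Path X Y → ℕ
    chainCost k b stop                     = 0
    chainCost k b {X} (_◂_ {d = d} ch π) =
      headCost k b (width (setOf X ∪ Z)) + (chainCost k (big k (width (setOf X ∪ Z))) π + cost k (big k (width (setOf X ∪ Z))) (restrict d (∁ Z)))

    off-step : ∀ {k} → m ≤ k → ∀ S {b₁ b₂ b} → ⟦ b₁ ⟧ + ⟦ b₂ ⟧ ≤ ⟦ b ⟧ → All OffCopies S → All (OffIntact (suc k)) S →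
      Drop (cost (suc k) b₁ (restrict S Z)) (cost (suc k) b₂ (restrict S (∁ Z))) (cost (suc k) b S) (All (OffIntact k) S)
    off-step {k} m≤k (leaf x) {b₁} {b₂} {b} h c g rewrite cost-leaf (suc k) b₁ x Z | cost-leaf (suc k) b₂ x (∁ Z) =
      head-step m≤k c {b₁} {b₂} {b} h g
    off-step {k} m≤k (node l r) {b₁} {b₂} {b} h (c , cl , cr) (g , gl , gr)
      rewrite restrict-cost (suc k) b₁ Z (left {c = l} {d = r}) | restrict-cost (suc k) b₂ (∁ Z) (left {c = l} {d = r}) =
      head-step m≤k c {b₁} {b₂} {b} h g ⊞ off-step m≤k l (flags m≤k c g) cl gl ⊞ off-step m≤k r (flags m≤k c g) cr gr

    chain-step : ∀ {k} → m ≤ k → ∀ {X Y} (π : Path X Y) → setOf Y ⊆ Z → ∀ {b₁ b₂ b} → ⟦ b₁ ⟧ + ⟦ b₂ ⟧ ≤ ⟦ b ⟧ →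
      AllPath ChainCopies OffCopies π → AllPath (ChainIntact (suc k)) (OffIntact (suc k)) π →
      Drop (cost (suc k) b₁ (restrict X Z)) (chainCost (suc k) b₂ π) (cost (suc k) b X) (AllPath (ChainIntact k) (OffIntact k) π)
    chain-step {k} m≤k {Y = Y} stop Y⊆ {b₁} {b₂} h c g =
      even (≤-trans (≤-reflexive (+-identityʳ _)) (cost-agree (suc k) Y Z Y⊆ (≤-trans (m≤m+n _ ⟦ b₂ ⟧) h))) tt
    chain-step {k} m≤k (_◂_ {d = d} ch π) Y⊆ {b₁} {b₂} {b} h (c , cπ , cd) (g , gπ , gd)
      rewrite restrict-cost (suc k) b₁ Z ch | child-cost (suc k) b ch =
      head-step m≤k c {b₁} {b₂} {b} h g ⊞ chain-step m≤k π Y⊆ (flags m≤k c g) cπ gπ ⊞ off-step m≤k d (flags m≤k c g) cd gd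

    cutout-cost : ∀ k b {X Y} (π : Path X Y) B → setOf Y ⊆ Z → setOf B ≗ Z → width Z < k →
                  cost k b (cutout π Z B) ≡ chainCost k b π + cost k false B
    cutout-cost k b stop B Y⊆ eq lt = cost-small k b B (subst (_< k) (sym (width-cong eq)) lt)
    cutout-cost k b {X} (_◂_ {d = d} ch π) B Y⊆ eq lt rewrite width-cong (cutout-set (ch ◂ π) Z B Y⊆ eq) =
      trans (cong (λ x → h + (x + r)) (cutout-cost k (big k p) π B Y⊆ eq lt)) (pull h (chainCost k (big k p) π) (cost k false B) r)
      where
      p = width (setOf X ∪ Z)
      h = headCost k b p
      r = cost k (big k p) (restrict d (∁ Z))

    intact-suc : ∀ {k p a c} → Intact k m p a c → Intact (suc k) m p a c
    intact-suc h lt = h (<⇒≤ lt)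

    raise-chain : ∀ {X Y} (π : Path X Y) → AllPath (ChainIntact m) (OffIntact m) π → AllPath (ChainIntact (suc m)) (OffIntact (suc m)) π
    raise-chain = AllPath-map intact-suc intact-suc

    raise-off : ∀ S → All (OffIntact m) S → All (OffIntact (suc m)) S
    raise-off = All-map intact-suc

    strict-head : ∀ {p a c} b₂ → m < p → Copies m p a c → c ≤ m → headCost (suc m) false a + headCost (suc m) b₂ c < headCost (suc m) true p
    strict-head {p} {a} {c} b₂ m<p C le rewrite big-no {suc m} {c} (s≤s le) | big-yes {suc m} {p} m<p | 𝔹.∧-zeroʳ (big (suc m) a)
      | +-identityʳ ⟦ big (suc m) a ⟧ | +-identityʳ ⟦ big (suc m) a ⟧ = s≤s (bit (big (suc m) a))
      where
      bit : ∀ b → ⟦ b ⟧ ≤ 1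
      bit false = z≤n
      bit true = ≤-refl

    bit≤1 : ∀ b → ⟦ b ⟧ ≤ 1
    bit≤1 false = z≤n
    bit≤1 true  = ≤-refl

    -- At an edge whose copy inside `Z` is still narrow, only the other copy can be wide; the
    -- recursion goes on with a narrow parent in the first copy and a wide parent in the original.
    switch : ∀ {p a c} b₂ b {B : Set} (X X′ Y Y′ V V′ : Bool → ℕ) → ⟦ b₂ ⟧ ≤ ⟦ b ⟧ → Copies m p a c → m < p → a ≤ m →
      (∀ b₂ → Drop (X false) (Y b₂) (V true) ⊥) →
      (∀ {b₁ b₂ b} → ⟦ b₁ ⟧ + ⟦ b₂ ⟧ ≤ ⟦ b ⟧ → Drop (X′ b₁) (Y′ b₂) (V′ b) B) →
      Drop (headCost (suc m) false a + (X (big (suc m) a) + X′ (big (suc m) a)))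
           (headCost (suc m) b₂ c + (Y (big (suc m) c) + Y′ (big (suc m) c)))
           (headCost (suc m) b p + (V (big (suc m) p) + V′ (big (suc m) p))) ⊥
    switch {p} {a} {c} b₂ b X X′ Y Y′ V V′ h C m<p le s u =
      drop-map (λ { (_ , x , _) → x }) (heads ⊞ chain ⊞ u {big (suc m) a} {big (suc m) c} {big (suc m) p} (one-big ≤-refl C (inj₁ le)))
      where
      heads : Drop (headCost (suc m) false a) (headCost (suc m) b₂ c) (headCost (suc m) b p) ⊤
      heads = even (head-intact ≤-refl C {false} {b₂} {b} h (inj₁ le)) tt
      chain : Drop (X (big (suc m) a)) (Y (big (suc m) c)) (V (big (suc m) p)) ⊥
      chain rewrite big-no {suc m} {a} (s≤s le) | big-yes m<p = s _

    cost-strict : ∀ T → setOf T ⊆ Z → m < width (setOf T) → cost (suc m) false (restrict T Z) < cost (suc m) true T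
    cost-strict (leaf x) h w rewrite cost-leaf (suc m) false x Z | width-cong (∩-⊆ {setOf (leaf x)} {Z} h) | big-yes w = s≤s (s≤s z≤n)
    cost-strict (node l r) h w rewrite restrict-cost (suc m) false Z (left {c = l} {d = r}) | width-cong (∩-⊆ {setOf (node l r)} {Z} h) | big-yes w =
      s≤s (s≤s (+-mono-≤ (cost-agree (suc m) l Z (λ v p → h v (∨-introˡ _ p)) ≤-refl) (cost-agree (suc m) r Z (λ v p → h v (∨-introʳ _ p)) ≤-refl)))

    -- If no width is lost, a chain edge keeps its width in exactly one copy, and the copy changes along the chain: at the change a
    -- parent-child pair of wide edges is lost.
    strict-step : ∀ {X Y} (π : Path X Y) → setOf Y ⊆ Z → ∀ b₂ → ChainAll (λ W → m < width W) π →
      AllPath ChainCopies OffCopies π → AllPath (ChainIntact m) (OffIntact m) π →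
      Drop (cost (suc m) false (restrict X Z)) (chainCost (suc m) b₂ π) (cost (suc m) true X) ⊥
    chain-switch : ∀ {c d X Y} (ch : Child c d X) (π : Path c Y) → setOf Y ⊆ Z → ∀ b₂ b → ⟦ b₂ ⟧ ≤ ⟦ b ⟧ → width (setOf X ∩ Z) ≤ m →
      ChainAll (λ W → m < width W) (ch ◂ π) → AllPath ChainCopies OffCopies (ch ◂ π) → AllPath (ChainIntact m) (OffIntact m) (ch ◂ π) →
      Drop (cost (suc m) false (restrict X Z)) (chainCost (suc m) b₂ (ch ◂ π)) (cost (suc m) b X) ⊥
    strict-step {X} stop Y⊆ b₂ w c g = less (≤-trans (≤-reflexive (cong suc (+-identityʳ _))) (cost-strict X Y⊆ w))
    strict-step (ch ◂ π) Y⊆ b₂ (m<p , w) (c , cπ , cd) (g , gπ , gd) with g m<p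
    ... | inj₁ le = chain-switch ch π Y⊆ b₂ true (bit≤1 b₂) le (m<p , w) (c , cπ , cd) (g , gπ , gd)
    strict-step {X} (_◂_ {d = d} ch π) Y⊆ b₂ (m<p , w) (c , cπ , cd) (g , gπ , gd) | inj₂ le
      rewrite restrict-cost (suc m) false Z ch | child-cost (suc m) true ch =
      drop-map (λ { (x , _) → x }) (heads ⊞ chain-step ≤-refl π Y⊆ (one-big ≤-refl c (inj₂ le)) cπ (raise-chain π gπ)
                                          ⊞ off-step ≤-refl d (one-big ≤-refl c (inj₂ le)) cd (raise-off d gd))
      where
      heads : Drop (headCost (suc m) false (width (setOf X ∩ Z))) (headCost (suc m) b₂ (width (setOf X ∪ Z))) (headCost (suc m) true (width (setOf X))) ⊥
      heads = less (strict-head b₂ m<p c le)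
    chain-switch {a} {d} ch π Y⊆ b₂ b h le (m<p , w) (c , cπ , cd) (g , gπ , gd)
      rewrite restrict-cost (suc m) false Z ch | child-cost (suc m) b ch =
      switch b₂ b (λ b → cost (suc m) b (restrict a Z)) (λ b → cost (suc m) b (restrict d Z)) (λ b → chainCost (suc m) b π)
        (λ b → cost (suc m) b (restrict d (∁ Z))) (λ b → cost (suc m) b a) (λ b → cost (suc m) b d) h c m<p le
        (λ b → strict-step π Y⊆ b w cπ gπ) (λ h → off-step ≤-refl d h cd (raise-off d gd))

    module Descent {T X Y : CarvTree n} (ρ : Path T X) (π : Path X Y) (Y⊆ : setOf Y ⊆ Z) (⊆X : Z ⊆ setOf X) (eq : width Z ≡ m)
                   (wide : ChainAll (λ W → m < width W) π) (cs : AllPath ChainCopies OffCopies π) where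

      X′ : CarvTree n
      X′ = cutout π Z (restrict X Z)

      restrict-Z : setOf (restrict X Z) ≗ Z
      restrict-Z v = trans (restrict-set X Z v) (trans (𝔹.∧-comm (setOf X v) (Z v)) (∩-⊆ ⊆X v))

      X′-set : setOf X′ ≗ setOf X
      X′-set v = trans (cutout-set π Z (restrict X Z) Y⊆ restrict-Z v) (absorb (setOf X v) (Z v) (⊆X v))
        where
        absorb : ∀ a b → (b ≡ true → a ≡ true) → a ∨ b ≡ a
        absorb true b h = refl
        absorb false true h = sym (h refl)
        absorb false false h = refl

      T′ : CarvTree n
      T′ = replace ρ X′

      X′-cost : ∀ k b → m < k → cost k b X′ ≡ cost k false (restrict X Z) + chainCost k b π
      X′-cost k b lt = trans (cutout-cost k b π (restrict X Z) Y⊆ restrict-Z (subst (_< k) (sym eq) lt)) (+-comm (chainCost k b π) _)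

      -- At the top of the path the copy inside `Z` is `Z` itself, of width `m`; at the bottom it is
      -- `Y`, which is wider. So the wide copy must change on the way, and there a pair is lost.
      top-step : ∀ b → AllPath (ChainIntact m) (OffIntact m) π → cost (suc m) b X′ < cost (suc m) b X
      top-step b int rewrite X′-cost (suc m) b ≤-refl = drop-< (by-path π Y⊆ wide cs int)
        where
        by-path : ∀ {Y} (π : Path X Y) → setOf Y ⊆ Z → ChainAll (λ W → m < width W) π → AllPath ChainCopies OffCopies π →
                  AllPath (ChainIntact m) (OffIntact m) π → Drop (cost (suc m) false (restrict X Z)) (chainCost (suc m) b π) (cost (suc m) b X) ⊥
        -- Here `X` and `Y` are the same node, so `Z` equals both and cannot be narrower.
        by-path stop Y⊆ w c g = ⊥-elim (<-irrefl (trans (sym eq) (width-cong λ v → trans (sym (∩-⊆ ⊆X v)) (trans (𝔹.∧-comm (Z v) (setOf X v)) (∩-⊆ Y⊆ v)))) w)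
        by-path (ch ◂ π) Y⊆ w c g = chain-switch ch π Y⊆ b b ≤-refl (≤-reflexive (trans (width-cong (λ v → trans (sym (restrict-set X Z v)) (restrict-Z v))) eq)) w c g

      -- Goes down through the levels with intact edges until one drops strictly; at level `suc m`
      -- this is forced by `top-step`.
      descent : ∀ k → m < k → AllPath (ChainIntact k) (OffIntact k) π → (λ k → cost k false T′) ≺[ k ] (λ k → cost k false T)
      descent (suc k) (s≤s m≤k) int with replace-cost (suc k) false ρ X′ X′-set
      ... | C , b , p , q with chain-step m≤k π Y⊆ {false} {b} {b} ≤-refl cs int
      ...   | less lt = inj₁ (subst₂ _<_ (sym p) (sym q) (+-monoʳ-< C (subst (_< cost (suc k) b X) (sym (X′-cost (suc k) b (s≤s m≤k))) lt)))
      ...   | even le int′ with m≤n⇒m<n∨m≡n m≤k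
      ...     | inj₁ m<k = ≺-suc k (subst₂ _≤_ (sym p) (sym q) (+-monoʳ-≤ C (subst (_≤ cost (suc k) b X) (sym (X′-cost (suc k) b (s≤s m≤k))) le))) (descent k m<k int′)
      ...     | inj₂ refl = inj₁ (subst₂ _<_ (sym p) (sym q) (+-monoʳ-< C (top-step b int′)))

  less-half : ∀ {a c p m} → a + c ≤ p + m → m ≤ c → a ≤ p
  less-half {a} {c} {p} {m} le h = +-cancelʳ-≤ m a p (≤-trans (+-monoʳ-≤ a h) le)

  less-half′ : ∀ {a c p m} → a + c ≤ p + m → m < c → a < p
  less-half′ {a} {c} {p} {m} le h = +-cancelʳ-≤ m (suc a) p (≤-trans (≤-reflexive (sym (+-suc a m))) (≤-trans (+-monoʳ-≤ a h) le))

  -- Submodularity for `W` and the complement of `Z`, rewritten by the symmetry of the width.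
  difference-sub : ∀ W Z → width (W ∩ ∁ Z) + width (Z ∩ ∁ W) ≤ width W + width Z
  difference-sub W Z = ≤-trans (+-monoʳ-≤ (width (W ∩ ∁ Z)) (≤-reflexive (trans (sym (width-∁ _)) (width-cong λ v → bool (W v) (Z v)))))
    (≤-trans (width-sub W (∁ Z)) (≤-reflexive (cong (width W +_) (width-∁ Z))))
    where
    bool : ∀ a b → not (b ∧ not a) ≡ a ∨ not b
    bool = toWitness {a? = ∀𝔹? λ a → ∀𝔹? λ b → _ 𝔹.≟ _} tt

  empty-least : ∀ E S → (∀ v → E v ≡ false) → width E ≤ width S
  empty-least E S e = half _ _ (≤-trans (≤-reflexive (cong₂ _+_ p q)) (≤-trans (width-sub S (∁ S)) (≤-reflexive (cong (width S +_) (width-∁ S)))))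
    where
    p : width E ≡ width (S ∩ ∁ S)
    p = width-cong λ v → trans (e v) (sym (𝔹.∧-inverseʳ (S v)))
    q : width E ≡ width (S ∪ ∁ S)
    q = trans (sym (width-∁ E)) (width-cong λ v → trans (cong not (e v)) (sym (𝔹.∨-inverseʳ (S v))))
    half : ∀ x y → x + x ≤ y + y → x ≤ y
    half x y h with x ≤? y
    ... | yes le = le
    ... | no ¬le = ⊥-elim (<⇒≱ (+-mono-<-≤ (≰⇒> ¬le) (<⇒≤ (≰⇒> ¬le))) h)

  -- `Z` has least width between `Y` and `X` and, among those sets, crosses the fewest nodes off the
  -- path. Least width makes both copies of every edge no wider than the original. For a node off
  -- the path that crosses `Z`, the flattened sets have fewer crossings, so they cannot be of least
  -- width, and both copies become strictly narrower.
  module Uncross {X Y : CarvTree n} (π : Path X Y) (d : Disjoint X) (Z : VSet n) (bt : Between (setOf Y) (setOf X) Z)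
                 (least : ∀ S → Between (setOf Y) (setOf X) S → width Z ≤ width S)
                 (few : ∀ S → Between (setOf Y) (setOf X) S → width S ≡ width Z → offCrossings π Z ≤ offCrossings π S) where

    meet≤ : ∀ W → W ⊆ setOf X → width (W ∩ Z) ≤ width W
    meet≤ W h = less-half (width-sub W Z) (least (W ∪ Z) ((λ v p → ∨-introʳ (W v) (proj₁ bt v p)) , λ v p → [ h v , proj₂ bt v ]′ (∨-true p)))

    chain-copies : ∀ W → setOf Y ⊆ W → W ⊆ setOf X → ChainCopies (width Z) Z W
    chain-copies W Y⊆ ⊆X = copies (less-half sub z≤∪) (less-half (≤-trans (≤-reflexive (+-comm (width (W ∪ Z)) _)) sub) z≤∩) type
      where
      sub = width-sub W Z
      z≤∪ = least (W ∪ Z) (between-∪ (Y⊆ , ⊆X) bt)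
      z≤∩ = least (W ∩ Z) (between-∩ (Y⊆ , ⊆X) bt)
      type : width (W ∩ Z) ≤ width Z ⊎ width (W ∪ Z) ≤ width Z ⊎ (width (W ∩ Z) < width W × width (W ∪ Z) < width W)
      type with m≤n⇒m<n∨m≡n z≤∩ | m≤n⇒m<n∨m≡n z≤∪
      ... | inj₂ e | _ = inj₁ (≤-reflexive (sym e))
      ... | _ | inj₂ e = inj₂ (inj₁ (≤-reflexive (sym e)))
      ... | inj₁ lt | inj₁ lt′ = inj₂ (inj₂ (less-half′ sub lt′ , less-half′ (≤-trans (≤-reflexive (+-comm (width (W ∪ Z)) _)) sub) lt))

    off-copies : ∀ {W} → Off π W → OffCopies (width Z) Z (setOf W)
    off-copies {W} o = copies (less-half sub z≤∪) (less-half sub′ z≤∖) type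
      where
      S = setOf W
      sub  = width-sub S Z
      sub′ = difference-sub S Z
      bt∪ : Between (setOf Y) (setOf X) (S ∪ Z)
      bt∪ = (λ v p → ∨-introʳ (S v) (proj₁ bt v p)) , λ v p → [ off-⊆ o v , proj₂ bt v ]′ (∨-true p)
      bt∖ : Between (setOf Y) (setOf X) (Z ∩ ∁ S)
      bt∖ = (λ v p → cong₂ _∧_ (proj₁ bt v p) (cong not (apart-sym (off-apart d o) v p))) , λ v p → proj₂ bt v (proj₁ (∧-true p))
      z≤∪ = least (S ∪ Z) bt∪
      z≤∖ = least (Z ∩ ∁ S) bt∖
      type : width (S ∩ Z) ≤ width Z ⊎ width (S ∩ ∁ Z) ≤ width Z ⊎ (width (S ∩ Z) < width S × width (S ∩ ∁ Z) < width S)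
      type with meets? S Z | meets? S (∁ Z)
      ... | no ¬p | _ = inj₁ (empty-least _ _ λ v → ¬true λ p → ¬p (v , ∧-true p))
      ... | _ | no ¬p = inj₂ (inj₁ (empty-least _ _ λ v → ¬true λ p → ¬p (v , ∧-true p)))
      ... | yes p | yes (u , q , q′) = inj₂ (inj₂ (less-half′ sub (strict z≤∪ bt∪ flat∪) , less-half′ sub′ (strict z≤∖ bt∖ flat∖)))
        where
        crosses : Crosses S Z
        crosses = p , (u , q , ¬true λ r → clash q′ (cong not r))
        flat∪ : Flattens S Z (S ∪ Z)
        flat∪ = record { b = true ; const = λ v h → ∨-introˡ (Z v) h ; agree = λ v h → cong (_∨ Z v) (sym h) }
        flat∖ : Flattens S Z (Z ∩ ∁ S)
        flat∖ = record { b = false ; const = λ v h → trans (cong (λ x → Z v ∧ not x) h) (𝔹.∧-zeroʳ (Z v))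
                       ; agree = λ v h → sym (trans (cong (λ x → Z v ∧ not x) h) (𝔹.∧-identityʳ (Z v))) }
        strict : ∀ {S′} → width Z ≤ width S′ → Between (setOf Y) (setOf X) S′ → Flattens S Z S′ → width Z < width S′
        strict le b f with m≤n⇒m<n∨m≡n le
        ... | inj₁ lt = lt
        ... | inj₂ e  = ⊥-elim (<⇒≱ (offCrossings-flatten d o crosses f) (few _ b (sym e)))

  -- The cut `Z₀` shows that the tree is not linked along `π`. It only starts the search: the cut
  -- used for rebuilding is chosen by least width and then by fewest crossings. The bound `K`
  -- persists because no copy is wider than its original.
  improve : ∀ K {T X Y} (ρ : Path T X) (π : Path X Y) → Disjoint T → All (λ W → width W ≤ K) T → ∀ w → ChainAll (λ W → w ≤ width W) π →
            ∀ Z₀ → Between (setOf Y) (setOf X) Z₀ → width Z₀ < w →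
            ∃[ T′ ] (setOf T′ ≗ setOf T × Disjoint T′ × All (λ W → width W ≤ K) T′ × (λ k → cost k false T′) ≺[ K ] (λ k → cost k false T))
  improve K {T} {X} {Y} ρ π d bd w wide Z₀ bt₀ lt₀ =
    D.T′ , replace-set ρ D.X′ D.X′-set , replace-disjoint ρ D.X′ D.X′-set d
      (cutout-disjoint π Z (restrict X Z) (proj₁ bt) D.restrict-Z dX (restrict-disjoint X Z dX)) ,
    replace-all resp ρ D.X′ D.X′-set bd (cutout-all resp π Z (restrict X Z) (proj₁ bt) D.restrict-Z
      (allPath π (ChainAll-map (λ { (c , h) → ≤-trans (Copies.c≤p c) h }) π chain-facts) λ o → ≤-trans (Copies.c≤p (U.off-copies o)) (All-off bdX o))
      (restrict-all resp X Z (All-path X λ σ → ≤-trans (U.meet≤ _ (path-⊆ σ)) (All-at bdX σ)))) ,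
    D.descent K (≤-trans m<w (≤-trans (ChainAll-top π wide) (All-root X bdX)))
      (allPath π (ChainAll-map (λ h lt → ⊥-elim (<⇒≱ lt h)) π (All-chain π bdX)) λ o lt → ⊥-elim (<⇒≱ lt (All-off bdX o)))
    where
    P : VSet n → Set
    P = Between (setOf Y) (setOf X)
    P? : ∀ S → Dec (P S)
    P? S = (setOf Y ⊆? S) ×-dec (S ⊆? setOf X)
    P-resp : ∀ {S S′} → S ≗ S′ → P S → P S′
    P-resp eq (p , q) = (λ v h → trans (sym (eq v)) (p v h)) , λ v h → q v (trans (eq v) h)
    resp : ∀ {S S′} → S ≗ S′ → width S ≤ K → width S′ ≤ K
    resp eq = subst (_≤ K) (width-cong eq)
    dX = disjoint-at d ρ
    bdX : All (λ W → width W ≤ K) X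
    bdX = All-below bd ρ
    first = argmin width P? P-resp width-cong (Z₀ , bt₀)
    Z₁ = proj₁ first
    second = argmin {P = λ S → P S × width S ≡ width Z₁} (offCrossings π) (λ S → P? S ×-dec (width S ≟ width Z₁))
      (λ eq (p , q) → P-resp eq p , trans (sym (width-cong eq)) q)
      (λ eq → ≤-antisym (offCrossings-agree π λ v _ → eq v) (offCrossings-agree π λ v _ → sym (eq v)))
      (Z₁ , proj₁ (proj₂ first) , refl)
    Z  = proj₁ second
    bt = proj₁ (proj₁ (proj₂ second))
    Z≡ : width Z ≡ width Z₁
    Z≡ = proj₂ (proj₁ (proj₂ second))
    least : ∀ S → P S → width Z ≤ width S
    least S p = ≤-trans (≤-reflexive Z≡) (proj₂ (proj₂ first) S p)
    module U = Uncross π dX Z bt least (λ S p e → proj₂ (proj₂ second) S (p , trans e Z≡))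
    m<w : width Z < w
    m<w = ≤-trans (s≤s (least Z₀ bt₀)) lt₀
    chain-facts : ChainAll (λ W → ChainCopies (width Z) Z W × width W ≤ K) π
    chain-facts = ChainAll-zip π (chainAll π U.chain-copies) (All-chain π bdX)
    module D = Descent (width Z) Z ρ π (proj₁ bt) (proj₂ bt) refl (ChainAll-map (≤-trans m<w) π wide)
                 (allPath π (chainAll π U.chain-copies) U.off-copies)

-- From carvings to binary trees

∑-zero : {A : Set} (xs : List A) → ∑ (λ _ → 0) xs ≡ 0
∑-zero []       = refl
∑-zero (x ∷ xs) = ∑-zero xs

∑-swap : {A B : Set} (f : A → B → ℕ) (xs : List A) (ys : List B) → ∑ (λ x → ∑ (f x) ys) xs ≡ ∑ (λ y → ∑ (λ x → f x y) xs) ys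
∑-swap f []       ys = sym (∑-zero ys)
∑-swap f (x ∷ xs) ys = trans (cong (∑ (f x) ys +_) (∑-swap f xs ys)) (sym (∑-+ (f x) (λ y → ∑ (λ x → f x y) xs) ys))

∑-one : {A : Set} (xs : List A) → ∑ (λ _ → 1) xs ≡ length xs
∑-one []       = refl
∑-one (x ∷ xs) = cong suc (∑-one xs)

∑-≤-length : ∀ {n} (f : Fin n → ℕ) {xs L : List (Fin n)} → Unique xs → (∀ x → f x ≤ 1) → (∀ x → 1 ≤ f x → x ∈ L) → ∑ f xs ≤ length L
∑-≤-length f {xs} {L} u f≤1 h = ≤-trans (∑-mono xs (λ {x} _ → below x)) (≤-trans (≤-reflexive (∑-swap (λ x l → δ l x) xs L))
  (≤-trans (∑-mono L (λ {l} _ → ∑δ-unique l u)) (≤-reflexive (∑-one L))))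
  where
  below : ∀ x → f x ≤ ∑ (λ l → δ l x) L
  below x with f x | f≤1 x | h x
  ... | zero  | _ | _ = z≤n
  ... | suc zero | _ | k = ≤-trans (≤-reflexive (sym (δ-refl x))) (∑-member (λ l → δ l x) L (k (s≤s z≤n)))
  ... | suc (suc _) | s≤s () | _

unique-length : ∀ {n} {xs : List (Fin n)} → Unique xs → length xs ≤ n
unique-length {n} {xs} u = ≤-trans (≤-reflexive (sym (∑-one xs)))
  (≤-trans (∑-≤-length (λ _ → 1) u (λ _ → ≤-refl) (λ x _ → ∈-allFin x)) (≤-reflexive (length-tabulate id)))

module Darts (U : UGraph) where

  V E : Set
  V = Fin (tV U)
  E = Fin (tE U)

  -- A tree edge with a direction; it stands for the subtree beyond its far end.
  Dart : Set
  Dart = E × Bool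

  edge : Dart → E
  edge = proj₁

  near far : Dart → V
  near (e , true)  = end₁ U e
  near (e , false) = end₂ U e
  far (e , true)  = end₂ U e
  far (e , false) = end₁ U e

  flip : Dart → Dart
  flip (e , b) = e , not b

  near-flip : ∀ d → near (flip d) ≡ far d
  near-flip (e , true)  = refl
  near-flip (e , false) = refl

  far-flip : ∀ d → far (flip d) ≡ near d
  far-flip (e , true)  = refl
  far-flip (e , false) = refl

  data Conn (P : E → Set) : V → V → Set where
    here : ∀ {a} → Conn P a a
    step : ∀ {a b} (d : Dart) → P (edge d) → near d ≡ a → Conn P (far d) b → Conn P a b

  from-reach : ∀ {P a b} → Reach U P a b → Conn P a b
  from-reach here = here
  from-reach (step₁ e p q r) = step (e , true) p q (from-reach r)
  from-reach (step₂ e p q r) = step (e , false) p q (from-reach r)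

  to-reach : ∀ {P a b} → Conn P a b → Reach U P a b
  to-reach here = here
  to-reach (step (e , true) p q r) = step₁ e p q (to-reach r)
  to-reach (step (e , false) p q r) = step₂ e p q (to-reach r)

  conn-trans : ∀ {P a b c} → Conn P a b → Conn P b c → Conn P a c
  conn-trans here r = r
  conn-trans (step d p q s) r = step d p q (conn-trans s r)

  conn-sym : ∀ {P a b} → Conn P a b → Conn P b a
  conn-sym here = here
  conn-sym {P} (step d p refl r) = conn-trans (conn-sym r) (step (flip d) p (near-flip d) (subst (λ x → Conn P x (near d)) (sym (far-flip d)) here))

  conn-map : ∀ {P Q a b} → (∀ d → P (edge d) → Q (edge d)) → Conn P a b → Conn Q a b
  conn-map f here = here
  conn-map f (step d p q r) = step d (f d p) q (conn-map f r)

  ends : ∀ {P} d d′ → edge d′ ≡ edge d → Conn P (near d) (far d) → Conn P (near d′) (far d′)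
  ends (e , true)  (_ , true)  refl r = r
  ends (e , false) (_ , false) refl r = r
  ends (e , false) (_ , true)  refl r = conn-sym r
  ends (e , true)  (_ , false) refl r = conn-sym r

  -- A union-find count: each edge of `L` merges at most two classes and so costs at most one
  -- representative.
  record Classes (L : List E) : Set where
    field
      rep      : V → V
      merged   : ∀ {e} → e ∈ L → rep (end₁ U e) ≡ rep (end₂ U e)
      reps     : List V
      distinct : ∀ y → ∑ (δ y ∘ rep) reps ≤ 1
      many     : tV U ≤ length reps + length L

  classes : ∀ L → Classes L
  classes [] = record
    { rep = id ; merged = λ () ; reps = allFin (tV U) ; distinct = λ y → ∑δ-unique y (allFin⁺ (tV U))
    ; many = ≤-reflexive (sym (trans (+-identityʳ _) (length-tabulate id))) }
  classes (x ∷ L) = record { rep = rep′ ; merged = merged′ ; reps = prune reps ; distinct = distinct′ ; many = many′ }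
    where
    open Classes (classes L)
    a = rep (end₁ U x)
    b = rep (end₂ U x)
    glue : V → V
    glue y with a Fin.≟ y
    ... | yes _ = b
    ... | no _  = y
    rep′ : V → V
    rep′ = glue ∘ rep
    glue-b : glue b ≡ b
    glue-b with a Fin.≟ b
    ... | yes _ = refl
    ... | no _  = refl
    glue-a : glue a ≡ b
    glue-a with a Fin.≟ a
    ... | yes _ = refl
    ... | no ¬p = ⊥-elim (¬p refl)
    merged′ : ∀ {e} → e ∈ x ∷ L → rep′ (end₁ U e) ≡ rep′ (end₂ U e)
    merged′ (here refl) = trans glue-a (sym glue-b)
    merged′ (there e∈)  = cong glue (merged e∈)
    prune : List V → List V
    prune [] = []
    prune (v ∷ vs) with a Fin.≟ rep v
    ... | yes _ = prune vs
    ... | no _  = v ∷ prune vs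
    prune-∑ : ∀ y vs → ∑ (δ y ∘ rep′) (prune vs) ≤ ∑ (δ y ∘ rep) vs
    prune-∑ y [] = z≤n
    prune-∑ y (v ∷ vs) with a Fin.≟ rep v in eq
    ... | yes _ = ≤-trans (prune-∑ y vs) (m≤n+m _ (δ y (rep v)))
    ... | no _ rewrite eq = +-monoʳ-≤ (δ y (rep v)) (prune-∑ y vs)
    distinct′ : ∀ y → ∑ (δ y ∘ rep′) (prune reps) ≤ 1
    distinct′ y = ≤-trans (prune-∑ y reps) (distinct y)
    prune-length : ∀ vs → length vs ≤ length (prune vs) + ∑ (δ a ∘ rep) vs
    prune-length [] = z≤n
    prune-length (v ∷ vs) with a Fin.≟ rep v
    ... | yes _ = ≤-trans (s≤s (prune-length vs)) (≤-reflexive (sym (+-suc _ _)))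
    ... | no _  = s≤s (prune-length vs)
    many′ : tV U ≤ length (prune reps) + suc (length L)
    many′ = ≤-trans many (≤-trans (+-monoˡ-≤ (length L) (≤-trans (prune-length reps) (+-monoʳ-≤ (length (prune reps)) (distinct a))))
      (≤-reflexive (+-assoc (length (prune reps)) 1 (length L))))

  spanning-bound : ∀ L → (∀ a b → Conn (_∈ L) a b) → tV U ≤ 1 + length L
  spanning-bound L conn = ≤-trans many (+-monoˡ-≤ (length L) (bound reps distinct))
    where
    open Classes (classes L)
    same : ∀ {a b} → Conn (_∈ L) a b → rep a ≡ rep b
    same here = refl
    same (step (e , true) e∈ refl r) = trans (merged e∈) (same r)
    same (step (e , false) e∈ refl r) = trans (sym (merged e∈)) (same r)
    bound : ∀ vs → (∀ y → ∑ (δ y ∘ rep) vs ≤ 1) → length vs ≤ 1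
    bound [] h = z≤n
    bound (v ∷ []) h = ≤-refl
    bound (v ∷ u ∷ vs) h = ⊥-elim (<⇒≱ (+-mono-≤ (≤-reflexive (sym (δ-refl (rep v))))
      (≤-trans (≤-reflexive (sym (trans (cong (δ (rep v)) (same (conn u v))) (δ-refl (rep v))))) (m≤m+n _ _))) (h (rep v)))

  module _ (tree : IsTree U) where
    open IsTree tree

    -- If the ends of an edge were joined without it, so would be all pairs of vertices, by a
    -- detour; then too few edges would connect the whole tree.
    bridge : ∀ d → ¬ Conn (_≢ edge d) (near d) (far d)
    bridge d r = <⇒≱ (≤-trans (s≤s (unique-length unique-x∷L)) (≤-reflexive (trans (+-comm 1 (tE U)) edgeCount)))
                     (spanning-bound L λ a b → conn-map (λ d′ p → ∈-filter⁺ (λ e → ¬? (e Fin.≟ edge d)) (∈-allFin (edge d′)) p) (detour (from-reach (connected a b))))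
      where
      L = filter (λ e → ¬? (e Fin.≟ edge d)) (allFin (tE U))
      unique-x∷L : Unique (edge d ∷ L)
      unique-x∷L = All.tabulate (λ e∈ eq → proj₂ (∈-filter⁻ (λ e → ¬? (e Fin.≟ edge d)) {xs = allFin (tE U)} e∈) (sym eq)) ∷ filter⁺ (λ e → ¬? (e Fin.≟ edge d)) (allFin⁺ (tE U))
      detour : ∀ {a b} → Conn (λ _ → ⊤) a b → Conn (_≢ edge d) a b
      detour here = here
      detour (step d′ _ refl s) with edge d′ Fin.≟ edge d
      ... | yes q = conn-trans (ends d d′ q r) (detour s)
      ... | no ¬q = step d′ ¬q refl (detour s)

    no-loop : ∀ d → near d ≢ far d
    no-loop d q = bridge d (subst (Conn _ (near d)) q here)

  starts stops : V → List E
  starts t = filter (λ e → end₁ U e Fin.≟ t) (allFin (tE U))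
  stops t  = filter (λ e → end₂ U e Fin.≟ t) (allFin (tE U))

  forward backward : E → Dart
  forward e  = e , true
  backward e = e , false

  darts : V → List Dart
  darts t = map forward (starts t) ++ map backward (stops t)

  darts-length : ∀ t → length (darts t) ≡ deg U t
  darts-length t = trans (length-++ (map forward (starts t))) (cong₂ _+_ (length-map forward (starts t)) (length-map backward (stops t)))

  darts-unique : ∀ t → Unique (darts t)
  darts-unique t = ++⁺ {xs = map forward (starts t)} {map backward (stops t)}
    (map⁺ {f = forward} (λ { refl → refl }) (filter⁺ (λ e → end₁ U e Fin.≟ t) (allFin⁺ (tE U))))
    (map⁺ {f = backward} (λ { refl → refl }) (filter⁺ (λ e → end₂ U e Fin.≟ t) (allFin⁺ (tE U))))
    λ { (p , q) → apart p q }
    where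
    apart : ∀ {d} → d ∈ map forward (starts t) → d ∈ map backward (stops t) → ⊥
    apart p q with ∈-map⁻ forward p | ∈-map⁻ backward q
    ... | _ , _ , refl | _ , _ , ()

  near-darts : ∀ {t} d → near d ≡ t → d ∈ darts t
  near-darts {t} (e , true) q = ∈-++⁺ˡ (∈-map⁺ forward (∈-filter⁺ (λ e → end₁ U e Fin.≟ t) (∈-allFin e) q))
  near-darts {t} (e , false) q = ∈-++⁺ʳ (map forward (starts t)) (∈-map⁺ backward (∈-filter⁺ (λ e → end₂ U e Fin.≟ t) (∈-allFin e) q))

  darts-near : ∀ {t d} → d ∈ darts t → near d ≡ t
  darts-near {t} d∈ with ∈-++⁻ (map forward (starts t)) d∈
  ... | inj₁ p with ∈-map⁻ forward p
  ...   | e , e∈ , refl = proj₂ (∈-filter⁻ (λ e → end₁ U e Fin.≟ t) {xs = allFin (tE U)} e∈)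
  darts-near {t} d∈ | inj₂ p with ∈-map⁻ backward p
  ...   | e , e∈ , refl = proj₂ (∈-filter⁻ (λ e → end₂ U e Fin.≟ t) {xs = allFin (tE U)} e∈)

single-list : {A : Set} {x : A} {xs : List A} → length xs ≤ 1 → x ∈ xs → ∀ {y} → y ∈ xs → y ≡ x
single-list {xs = _ ∷ []} _ (here refl) (here refl) = refl
single-list {xs = _ ∷ _ ∷ _} (s≤s ()) _ _

record Others {A : Set} (x : A) (xs : List A) : Set where
  constructor others
  field
    y z   : A
    y∈    : y ∈ xs
    z∈    : z ∈ xs
    y≢x   : y ≢ x
    z≢x   : z ≢ x
    y≢z   : y ≢ z
    only  : ∀ {w} → w ∈ xs → w ≢ x → w ≡ y ⊎ w ≡ z

three-list : {A : Set} {x : A} {xs : List A} → length xs ≡ 3 → Unique xs → x ∈ xs → Others x xs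
three-list {xs = a ∷ b ∷ c ∷ []} refl ((ab ∷ ac ∷ []) ∷ (bc ∷ []) ∷ _) (here refl) =
  others b c (there (here refl)) (there (there (here refl))) (λ q → ab (sym q)) (λ q → ac (sym q)) bc
    λ { (here refl) n → ⊥-elim (n refl) ; (there (here refl)) _ → inj₁ refl ; (there (there (here refl))) _ → inj₂ refl }
three-list {xs = a ∷ b ∷ c ∷ []} refl ((ab ∷ ac ∷ []) ∷ (bc ∷ []) ∷ _) (there (here refl)) =
  others a c (here refl) (there (there (here refl))) ab (λ q → bc (sym q)) ac
    λ { (here refl) _ → inj₁ refl ; (there (here refl)) n → ⊥-elim (n refl) ; (there (there (here refl))) _ → inj₂ refl }
three-list {xs = a ∷ b ∷ c ∷ []} refl ((ab ∷ ac ∷ []) ∷ (bc ∷ []) ∷ _) (there (there (here refl))) =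
  others a b (here refl) (there (here refl)) ac bc ab
    λ { (here refl) _ → inj₁ refl ; (there (here refl)) _ → inj₂ refl ; (there (there (here refl))) n → ⊥-elim (n refl) }

module FromCarving (G : Digraph) (C : Carving G) (k : ℕ) (W : WidthAtMost G C k) where

  U = T C
  open Darts U
  module E = Cuts {A = Fin (nE G)} (tail G) (head G)

  cutWidth : VSet (nV G) → ℕ
  cutWidth S = ∑ (E.out S) (allFin (nE G))

  bridge′ = bridge (isTree C)
  no-loop′ = no-loop (isTree C)

  Side : Dart → V → Set
  Side d s = Conn (_≢ edge d) (far d) s

  record Branch (d : Dart) : Set where
    field
      carv     : CarvTree (nV G)
      inside   : ∀ v → setOf carv v ≡ true → Side d (ℓ C v)
      complete : ∀ v → Side d (ℓ C v) → setOf carv v ≡ true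
      disjoint : Disjoint carv
      narrow   : All (λ S → cutWidth S ≤ k) carv

  -- Only outgoing edges are counted here, so the list that bounds the full boundary bounds them
  -- too.
  side-narrow : ∀ d S → (∀ v → S v ≡ true → Side d (ℓ C v)) → (∀ v → Side d (ℓ C v) → S v ≡ true) → cutWidth S ≤ k
  side-narrow d S i c = go (bound d)
    where
    bound : ∀ d → CutAtMost G (λ v → Reach U (λ f → f ≢ edge d) (far d) (ℓ C v)) k
    bound (e , true)  = proj₂ (W e)
    bound (e , false) = proj₁ (W e)
    out≤1 : ∀ e → E.out S e ≤ 1
    out≤1 e with S (tail G e) ∧ not (S (head G e))
    ... | true = ≤-refl
    ... | false = z≤n
    go : CutAtMost G (λ v → Reach U (λ f → f ≢ edge d) (far d) (ℓ C v)) k → cutWidth S ≤ k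
    go (L , len , h) = ≤-trans (∑-≤-length (E.out S) (allFin⁺ (nE G)) out≤1 crossing) len
      where
      crossing : ∀ e → 1 ≤ E.out S e → e ∈ L
      crossing e p with S (tail G e) in eq | S (head G e) in eq′
      ... | true | false = h e (inj₁ (to-reach (i _ eq) , λ r → clash (c _ (from-reach r)) eq′))
      crossing e () | true | true
      crossing e () | false | _

  module Join (d d₁ d₂ : Dart) (near₁ : near d₁ ≡ far d) (near₂ : near d₂ ≡ far d)
              (d₁≢ : d₁ ≢ flip d) (d₂≢ : d₂ ≢ flip d) (d₁≢d₂ : d₁ ≢ d₂)
              (only : ∀ {w} → near w ≡ far d → w ≢ flip d → w ≡ d₁ ⊎ w ≡ d₂) where

    t : V
    t = far d

    same-edge : ∀ x y → near x ≡ t → near y ≡ t → x ≢ y → edge x ≢ edge y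
    same-edge (e , true)  (_ , true)  p q n refl = n refl
    same-edge (e , false) (_ , false) p q n refl = n refl
    same-edge (e , true)  (_ , false) p q n refl = no-loop′ (e , true) (trans p (sym q))
    same-edge (e , false) (_ , true)  p q n refl = no-loop′ (e , true) (trans q (sym p))

    e₁≢e : edge d₁ ≢ edge d
    e₁≢e = same-edge d₁ (flip d) near₁ (near-flip d) d₁≢
    e₂≢e : edge d₂ ≢ edge d
    e₂≢e = same-edge d₂ (flip d) near₂ (near-flip d) d₂≢
    e₁≢e₂ : edge d₁ ≢ edge d₂
    e₁≢e₂ = same-edge d₁ d₂ near₁ near₂ d₁≢d₂

    Away : E → Set
    Away f = end₁ U f ≢ t × end₂ U f ≢ t

    away-dart : ∀ x → near x ≡ t → ∀ {f} → Away f → f ≢ edge x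
    away-dart (e , true) q (p , _) refl = p q
    away-dart (e , false) q (_ , p) refl = p q

    to-away : ∀ x → near x ≢ t → far x ≢ t → Away (edge x)
    to-away (e , true) p q = p , q
    to-away (e , false) p q = q , p

    avoids : ∀ x → near x ≡ t → ∀ {s} → Side x s → s ≢ t
    avoids x q r refl = bridge′ x (conn-sym (subst (Conn _ (far x)) (sym q) r))

    away : ∀ {P a s} → (∀ {c} → Conn P a c → c ≢ t) → Conn P a s → Conn Away a s
    away h here = here
    away h (step x p refl r) = step x (to-away x (h here) (h (step x p refl here))) refl (away (λ r′ → h (step x p refl r′)) r)

    side-away : ∀ x → near x ≡ t → ∀ {s} → Side x s → Conn Away (far x) s
    side-away x q r = away (avoids x q) r

    away-side : ∀ x → near x ≡ t → ∀ {a s} → Conn Away a s → Conn (_≢ edge x) a s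
    away-side x q = conn-map (λ _ → away-dart x q)

    extend-side : ∀ x → near x ≡ t → edge x ≢ edge d → ∀ {s} → Side x s → Side d s
    extend-side x q n r = step x n q (conn-map (λ y p e → away-dart (flip d) (near-flip d) p e) (side-away x q r))

    apart : ∀ {s} → Side d₁ s → Side d₂ s → ⊥
    apart r r′ = avoids d₁ near₁ (conn-trans r (conn-trans (away-side d₁ near₁ (conn-sym (side-away d₂ near₂ r′)))
      (step (flip d₂) (λ e → e₁≢e₂ (sym e)) (near-flip d₂) (subst (λ x → Conn _ x (near d₂)) (sym (far-flip d₂)) here)))) near₂

    -- Treats the walk from its end backwards. After its last visit to `t`, if there is one, it
    -- either stops or continues through `d₁` or `d₂` and stays away from `t`; the fourth case is a
    -- walk that does not meet `t`.
    cover : ∀ {a s} → Conn (_≢ edge d) a s → s ≡ t ⊎ Side d₁ s ⊎ Side d₂ s ⊎ (a ≢ t × Conn Away a s)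
    cover {a} here with a Fin.≟ t
    ... | yes q = inj₁ q
    ... | no ¬q = inj₂ (inj₂ (inj₂ (¬q , here)))
    cover (step x p refl r) with cover r
    ... | inj₁ q = inj₁ q
    ... | inj₂ (inj₁ q) = inj₂ (inj₁ q)
    ... | inj₂ (inj₂ (inj₁ q)) = inj₂ (inj₂ (inj₁ q))
    ... | inj₂ (inj₂ (inj₂ (n , s))) with near x Fin.≟ t
    ...   | no ¬q = inj₂ (inj₂ (inj₂ (¬q , step x (to-away x ¬q n) refl s)))
    ...   | yes q with only {x} q (λ e → p (cong edge e))
    ...     | inj₁ e = inj₂ (inj₁ (away-side d₁ near₁ (subst (λ y → Conn Away (far y) _) e s)))
    ...     | inj₂ e = inj₂ (inj₂ (inj₁ (away-side d₂ near₂ (subst (λ y → Conn Away (far y) _) e s))))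

    join-branches : ¬ Leaf U t → Branch d₁ → Branch d₂ → Branch d
    join-branches inner b₁ b₂ = record
      { carv = node (carv b₁) (carv b₂) ; inside = ins ; complete = com
      ; disjoint = (λ v p → ¬true λ q → apart (inside b₁ v p) (inside b₂ v q)) , disjoint b₁ , disjoint b₂
      ; narrow = side-narrow d _ ins com , narrow b₁ , narrow b₂ }
      where
      open Branch
      ins : ∀ v → setOf (carv b₁) v ∨ setOf (carv b₂) v ≡ true → Side d (ℓ C v)
      ins v p with ∨-true p
      ... | inj₁ q = extend-side d₁ near₁ e₁≢e (inside b₁ v q)
      ... | inj₂ q = extend-side d₂ near₂ e₂≢e (inside b₂ v q)
      com : ∀ v → Side d (ℓ C v) → setOf (carv b₁) v ∨ setOf (carv b₂) v ≡ true
      com v r with cover r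
      ... | inj₁ q = ⊥-elim (inner (subst (Leaf U) q (ℓ-leaf C v)))
      ... | inj₂ (inj₁ q) = ∨-introˡ _ (complete b₁ v q)
      ... | inj₂ (inj₂ (inj₁ q)) = ∨-introʳ _ (complete b₂ v q)
      ... | inj₂ (inj₂ (inj₂ (n , _))) = ⊥-elim (n refl)

  leaf-branch : ∀ d → Leaf U (far d) → Branch d
  leaf-branch d lf = build (Finₚ.any? λ v → ℓ C v Fin.≟ far d)
    where
    stuck : ∀ {s} → Side d s → s ≡ far d
    stuck here = refl
    stuck (step x p q r) = ⊥-elim (p (cong edge (single-list (≤-trans (≤-reflexive (darts-length (far d))) lf)
      (near-darts (flip d) (near-flip d)) (near-darts x q))))
    build : Dec (∃[ v ] ℓ C v ≡ far d) → Branch d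
    build (no ¬p) = record
      { carv = leaf nothing ; inside = λ _ () ; complete = com ; disjoint = tt
      ; narrow = side-narrow d (λ _ → false) (λ _ ()) com }
      where
      com : ∀ v → Side d (ℓ C v) → false ≡ true
      com v r = ⊥-elim (¬p (v , stuck r))
    build (yes (u , q)) = record
      { carv = leaf (just u) ; inside = ins ; complete = com ; disjoint = tt
      ; narrow = side-narrow d ⁅ u ⁆ ins com }
      where
      ins : ∀ v → ⁅ u ⁆ v ≡ true → Side d (ℓ C v)
      ins v p with v Fin.≟ u
      ... | yes refl = subst (Side d) (sym q) here
      com : ∀ v → Side d (ℓ C v) → ⁅ u ⁆ v ≡ true
      com v r with v Fin.≟ u
      ... | yes _ = refl
      ... | no ¬e = ⊥-elim (¬e (ℓ-inj C (trans (stuck r) (sym q))))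

  -- The visited vertices all lie outside the side still to be explored, so their number bounds the depth.
  grow : ∀ fuel (vs : List V) d → tV U ≤ fuel + length vs → Unique vs → (∀ {s} → s ∈ vs → ¬ Side d s) → Branch d
  grow zero vs d h u out = ⊥-elim (<⇒≱ (unique-length (All.tabulate (λ { {y} y∈ refl → out y∈ here }) ∷ u)) h)
  grow (suc fuel) vs d h u out with cubic C (far d)
  ... | inj₁ lf = leaf-branch d lf
  ... | inj₂ three with three-list (trans (darts-length (far d)) three) (darts-unique (far d)) (near-darts (flip d) (near-flip d))
  ...   | others d₁ d₂ d₁∈ d₂∈ n₁ n₂ n₁₂ only =
    J.join-branches (λ lf → <⇒≱ (s≤s (s≤s z≤n)) (≤-trans (≤-reflexive (sym three)) lf))
      (sub d₁ (darts-near d₁∈) J.e₁≢e) (sub d₂ (darts-near d₂∈) J.e₂≢e)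
    where
    module J = Join d d₁ d₂ (darts-near d₁∈) (darts-near d₂∈) n₁ n₂ n₁₂ (λ q n → only (near-darts _ q) n)
    sub : ∀ x → near x ≡ far d → edge x ≢ edge d → Branch x
    sub x q n = grow fuel (far d ∷ vs) x (≤-trans h (≤-reflexive (sym (+-suc fuel (length vs)))))
      (All.tabulate (λ { {y} y∈ refl → out y∈ here }) ∷ u)
      λ { (here refl) r → J.avoids x q r refl ; (there s∈) r → out s∈ (J.extend-side x q n r) }

  branch : ∀ d → Branch d
  branch d = grow (tV U) [] d (m≤m+n _ _) [] λ ()

  whole-narrow : ∀ S → (∀ v → S v ≡ true) → cutWidth S ≤ k
  whole-narrow S h = ≤-trans (≤-reflexive (trans (∑-cong (allFin (nE G)) (λ e → cong₂ cross (h (tail G e)) (h (head G e)))) (∑-zero (allFin (nE G))))) z≤n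

  record Rooted : Set where
    field
      carv     : CarvTree (nV G)
      whole    : ∀ v → setOf carv v ≡ true
      disjoint : Disjoint carv
      narrow   : All (λ S → cutWidth S ≤ k) carv

  -- The root subdivides an edge of the carving; its set consists of all vertices and has width 0.
  rooted-at : E → Rooted
  rooted-at x = record
    { carv = node (carv b) (carv b′) ; whole = all
    ; disjoint = (λ v p → ¬true λ q → bridge′ (x , true) (conn-trans (inside b v p) (conn-sym (inside b′ v q)))) , disjoint b , disjoint b′
    ; narrow = whole-narrow _ all , narrow b , narrow b′ }
    where
    open Branch
    b = branch (x , false)
    b′ = branch (x , true)
    cover : ∀ {a s} → Conn (λ _ → ⊤) a s → Conn (_≢ x) a s ⊎ Side (x , false) s ⊎ Side (x , true) s
    cover here = inj₁ here
    cover (step y _ refl r) with cover r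
    ... | inj₂ q = inj₂ q
    cover (step (y , b) _ refl r) | inj₁ q with y Fin.≟ x
    ... | no ¬e = inj₁ (step (y , b) ¬e refl q)
    cover (step (y , true) _ refl r) | inj₁ q | yes refl = inj₂ (inj₂ q)
    cover (step (y , false) _ refl r) | inj₁ q | yes refl = inj₂ (inj₁ q)
    all : ∀ v → setOf (carv b) v ∨ setOf (carv b′) v ≡ true
    all v with cover (from-reach (IsTree.connected (isTree C) (end₁ U x) (ℓ C v)))
    ... | inj₁ q = ∨-introˡ _ (complete b v q)
    ... | inj₂ (inj₁ q) = ∨-introˡ _ (complete b v q)
    ... | inj₂ (inj₂ q) = ∨-introʳ _ (complete b′ v q)

  rooted-empty : tE U ≡ 0 → Rooted
  rooted-empty none = build (nV G) refl
    where
    tV≡1 : tV U ≡ 1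
    tV≡1 = trans (sym (IsTree.edgeCount (isTree C))) (cong (_+ 1) none)
    fin1 : ∀ {m} → m ≡ 1 → (x y : Fin m) → x ≡ y
    fin1 refl zero zero = refl
    build : ∀ m → nV G ≡ m → Rooted
    build zero eq = record { carv = leaf nothing ; whole = λ v → ⊥-elim (Finₚ.¬Fin0 (subst Fin eq v)) ; disjoint = tt
                           ; narrow = whole-narrow (λ _ → false) λ v → ⊥-elim (Finₚ.¬Fin0 (subst Fin eq v)) }
    build (suc m) eq = record { carv = leaf (just u) ; whole = all ; disjoint = tt ; narrow = whole-narrow _ all }
      where
      u = subst Fin (sym eq) zero
      all : ∀ v → ⁅ u ⁆ v ≡ true
      all v with v Fin.≟ u
      ... | yes _ = refl
      ... | no ¬e = ⊥-elim (¬e (ℓ-inj C (fin1 tV≡1 _ _)))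

  rooted : Rooted
  rooted = by-edges (tE U) refl
    where
    by-edges : ∀ m → tE U ≡ m → Rooted
    by-edges zero eq    = rooted-empty eq
    by-edges (suc m) eq = rooted-at (subst Fin (sym eq) zero)

-- Pieces from linkages

∑-scale : {A : Set} (c : ℕ) (f : A → ℕ) (xs : List A) → ∑ (λ x → c * f x) xs ≡ c * ∑ f xs
∑-scale c f []       = sym (*-zeroʳ c)
∑-scale c f (x ∷ xs) = trans (cong (c * f x +_) (∑-scale c f xs)) (sym (*-distribˡ-+ c (f x) _))

-- Summing over the vertices turns the degree condition into a balance of every vertex set.
∑-by-value : ∀ {m n} (f : Fin m → Fin n) (g : Fin n → ℕ) es → ∑ (g ∘ f) es ≡ ∑ (λ v → g v * ∑ (λ e → δ v (f e)) es) (allFin n)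
∑-by-value {n = n} f g es = begin
  ∑ (g ∘ f) es                                             ≡⟨ ∑-cong es (λ e → sym (pick (f e))) ⟩
  ∑ (λ e → ∑ (λ v → g v * δ v (f e)) (allFin n)) es        ≡⟨ ∑-swap (λ e v → g v * δ v (f e)) es (allFin n) ⟩
  ∑ (λ v → ∑ (λ e → g v * δ v (f e)) es) (allFin n)        ≡⟨ ∑-cong (allFin n) (λ v → ∑-scale (g v) (λ e → δ v (f e)) es) ⟩
  ∑ (λ v → g v * ∑ (λ e → δ v (f e)) es) (allFin n) ∎
  where
  open ≡-Reasoning
  at : ∀ x v → g v * δ v x ≡ g x * δ x v
  at x v with v Fin.≟ x | x Fin.≟ v
  ... | yes refl | yes _ = refl
  ... | no _     | no _  = trans (*-zeroʳ (g v)) (sym (*-zeroʳ (g x)))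
  ... | yes p    | no ¬q = ⊥-elim (¬q (sym p))
  ... | no ¬p    | yes q = ⊥-elim (¬p (sym q))
  pick : ∀ x → ∑ (λ v → g v * δ v x) (allFin n) ≡ g x
  pick x = begin
    ∑ (λ v → g v * δ v x) (allFin n) ≡⟨ ∑-cong (allFin n) (at x) ⟩
    ∑ (λ v → g x * δ x v) (allFin n) ≡⟨ ∑-scale (g x) (δ x) (allFin n) ⟩
    g x * ∑ (δ x) (allFin n)         ≡⟨ cong (g x *_) (∑δ-allFin x) ⟩
    g x * 1                          ≡⟨ *-identityʳ (g x) ⟩
    g x ∎

length-filter : ∀ {m n} (f : Fin m → Fin n) v es → length (filter (λ e → f e Fin.≟ v) es) ≡ ∑ (λ e → δ v (f e)) es
length-filter f v [] = refl
length-filter f v (e ∷ es) with f e Fin.≟ v | v Fin.≟ f e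
... | yes _ | yes _ = cong suc (length-filter f v es)
... | no _  | no _  = length-filter f v es
... | yes p | no ¬q = ⊥-elim (¬q (sym p))
... | no ¬p | yes q = ⊥-elim (¬p (sym q))

eulerian-balanced : ∀ G → Eulerian G → Cuts.Balanced (tail G) (head G) (allFin (nE G))
eulerian-balanced G eul S = begin
  ∑ (λ e → ⟦ S (tail G e) ⟧) es ≡⟨ ∑-by-value (tail G) (⟦_⟧ ∘ S) es ⟩
  ∑ (λ v → ⟦ S v ⟧ * ∑ (λ e → δ v (tail G e)) es) (allFin (nV G)) ≡⟨ ∑-cong (allFin (nV G)) (λ v → cong (⟦ S v ⟧ *_) (degrees v)) ⟩
  ∑ (λ v → ⟦ S v ⟧ * ∑ (λ e → δ v (head G e)) es) (allFin (nV G)) ≡⟨ sym (∑-by-value (head G) (⟦_⟧ ∘ S) es) ⟩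
  ∑ (λ e → ⟦ S (head G e) ⟧) es ∎
  where
  open ≡-Reasoning
  es = allFin (nE G)
  degrees : ∀ v → ∑ (λ e → δ v (tail G e)) es ≡ ∑ (λ e → δ v (head G e)) es
  degrees v = trans (sym (length-filter (tail G) v es)) (trans (sym (eul v)) (length-filter (head G) v es))

∑-tabulate : ∀ {A : Set} {m} (f : A → ℕ) (g : Fin m → A) → ∑ f (tabulate g) ≡ ∑ (f ∘ g) (allFin m)
∑-tabulate {m = zero} f g  = refl
∑-tabulate {m = suc m} f g = cong (f (g zero) +_) (trans (∑-tabulate f (g ∘ suc)) (sym (∑-tabulate (f ∘ g) suc)))

record Enum {m} (p : Fin m → Bool) (w : ℕ) : Set where
  field
    at    : Fin w → Fin m
    holds : ∀ a → p (at a) ≡ true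
    inj   : ∀ {a b} → at a ≡ at b → a ≡ b
    sur   : ∀ x → p x ≡ true → ∃[ a ] at a ≡ x

enum : ∀ {m} (p : Fin m → Bool) → Enum p (∑ (⟦_⟧ ∘ p) (allFin m))
enum {zero} p = record { at = λ () ; holds = λ () ; inj = λ { {()} } ; sur = λ () }
enum {suc m} p = subst (Enum p) (cong (⟦ p zero ⟧ +_) (sym (∑-tabulate (⟦_⟧ ∘ p) suc))) (by (p zero) refl)
  where
  open Enum (enum (p ∘ suc))
  by : ∀ b → p zero ≡ b → Enum p (⟦ b ⟧ + ∑ (⟦_⟧ ∘ p ∘ suc) (allFin m))
  by true eq = record
    { at = λ { zero → zero ; (suc a) → suc (at a) }
    ; holds = λ { zero → eq ; (suc a) → holds a }
    ; inj = λ { {zero} {zero} _ → refl ; {suc a} {suc b} q → cong suc (inj (suc-inj q)) ; {zero} {suc b} () ; {suc a} {zero} () }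
    ; sur = λ { zero _ → zero , refl ; (suc x) h → let a , q = sur x h in suc a , cong suc q } }
    where
    suc-inj : ∀ {n} {x y : Fin n} → Fin.suc x ≡ suc y → x ≡ y
    suc-inj refl = refl
  by false eq = record
    { at = suc ∘ at ; holds = holds ; inj = λ q → inj (suc-inj q)
    ; sur = λ { zero h → ⊥-elim (clash h eq) ; (suc x) h → let a , q = sur x h in a , cong suc q } }
    where
    suc-inj : ∀ {n} {x y : Fin n} → Fin.suc x ≡ suc y → x ≡ y
    suc-inj refl = refl

walk-first : ∀ {G s es t} → Walk G s es t → ∃[ f ] ∃[ rest ] (es ≡ f ∷ rest × tail G f ≡ s)
walk-first (one e p _)  = e , [] , refl , p
walk-first (more e p _) = e , _ , refl , p

walk-last : ∀ {G s es t} → Walk G s es t → ∃[ init ] ∃[ l ] (es ≡ init ++ l ∷ [] × head G l ≡ t)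
walk-last (one e _ q) = [] , e , refl , q
walk-last (more e _ w) with walk-last w
... | init , l , refl , q = e ∷ init , l , refl , q

walk-tail′ : ∀ {G s es t g} → Walk G s es t → g ∈ es → tail G g ≡ s ⊎ tail G g ∈ internal G es
walk-tail′ (one e p _) (here refl)  = inj₁ p
walk-tail′ (more e p w) (here refl) = inj₁ p
walk-tail′ w@(more e p _) (there g∈) = inj₂ (walk-tail w g∈)

cross-1 : ∀ a b → 1 ≤ cross a b → a ≡ true × b ≡ false
cross-1 true false _ = refl , refl
cross-1 true true ()
cross-1 false _ ()

cross-one : ∀ {a b} → a ≡ true → b ≡ false → cross a b ≡ 1
cross-one refl refl = refl

module Width (G : Digraph) (eul : Eulerian G) where

  module E = Cuts {A = Fin (nE G)} (tail G) (head G)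

  es : List (Fin (nE G))
  es = allFin (nE G)

  width : VSet (nV G) → ℕ
  width S = ∑ (E.out S) es

  bal : E.Balanced es
  bal = eulerian-balanced G eul

  width-inn : ∀ S → width S ≡ ∑ (E.inn S) es
  width-inn S = E.balanced-cut es bal S

  piece : (S : VSet (nV G)) → Piece G (width S)
  piece S = record
    { set = S ; o = at O ; i = at I
    ; o-cut = λ a → let p , q = ∧-true (holds O a) in p , not-true q
    ; i-cut = λ b → let p , q = ∧-true (holds I b) in not-true q , p
    ; o-inj = inj O ; i-inj = inj I
    ; o-sur = λ e p q → sur O e (cong₂ _∧_ p (cong not q))
    ; i-sur = λ e p q → sur I e (cong₂ _∧_ q (cong not p)) }
    where
    open Enum
    O : Enum (λ e → S (tail G e) ∧ not (S (head G e))) (width S)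
    O = enum _
    I : Enum (λ e → S (head G e) ∧ not (S (tail G e))) (width S)
    I = subst (Enum _) (sym (width-inn S)) (enum _)
    not-true : ∀ {b} → not b ≡ true → b ≡ false
    not-true {false} _ = refl

  walk-out : ∀ S {s xs t} → Walk G s xs t → cross (S s) (S t) ≤ ∑ (E.out S) xs
  walk-out S (one e refl refl) = ≤-reflexive (sym (+-identityʳ _))
  walk-out S (more e refl w) = ≤-trans (cross-triangle (S (tail G e)) (S (head G e)) _) (+-monoʳ-≤ (E.out S e) (walk-out S w))

  walk-inn : ∀ S {s xs t} → Walk G s xs t → cross (S t) (S s) ≤ ∑ (E.inn S) xs
  walk-inn S (one e refl refl) = ≤-reflexive (sym (+-identityʳ _))
  walk-inn S (more e refl w) = ≤-trans (cross-triangle _ (S (head G e)) (S (tail G e)))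
    (≤-trans (+-monoˡ-≤ _ (walk-inn S w)) (≤-reflexive (+-comm _ (E.inn S e))))

  module Linked {w} (Q : Piece G w) (Y : VSet (nV G)) (Y⊆X : Y ⊆ set Q) (wY : width Y ≡ w) (wX : width (set Q) ≡ w)
                (as : List (Menger.Arc G Y (set Q) w)) (routing : Menger.Routing G Y (set Q) w as)
                (dst-idle : ∀ {τ} → τ ∈ as → Menger.Idle G Y (set Q) w τ) where

    X = set Q
    open Menger G Y X w hiding (module E)
    open Trail
    open Routing routing renaming (large to large′; balanced to balanced′)

    -- Every trail ending at an inner vertex starts there too; a further trail starting there would
    -- upset the balance.
    src-idle : ∀ {τ} → τ ∈ as → Mid (src τ) → src τ ≡ dst τ
    src-idle {τ} τ∈ m with dst τ Fin.≟ src τ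
    ... | yes q = sym q
    ... | no ¬q = ⊥-elim (<-irrefl (sym (balanced′ ⁅ src τ ⁆)) (∑-strict as le τ∈ lt))
      where
      le : ∀ {σ} → σ ∈ as → ⟦ ⁅ src τ ⁆ (dst σ) ⟧ ≤ ⟦ ⁅ src τ ⁆ (src σ) ⟧
      le {σ} σ∈ with dst σ Fin.≟ src τ
      ... | no _ = z≤n
      ... | yes q = ≤-reflexive (sym (trans (cong (λ x → δ x (src τ)) (trans (dst-idle σ∈ (subst Mid (sym q) m)) q)) (δ-refl (src τ))))
      lt : ⟦ ⁅ src τ ⁆ (dst τ) ⟧ < ⟦ ⁅ src τ ⁆ (src τ) ⟧
      lt with dst τ Fin.≟ src τ | src τ Fin.≟ src τ
      ... | yes q | _ = ⊥-elim (¬q q)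
      ... | no _ | yes _ = s≤s z≤n
      ... | no _ | no ¬r = ⊥-elim (¬r refl)

    -- The ends of the trails already account for `w` crossings, while all edges together cross only
    -- `w` times. So no trail goes back and forth: it leaves `S` at most once, and only if its ends
    -- require it.
    out-count : ∀ S → Between Y X S → width S ≡ w → ∀ {τ} → τ ∈ as → cross (S (src τ)) (S (dst τ)) ≡ ∑ (E.out S) (edges τ)
    out-count S bt q τ∈ = ∑-tight as (λ {τ} _ → walk-out S (walk τ))
      (≤-trans (≤-reflexive (trans (weight (E.out S)) q)) (large′ S bt)) τ∈

    inn-count : ∀ S → Between Y X S → width S ≡ w → ∀ {τ} → τ ∈ as → cross (S (dst τ)) (S (src τ)) ≡ ∑ (E.inn S) (edges τ)
    inn-count S bt q τ∈ = ∑-tight as (λ {τ} _ → walk-inn S (walk τ))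
      (≤-trans (≤-reflexive (trans (weight (E.inn S)) (trans (sym (width-inn S)) q)))
        (≤-trans (large′ S bt) (≤-reflexive (Cuts.balanced-cut src dst as balanced′ S)))) τ∈

    btX : Between Y X X
    btX = Y⊆X , λ _ p → p

    btY : Between Y X Y
    btY = (λ _ p → p) , Y⊆X

    through : ∀ e → ∃[ τ ] (τ ∈ as × e ∈ edges τ)
    through e with ∑-positive (∑ (δ e) ∘ edges) as (≤-reflexive (sym (trans (weight (δ e)) (∑δ-allFin e))))
    ... | τ , τ∈ , p = τ , τ∈ , ∈-∑δ (edges τ) p

    same-trail : ∀ {e τ σ} → τ ∈ as → σ ∈ as → e ∈ edges τ → e ∈ edges σ → τ ≡ σ
    same-trail {e} τ∈ σ∈ p q = ∑-unique (∑ (δ e) ∘ edges) as (≤-reflexive (trans (weight (δ e)) (∑δ-allFin e))) τ∈ σ∈ (∑δ-∈ p) (∑δ-∈ q)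

    edges-unique : ∀ {τ} → τ ∈ as → ∀ xs ys → edges τ ≡ xs ++ ys → Unique xs × Unique ys
    edges-unique {τ} τ∈ xs ys eq = ∑δ-unique⁻ xs (λ e → ≤-trans (m≤m+n _ _) (le e)) , ∑δ-unique⁻ ys (λ e → ≤-trans (m≤n+m _ (∑ (δ e) xs)) (le e))
      where
      le : ∀ e → ∑ (δ e) xs + ∑ (δ e) ys ≤ 1
      le e = ≤-trans (≤-reflexive (trans (sym (∑-++ (δ e) xs ys)) (cong (∑ (δ e)) (sym eq))))
        (≤-trans (∑-member (∑ (δ e) ∘ edges) as τ∈) (≤-reflexive (trans (weight (δ e)) (∑δ-allFin e))))

    cross≤1 : ∀ a b → cross a b ≤ 1
    cross≤1 = toWitness {a? = ∀𝔹? λ a → ∀𝔹? λ b → _ ≤? _} tt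

    one-out : ∀ S → Between Y X S → width S ≡ w → ∀ {τ} → τ ∈ as → ∀ {e f} → e ∈ edges τ → f ∈ edges τ → 1 ≤ E.out S e → 1 ≤ E.out S f → e ≡ f
    one-out S bt q {τ} τ∈ = ∑-unique (E.out S) (edges τ) (≤-trans (≤-reflexive (sym (out-count S bt q τ∈))) (cross≤1 (S (src τ)) (S (dst τ))))

    one-inn : ∀ S → Between Y X S → width S ≡ w → ∀ {τ} → τ ∈ as → ∀ {e f} → e ∈ edges τ → f ∈ edges τ → 1 ≤ E.inn S e → 1 ≤ E.inn S f → e ≡ f
    one-inn S bt q {τ} τ∈ = ∑-unique (E.inn S) (edges τ) (≤-trans (≤-reflexive (sym (inn-count S bt q τ∈))) (cross≤1 (S (dst τ)) (S (src τ))))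

    leaving : ∀ S → Between Y X S → width S ≡ w → ∀ {τ e} → τ ∈ as → e ∈ edges τ → S (tail G e) ≡ true → S (head G e) ≡ false →
              S (src τ) ≡ true × S (dst τ) ≡ false
    leaving S bt q {τ} {e} τ∈ e∈ p p′ = cross-1 _ _ (≤-trans (≤-reflexive (sym (cross-one p p′)))
      (≤-trans (∑-member (E.out S) (edges τ) e∈) (≤-reflexive (sym (out-count S bt q τ∈)))))

    entering : ∀ S → Between Y X S → width S ≡ w → ∀ {τ e} → τ ∈ as → e ∈ edges τ → S (tail G e) ≡ false → S (head G e) ≡ true →
               S (src τ) ≡ false × S (dst τ) ≡ true
    entering S bt q {τ} {e} τ∈ e∈ p p′ = let x , y = cross-1 _ _ (≤-trans (≤-reflexive (sym (cross-one p′ p)))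
                                                       (≤-trans (∑-member (E.inn S) (edges τ) e∈) (≤-reflexive (sym (inn-count S bt q τ∈))))) in y , x

    not-in : ∀ {v} → X v ≡ false → Y v ≡ false
    not-in p = ¬true λ q → clash (Y⊆X _ q) p

    -- The trail through `o Q a` starts in `Y` and ends outside `X`, so its first edge leaves `Y`
    -- and its last is `o Q a`. The first edge receives the number `a`.
    record Outward (a : Fin w) : Set where
      field
        τ      : Arc
        τ∈     : τ ∈ as
        first  : Fin (nE G)
        rest   : List (Fin (nE G))
        init   : List (Fin (nE G))
        starts : edges τ ≡ first ∷ rest
        stops  : edges τ ≡ init ++ o Q a ∷ []
        tail-f : tail G first ≡ src τ
        Ysrc   : Y (src τ) ≡ true
        Xdst   : X (dst τ) ≡ false
        head-l : head G (o Q a) ≡ dst τ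
        first-cut : Y (tail G first) ≡ true × Y (head G first) ≡ false

    outward : ∀ a → Outward a
    outward a with through (o Q a)
    ... | τ , τ∈ , e∈ with leaving X btX wX τ∈ e∈ (proj₁ (o-cut Q a)) (proj₂ (o-cut Q a)) | walk-first (walk τ) | walk-last (walk τ)
    ...   | Xs , Xd | f , rest , st , tf | init , l , sp , hl = record
      { τ = τ ; τ∈ = τ∈ ; first = f ; rest = rest ; init = init ; starts = st ; stops = trans sp (cong (λ x → init ++ x ∷ []) (sym e≡l))
      ; tail-f = tf ; Ysrc = Ys ; Xdst = Xd ; head-l = trans (cong (head G) e≡l) hl
      ; first-cut = trans (cong Y tf) Ys , head-f }
      where
      Ys : Y (src τ) ≡ true
      Ys = go (Y (src τ)) refl
        where
        go : ∀ b → Y (src τ) ≡ b → Y (src τ) ≡ true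
        go true q  = q
        -- A source in `X` but not in `Y` would make the trail closed, yet it ends outside `X`.
        go false q = ⊥-elim (clash Xs (subst (λ x → X x ≡ false) (sym (src-idle τ∈ (q , Xs))) Xd))
      l∈ : l ∈ edges τ
      l∈ = subst (l ∈_) (sym sp) (∈-++⁺ʳ init (here refl))
      f∈ : f ∈ edges τ
      f∈ = subst (f ∈_) (sym st) (here refl)
      tail-l : X (tail G l) ≡ true
      tail-l with walk-tail′ (walk τ) l∈
      ... | inj₁ q = trans (cong X q) Xs
      ... | inj₂ q = proj₂ (inside τ q)
      head-f : Y (head G f) ≡ false
      head-f with walk-head (walk τ) f∈
      ... | inj₁ q = trans (cong Y q) (not-in Xd)
      ... | inj₂ q = proj₁ (inside τ q)
      e≡l : o Q a ≡ l
      e≡l = one-out X btX wX τ∈ e∈ l∈ (≤-reflexive (sym (cross-one (proj₁ (o-cut Q a)) (proj₂ (o-cut Q a)))))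
              (≤-reflexive (sym (cross-one tail-l (trans (cong X hl) Xd))))

    record Inward (b : Fin w) : Set where
      field
        τ      : Arc
        τ∈     : τ ∈ as
        last   : Fin (nE G)
        rest   : List (Fin (nE G))
        init   : List (Fin (nE G))
        starts : edges τ ≡ i Q b ∷ rest
        stops  : edges τ ≡ init ++ last ∷ []
        tail-f : tail G (i Q b) ≡ src τ
        Xsrc   : X (src τ) ≡ false
        Ydst   : Y (dst τ) ≡ true
        head-l : head G last ≡ dst τ
        last-cut : Y (tail G last) ≡ false × Y (head G last) ≡ true

    inward : ∀ b → Inward b
    inward b with through (i Q b)
    ... | τ , τ∈ , e∈ with entering X btX wX τ∈ e∈ (proj₁ (i-cut Q b)) (proj₂ (i-cut Q b)) | walk-first (walk τ) | walk-last (walk τ)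
    ...   | Xs , Xd | f , rest , st , tf | init , l , sp , hl = record
      { τ = τ ; τ∈ = τ∈ ; last = l ; rest = rest ; init = init ; starts = trans st (cong (_∷ rest) (sym e≡f)) ; stops = sp
      ; tail-f = trans (cong (tail G) e≡f) tf ; Xsrc = Xs ; Ydst = Yd ; head-l = hl
      ; last-cut = tail-l , trans (cong Y hl) Yd }
      where
      Yd : Y (dst τ) ≡ true
      Yd = go (Y (dst τ)) refl
        where
        go : ∀ b → Y (dst τ) ≡ b → Y (dst τ) ≡ true
        go true q  = q
        go false q = ⊥-elim (clash Xd (subst (λ x → X x ≡ false) (dst-idle τ∈ (q , Xd)) Xs))
      l∈ : l ∈ edges τ
      l∈ = subst (l ∈_) (sym sp) (∈-++⁺ʳ init (here refl))
      f∈ : f ∈ edges τ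
      f∈ = subst (f ∈_) (sym st) (here refl)
      tail-l : Y (tail G l) ≡ false
      tail-l with walk-tail′ (walk τ) l∈
      ... | inj₁ q = trans (cong Y q) (not-in Xs)
      ... | inj₂ q = proj₁ (inside τ q)
      head-f : X (head G f) ≡ true
      head-f with walk-head (walk τ) f∈
      ... | inj₁ q = trans (cong X q) Xd
      ... | inj₂ q = proj₂ (inside τ q)
      e≡f : i Q b ≡ f
      e≡f = one-inn X btX wX τ∈ e∈ f∈ (≤-reflexive (sym (cross-one (proj₂ (i-cut Q b)) (proj₁ (i-cut Q b)))))
              (≤-reflexive (sym (cross-one head-f (trans (cong X tf) Xs))))

    module O a = Outward (outward a)
    module I b = Inward (inward b)

    first∈ : ∀ a → O.first a ∈ edges (O.τ a)
    first∈ a = subst (O.first a ∈_) (sym (O.starts a)) (here refl)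

    last∈ : ∀ b → I.last b ∈ edges (I.τ b)
    last∈ b = subst (I.last b ∈_) (sym (I.stops b)) (∈-++⁺ʳ (I.init b) (here refl))

    oQ∈ : ∀ a → o Q a ∈ edges (O.τ a)
    oQ∈ a = subst (o Q a ∈_) (sym (O.stops a)) (∈-++⁺ʳ (O.init a) (here refl))

    iQ∈ : ∀ b → i Q b ∈ edges (I.τ b)
    iQ∈ b = subst (i Q b ∈_) (sym (I.starts b)) (here refl)

    same-out : ∀ {a b e} → e ∈ edges (O.τ a) → e ∈ edges (O.τ b) → a ≡ b
    same-out {a} {b} p q = o-inj Q (proj₂ (∷ʳ-injective (O.init a) (O.init b)
      (trans (sym (O.stops a)) (trans (cong edges (same-trail (O.τ∈ a) (O.τ∈ b) p q)) (O.stops b)))))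

    same-in : ∀ {a b e} → e ∈ edges (I.τ a) → e ∈ edges (I.τ b) → a ≡ b
    same-in {a} {b} p q = i-inj Q (∷-injectiveˡ (trans (sym (I.starts a)) (trans (cong edges (same-trail (I.τ∈ a) (I.τ∈ b) p q)) (I.starts b))))

    -- The trail through an edge leaving `Y` also leaves `X`, through some `o Q a`; as only one of
    -- its edges leaves `Y`, that edge is the one numbered `a`.
    o-onto : ∀ e → Y (tail G e) ≡ true → Y (head G e) ≡ false → ∃[ a ] O.first a ≡ e
    o-onto e p q with through e
    ... | τ , τ∈ , e∈ with leaving Y btY wY τ∈ e∈ p q
    ...   | Ys , Yd with ∑-positive (E.out X) (edges τ) (≤-trans (≤-reflexive (sym (cross-one (Y⊆X _ Ys) Xd))) (≤-reflexive (out-count X btX wX τ∈)))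
      where
      Xd : X (dst τ) ≡ false
      Xd = ¬true λ r → clash Ys (subst (λ x → Y x ≡ false) (sym (dst-idle τ∈ (Yd , r))) Yd)
    ...     | g , g∈ , h with o-sur Q g (proj₁ (cross-1 _ _ h)) (proj₂ (cross-1 _ _ h))
    ...       | a , refl with same-trail τ∈ (O.τ∈ a) g∈ (oQ∈ a)
    ...         | refl = a , one-out Y btY wY τ∈ (first∈ a) e∈
                  (≤-reflexive (sym (cross-one (proj₁ (O.first-cut a)) (proj₂ (O.first-cut a))))) (≤-reflexive (sym (cross-one p q)))

    i-onto : ∀ e → Y (tail G e) ≡ false → Y (head G e) ≡ true → ∃[ b ] I.last b ≡ e
    i-onto e p q with through e
    ... | τ , τ∈ , e∈ with entering Y btY wY τ∈ e∈ p q
    ...   | Ys , Yd with ∑-positive (E.inn X) (edges τ) (≤-trans (≤-reflexive (sym (cross-one (Y⊆X _ Yd) Xs))) (≤-reflexive (inn-count X btX wX τ∈)))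
      where
      Xs : X (src τ) ≡ false
      Xs = ¬true λ r → clash Yd (subst (λ x → Y x ≡ false) (src-idle τ∈ (Ys , r)) Ys)
    ...     | g , g∈ , h with i-sur Q g (proj₂ (cross-1 _ _ h)) (proj₁ (cross-1 _ _ h))
    ...       | b , refl with same-trail τ∈ (I.τ∈ b) g∈ (iQ∈ b)
    ...         | refl = b , one-inn Y btY wY τ∈ (last∈ b) e∈
                  (≤-reflexive (sym (cross-one (proj₂ (I.last-cut b)) (proj₁ (I.last-cut b))))) (≤-reflexive (sym (cross-one q p)))

    linked-piece : Piece G w
    linked-piece = record
      { set = Y ; o = O.first ; i = I.last ; o-cut = O.first-cut ; i-cut = I.last-cut
      ; o-inj = λ {a} {b} q → same-out (first∈ a) (subst (_∈ edges (O.τ b)) (sym q) (first∈ b))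
      ; i-inj = λ {a} {b} q → same-in (last∈ a) (subst (_∈ edges (I.τ b)) (sym q) (last∈ b))
      ; o-sur = o-onto ; i-sur = i-onto }

    init⊆ : ∀ {a g} → g ∈ O.init a → g ∈ edges (O.τ a)
    init⊆ {a} {g} g∈ = subst (g ∈_) (sym (O.stops a)) (∈-++⁺ˡ g∈)

    rest⊆ : ∀ {b g} → g ∈ I.rest b → g ∈ edges (I.τ b)
    rest⊆ {b} {g} g∈ = subst (g ∈_) (sym (I.starts b)) (there g∈)

    link : Link linked-piece Q
    link = record
      { sub = Y⊆X ; o-init = O.init ; o-rest = O.rest ; o-starts = λ a → trans (sym (O.stops a)) (O.starts a)
      ; o-walk = λ a → subst₃ (O.stops a) (sym (O.tail-f a)) (sym (O.head-l a)) (walk (O.τ a))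
      ; o-mid = λ a {v} v∈ → inside (O.τ a) (subst (λ xs → v ∈ internal G xs) (sym (O.stops a)) v∈)
      ; i-rest = I.rest ; i-init = I.init ; i-ends = λ b → trans (sym (I.starts b)) (I.stops b)
      ; i-walk = λ b → subst₃ (I.starts b) (sym (I.tail-f b)) (sym (I.head-l b)) (walk (I.τ b))
      ; i-mid = λ b {v} v∈ → inside (I.τ b) (subst (λ xs → v ∈ internal G xs) (sym (I.starts b)) v∈)
      ; o-unique = λ a → proj₁ (edges-unique (O.τ∈ a) (O.init a) _ (O.stops a))
      ; i-unique = λ b → proj₂ (edges-unique (I.τ∈ b) (i Q b ∷ []) (I.rest b) (I.starts b))
      ; oo-disj = λ p q → same-out (init⊆ p) (init⊆ q)
      ; ii-disj = λ p q → same-in (rest⊆ p) (rest⊆ q)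
      -- An outward trail starts in `X` and an inward one outside, so they are different trails.
      ; oi-disj = λ {a} {b} p q → clash (Y⊆X _ (O.Ysrc a)) (trans (cong (λ τ → X (src τ)) (same-trail (O.τ∈ a) (I.τ∈ b) (init⊆ p) (rest⊆ q))) (I.Xsrc b)) }
      where
      subst₃ : ∀ {s s′ t t′ xs ys} → xs ≡ ys → s ≡ s′ → t ≡ t′ → Walk G s xs t → Walk G s′ ys t′
      subst₃ refl refl refl w = w

  linked : ∀ {w} (Q : Piece G w) (Y : VSet (nV G)) → Y ⊆ set Q → width Y ≡ w → width (set Q) ≡ w →
           (∀ S → Between Y (set Q) S → w ≤ width S) → ∃[ P ] (set P ≡ Y × Link P Q)
  linked {w} Q Y Y⊆X wY wX large with Menger.menger G Y (set Q) w bal large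
  ... | as , routing , idle = L.linked-piece , refl , L.link
    where module L = Linked Q Y Y⊆X wY wX as routing idle

-- Encoding by gap trees

open GapOrder

module Tables {c k : ℕ} where

  bit : Bool → Fin 2
  bit false = zero
  bit true  = suc zero

  bit-inj : ∀ {a b} → bit a ≡ bit b → a ≡ b
  bit-inj {false} {false} _ = refl
  bit-inj {true}  {true}  _ = refl

  module _ (t : Fin c → Fin k → Fin k → Bool) where

    entry : Fin c → Fin k × Fin k → Fin 2
    entry x (a , b) = bit (t x a b)

    row : Fin c × Fin (k * k) → Fin 2
    row (x , y) = entry x (remQuot {k} k y)

    digits : Fin (c * (k * k)) → Fin 2
    digits z = row (remQuot {c} (k * k) z)

    digits-at : ∀ x a b → digits (combine x (combine a b)) ≡ bit (t x a b)
    digits-at x a b = trans (cong row (remQuot-combine {c} {k * k} x (combine a b))) (cong (entry x) (remQuot-combine {k} {k} a b))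

  abstract
    code : (Fin c → Fin k → Fin k → Bool) → Fin (2 ^ (c * (k * k)))
    code t = funToFin (digits t)

    code-inj : ∀ t t′ → code t ≡ code t′ → ∀ x a b → t x a b ≡ t′ x a b
    code-inj t t′ eq x a b = bit-inj (trans (sym (digits-at t x a b)) (trans (trans (sym (finToFun-funToFin (digits t) z))
        (trans (cong (λ y → finToFun {2} {c * (k * k)} y z) eq) (finToFun-funToFin (digits t′) z))) (digits-at t′ x a b)))
      where
      z : Fin (c * (k * k))
      z = combine x (combine a b)

module Encoding (K : ℕ) where

  -- Pads a numbering to `K` places, so that pieces of all widths share one finite set of tags.
  slot : ∀ {w m} → (Fin w → Fin m) → Fin K → Maybe (Fin m)
  slot {w} f x with toℕ x <? w
  ... | yes p = just (f (fromℕ< p))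
  ... | no _  = nothing

  slot-inject : ∀ {w m} (f : Fin w → Fin m) (w≤K : w ≤ K) a → slot f (inject≤ a w≤K) ≡ just (f a)
  slot-inject {w} f w≤K a with toℕ (inject≤ a w≤K) <? w
  ... | yes p = cong (just ∘ f) (trans (fromℕ<-cong _ _ (toℕ-inject≤ a w≤K) p (toℕ<n a)) (fromℕ<-toℕ a (toℕ<n a)))
  ... | no ¬p = ⊥-elim (¬p (subst (_< w) (sym (toℕ-inject≤ a w≤K)) (toℕ<n a)))

  -- Six tables of coincidences between two padded numberings, with one bit for each pair of places.
  N : ℕ
  N = 2 ^ (6 * (K * K))

  Table : ℕ → Set
  Table m = Fin 6 → (Fin K → Maybe (Fin m)) × (Fin K → Maybe (Fin m))

  agrees : ∀ {m} → Table m → Fin 6 → Fin K → Fin K → Bool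
  agrees t c a b = does (≡-dec Fin._≟_ (proj₁ (t c) a) (proj₂ (t c) b))

  code : ∀ {m} → Table m → Fin N
  code t = Tables.code (agrees t)

  code-same : ∀ {m m′} (t : Table m) (t′ : Table m′) → code t ≡ code t′ → ∀ c a b → agrees t c a b ≡ agrees t′ c a b
  code-same t t′ = Tables.code-inj (agrees t) (agrees t′)

  -- The tag of a node records which boundary edges of its piece and of its two children coincide.
  table : ∀ {G w w₁ w₂} → Piece G w → Piece G w₁ → Piece G w₂ → Table (nE G)
  table P P₁ P₂ zero = slot (o P₁) , slot (o P)
  table P P₁ P₂ (suc zero) = slot (i P₁) , slot (i P)
  table P P₁ P₂ (suc (suc zero)) = slot (o P₂) , slot (o P)
  table P P₁ P₂ (suc (suc (suc zero))) = slot (i P₂) , slot (i P)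
  table P P₁ P₂ (suc (suc (suc (suc zero)))) = slot (o P₁) , slot (i P₂)
  table P P₁ P₂ (suc (suc (suc (suc (suc zero))))) = slot (o P₂) , slot (i P₁)

  tag : ∀ {G w w₁ w₂} → Piece G w → Piece G w₁ → Piece G w₂ → Fin N
  tag P P₁ P₂ = code (table P P₁ P₂)

  transfer : ∀ {m m′ u v} (f : Fin u → Fin m) (g : Fin v → Fin m) (f′ : Fin u → Fin m′) (g′ : Fin v → Fin m′) →
             u ≤ K → v ≤ K →
             (∀ a b → does (≡-dec Fin._≟_ (slot f a) (slot g b)) ≡ does (≡-dec Fin._≟_ (slot f′ a) (slot g′ b))) →
             ∀ {a b} → f a ≡ g b → f′ a ≡ g′ b
  transfer f g f′ g′ u≤K v≤K h {a} {b} eq =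
    just-injective (trans (sym (slot-inject f′ u≤K a)) (trans (true→ (≡-dec Fin._≟_ _ _) (trans (sym (h _ _)) (dec-true (≡-dec Fin._≟_ _ _) eq′))) (slot-inject g′ v≤K b)))
    where
    eq′ : slot f (inject≤ a u≤K) ≡ slot g (inject≤ b v≤K)
    eq′ = trans (slot-inject f u≤K a) (trans (cong just eq) (sym (slot-inject g v≤K b)))
    true→ : ∀ {A : Set} (d : Dec A) → does d ≡ true → A
    true→ (yes p) _ = p

  compatible : ∀ {H G w w₁ w₂} (P : Piece H w) (P₁ : Piece H w₁) (P₂ : Piece H w₂) (Q : Piece G w) (Q₁ : Piece G w₁) (Q₂ : Piece G w₂) →
               w ≤ K → w₁ ≤ K → w₂ ≤ K → tag P P₁ P₂ ≡ tag Q Q₁ Q₂ → Compatible P P₁ P₂ Q Q₁ Q₂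
  compatible P P₁ P₂ Q Q₁ Q₂ w w₁ w₂ eq = record
    { o₁o  = transfer (o P₁) (o P) (o Q₁) (o Q) w₁ w (h zero)
    ; i₁i  = transfer (i P₁) (i P) (i Q₁) (i Q) w₁ w (h (suc zero))
    ; o₂o  = transfer (o P₂) (o P) (o Q₂) (o Q) w₂ w (h (suc (suc zero)))
    ; i₂i  = transfer (i P₂) (i P) (i Q₂) (i Q) w₂ w (h (suc (suc (suc zero))))
    ; o₁i₂ = transfer (o P₁) (i P₂) (o Q₁) (i Q₂) w₁ w₂ (h (suc (suc (suc (suc zero)))))
    ; o₂i₁ = transfer (o P₂) (i P₁) (o Q₂) (i Q₁) w₂ w₁ (h (suc (suc (suc (suc (suc zero)))))) }
    where
    h = code-same (table P P₁ P₂) (table Q Q₁ Q₂) eq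

  -- The conditions on `In` supply exactly what a link of the gap embedding needs: a piece for the
  -- lower node and the trails between its boundary and that of `P`.
  data Codes {G} : ∀ {w} → Tree N w → Piece G w → Set where
    leaf : ∀ {w x} {P : Piece G w} → LeafPiece P x → Codes (leaf w x) P
    node : ∀ {w w₁ w₂} {P : Piece G w} {P₁ : Piece G w₁} {P₂ : Piece G w₂} {l r} →
           Codes l P₁ → Codes r P₂ → Splits P P₁ P₂ → w ≤ K → w₁ ≤ K → w₂ ≤ K →
           (∀ {u : Tree N w} → In u l → ∃[ Q ] (Codes u Q × Link Q P)) →
           (∀ {u : Tree N w} → In u r → ∃[ Q ] (Codes u Q × Link Q P)) →
           ∀ {τ} → τ ≡ tag P P₁ P₂ → Codes (node w τ l r) P

  -- Each rule of the gap embedding has its own construction: gluing for `node`, prolonging along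
  -- trails for the links.
  sound : ∀ {H G w} {s t : Tree N w} {P : Piece H w} {Q : Piece G w} → s ≼ t → Codes s P → Codes t Q → P ⊑ Q
  sound (leaf le) (leaf p) (leaf q) = leaf-⊑ le p q
  sound (node a b) (node {P = P} {P₁} {P₂} c d S w w₁ w₂ _ _ e) (node {P = Q} {Q₁} {Q₂} c′ d′ S′ _ _ _ _ _ e′) =
    Glue.glue S S′ (compatible P P₁ P₂ Q Q₁ Q₂ w w₁ w₂ (trans (sym e) e′)) (sound a c c′) (sound b d d′)
  sound (linkˡ u a) c (node _ _ _ _ _ _ ls _ _) = let Q , c′ , l = ls u in Extend.extend (sound a c c′) l
  sound (linkʳ u a) c (node _ _ _ _ _ _ _ ls _) = let Q , c′ , l = ls u in Extend.extend (sound a c c′) l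

  immersion : ∀ {H G u v} {s : Tree N u} {t : Tree N v} {P : Piece H u} {Q : Piece G v} → (u , s) ≼Σ (v , t) →
              Codes s P → Codes t Q → (∀ x → set P x ≡ true) → StrongImmersion H G
  immersion (same p) c c′ whole = strong-immersion whole (sound p c c′)

-- Encoding a narrow tree or improving it

module Build (G : Digraph) (eul : Eulerian G) (K : ℕ) where

  open Encoding K
  open Width G eul

  width-cong : ∀ {S S′} → S ≗ S′ → width S ≡ width S′
  width-cong eq = E.cut-cong eq es

  width-∁ : ∀ S → width (∁ S) ≡ width S
  width-∁ S = trans (∑-cong es (λ e → swap (S (tail G e)) (S (head G e)))) (sym (width-inn S))
    where
    swap : ∀ a b → cross (not a) (not b) ≡ cross b a
    swap = toWitness {a? = ∀𝔹? λ a → ∀𝔹? λ b → _ ≟ _} tt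

  module I = Improve width width-cong (λ A B → E.submodular A B es) width-∁

  Narrow : CarvTree (nV G) → Set
  Narrow = All (λ W → width W ≤ K)

  _≺_ : CarvTree (nV G) → CarvTree (nV G) → Set
  T′ ≺ T = (λ k → I.cost k false T′) ≺[ K ] (λ k → I.cost k false T)

  Smaller : CarvTree (nV G) → Set
  Smaller T = ∃[ T′ ] (setOf T′ ≗ setOf T × Disjoint T′ × Narrow T′ × T′ ≺ T)

  -- The boundary of cur will be numbered along a linkage to the nearest ancestor of the same width, if nothing narrower lies in between.
  record Anc (T cur : CarvTree (nV G)) (j : ℕ) : Set where
    field
      {X}   : CarvTree (nV G)
      above : Path T X
      below : Path X cur
      Q     : Piece G j
      set-Q : set Q ≡ setOf X
      exact : width (setOf X) ≡ j
      wide  : j ≤ width (setOf cur) → ChainAll (λ W → j ≤ width W) below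
  open Anc

  Env : (T cur : CarvTree (nV G)) → Set
  Env T cur = ∀ j → Maybe (Anc T cur j)

  Links : ∀ {T cur j i} → Env T cur → Tree N i → Anc T cur j → Set
  Links {j = j} env t α = ∀ {u : Tree N j} → In u t → ∃[ Q′ ] (Codes u Q′ × Link Q′ (Q α))

  record Built {T cur} (env : Env T cur) : Set where
    field
      tree    : Tree N (width (setOf cur))
      P       : Piece G (width (setOf cur))
      set-P   : set P ≡ setOf cur
      codes   : Codes tree P
      bounded : Bounded K tree
      links   : ∀ {j} (α : Anc T cur j) → env j ≡ just α → Links env tree α

  module _ {T : CarvTree (nV G)} (disj : Disjoint T) (narrow : Narrow T) where

    Placed : ∀ {cur} → Env T cur → Set
    Placed {cur} env = Σ (Piece G (width (setOf cur))) λ P → set P ≡ setOf cur × (∀ α → env (width (setOf cur)) ≡ just α → Link P (Q α))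

    -- If an ancestor of the same width is recorded, the boundary is numbered along a linkage to it.
    -- The linkage exists unless some set in between is narrower, in which case the tree can be
    -- improved; without such an ancestor any numbering will do.
    place : ∀ {cur} (env : Env T cur) → Smaller T ⊎ Placed env
    place {cur} env = by (env (width Y)) refl
      where
      Y = setOf cur
      by : ∀ m → env (width Y) ≡ m → Smaller T ⊎ Placed env
      by nothing eq = inj₂ (piece Y , refl , λ α e → ⊥-elim (absurd (trans (sym eq) e)))
        where
        absurd : ∀ {A : Set} {x : A} → nothing ≡ just x → ⊥
        absurd ()
      by (just α) eq with anySet? {P = λ S → Between Y (setOf (X α)) S × width S < width Y}
                            (λ S → ((Y ⊆? S) ×-dec (S ⊆? setOf (X α))) ×-dec (width S <? width Y))
                            (λ { e ((p , q) , lt) → ((λ v h → trans (sym (e v)) (p v h)) , λ v h → q v (trans (e v) h)) , subst (_< width Y) (width-cong e) lt })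
      ... | yes (S , bt , lt) = inj₁ (I.improve K (above α) (below α) disj narrow (width Y) (wide α ≤-refl) S bt lt)
      ... | no ¬viol = inj₂ (proj₁ L , proj₁ (proj₂ L) , λ β e → subst (λ γ → Link (proj₁ L) (Q γ)) (just-injective (trans (sym eq) e)) (proj₂ (proj₂ L)))
        where
        L : ∃[ P ] (set P ≡ Y × Link P (Q α))
        L = linked (Q α) Y (subst (Y ⊆_) (sym (set-Q α)) (path-⊆ (below α))) refl (trans (cong width (set-Q α)) (exact α))
              λ S bt → ≮⇒≥ λ lt → ¬viol (S , subst (λ Z → Between Y Z S) (set-Q α) bt , lt)

    module Below {cur c d : CarvTree (nV G)} (ch : Child c d cur) (ρ : Path T cur) (env : Env T cur)
                 (P : Piece G (width (setOf cur))) (set-P : set P ≡ setOf cur) where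

      self : Anc T c (width (setOf cur))
      self = record { above = ρ ; below = ch ◂ stop ; Q = P ; set-Q = set-P ; exact = refl ; wide = λ h → ≤-refl , h }

      lift : ∀ {j} → j ≤ width (setOf cur) → Anc T cur j → Anc T c j
      lift le α = record { above = above α ; below = snoc (below α) ch ; Q = Q α ; set-Q = set-Q α ; exact = exact α
                         ; wide = ChainAll-snoc (below α) ch (wide α le) }

      -- Mirrors the gap condition: below a node of width `i`, recorded ancestors of smaller width
      -- stay visible, the node itself takes the place for width `i`, and wider ones are hidden.
      childEnv : Env T c
      childEnv j with <-cmp j (width (setOf cur))
      ... | tri< lt _ _   = Data.Maybe.map (lift (<⇒≤ lt)) (env j)
      ... | tri≈ _ refl _ = just self
      ... | tri> _ _ _    = nothing

      childEnv-self : childEnv (width (setOf cur)) ≡ just self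
      childEnv-self with <-cmp (width (setOf cur)) (width (setOf cur))
      ... | tri< lt _ _   = ⊥-elim (<-irrefl refl lt)
      ... | tri≈ _ refl _ = refl
      ... | tri> _ _ lt   = ⊥-elim (<-irrefl refl lt)

      childEnv-lift : ∀ {j} → j < width (setOf cur) → ∀ α → env j ≡ just α → ∃[ β ] (childEnv j ≡ just β × Q β ≡ Q α)
      childEnv-lift {j} lt α eq with <-cmp j (width (setOf cur))
      ... | tri< lt′ _ _ = lift (<⇒≤ lt′) α , cong (Data.Maybe.map (lift (<⇒≤ lt′))) eq , refl
      ... | tri≈ ¬lt _ _ = ⊥-elim (¬lt lt)
      ... | tri> ¬lt _ _ = ⊥-elim (¬lt lt)

    build-leaf : ∀ {x} (ρ : Path T (leaf x)) (env : Env T (leaf x)) {z} → (∀ (P : Piece G (width (setOf (leaf x)))) → set P ≡ setOf (leaf x) → LeafPiece P z) →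
                 Placed env → Built env
    build-leaf ρ env {z} lp (P , set-P , l) = record
      { tree = leaf _ z ; P = P ; set-P = set-P ; codes = leaf (lp P set-P) ; bounded = leaf (All-at narrow ρ)
      ; links = λ { α e here → P , leaf (lp P set-P) , l α e } }

    loops : (v : Fin (nV G)) → Σ ℕ (Enum λ e → does (tail G e Fin.≟ v) ∧ does (head G e Fin.≟ v))
    loops v = _ , enum _

    single-leaf : ∀ v (P : Piece G (width (setOf (leaf (just v))))) → set P ≡ setOf (leaf (just v)) → LeafPiece P (suc (proj₁ (loops v)))
    single-leaf v P set-P = single v (trans (cong (λ f → f v) set-P) (dec-true (v Fin.≟ v) refl))
        (λ u h → holds-at (trans (sym (cong (λ f → f u) set-P)) h)) at
        (λ a → holds-at (proj₁ (∧-true (holds a))) , holds-at (proj₂ (∧-true (holds a)))) inj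
        (λ e p q → sur e (cong₂ _∧_ (dec-true (tail G e Fin.≟ v) p) (dec-true (head G e Fin.≟ v) q)))
      where
      open Enum (proj₂ (loops v))
      holds-at : ∀ {x y : Fin (nV G)} → does (x Fin.≟ y) ≡ true → x ≡ y
      holds-at {x} {y} h with x Fin.≟ y
      ... | yes q = q

    module Node {l r : CarvTree (nV G)} (ρ : Path T (node l r)) (env : Env T (node l r)) (P : Piece G (width (setOf (node l r))))
                (set-P : set P ≡ setOf (node l r)) (lk : ∀ α → env (width (setOf (node l r))) ≡ just α → Link P (Q α)) where

      module CL = Below left ρ env P set-P
      module CR = Below right ρ env P set-P

      build-node : Built CL.childEnv → Built CR.childEnv → Built env
      build-node bl br = record
        { tree = node _ (tag P Bl.P Br.P) Bl.tree Br.tree ; P = P ; set-P = set-P ; codes = codes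
        ; bounded = node (All-at narrow ρ) Bl.bounded Br.bounded ; links = links }
        where
        module Bl = Built bl
        module Br = Built br
        splits : Splits P Bl.P Br.P
        splits = record
          { union = λ v → trans (cong (λ f → f v) set-P) (sym (cong₂ _∨_ (cong (λ f → f v) Bl.set-P) (cong (λ f → f v) Br.set-P)))
          ; apart = λ v p → trans (cong (λ f → f v) Br.set-P) (proj₁ (disjoint-at disj ρ) v (trans (sym (cong (λ f → f v) Bl.set-P)) p)) }
        codes : Codes (node _ (tag P Bl.P Br.P) Bl.tree Br.tree) P
        codes = node Bl.codes Br.codes splits (All-at narrow ρ) (All-at narrow (snoc ρ left)) (All-at narrow (snoc ρ right))
                  (Bl.links CL.self CL.childEnv-self) (Br.links CR.self CR.childEnv-self) refl
        links : ∀ {j} (α : Anc T (node l r) j) → env j ≡ just α → Links env (node _ (tag P Bl.P Br.P) Bl.tree Br.tree) α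
        links α e here = P , codes , lk α e
        links α e (inˡ lt u∈) = let β , e′ , q = CL.childEnv-lift lt α e ; Q′ , c , k = Bl.links β e′ u∈ in Q′ , c , subst (Link Q′) q k
        links α e (inʳ lt u∈) = let β , e′ , q = CR.childEnv-lift lt α e ; Q′ , c , k = Br.links β e′ u∈ in Q′ , c , subst (Link Q′) q k

    _>>=_ : ∀ {A B : Set} → Smaller T ⊎ A → (A → Smaller T ⊎ B) → Smaller T ⊎ B
    inj₁ s >>= f = inj₁ s
    inj₂ a >>= f = f a

    build : ∀ cur (ρ : Path T cur) (env : Env T cur) → Smaller T ⊎ Built env
    build (leaf nothing) ρ env  = place env >>= λ p → inj₂ (build-leaf ρ env (λ P q → empty λ v → cong (λ f → f v) q) p)
    build (leaf (just v)) ρ env = place env >>= λ p → inj₂ (build-leaf ρ env (single-leaf v) p)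
    build (node l r) ρ env = place env >>= λ { (P , set-P , lk) → let open Node ρ env P set-P lk in
      build l (snoc ρ left) CL.childEnv >>= λ bl → build r (snoc ρ right) CR.childEnv >>= λ br → inj₂ (build-node bl br) }

  record Encoded : Set where
    field
      {w}     : ℕ
      tree    : Tree N w
      bounded : Bounded K tree
      root    : Piece G w
      whole   : ∀ v → set root v ≡ true
      codes   : Codes tree root

  -- Restarts after every improvement; the well-founded order on costs lets only finitely many
  -- occur.
  encode-tree : ∀ T → Acc _≺_ T → Disjoint T → Narrow T → (∀ v → setOf T v ≡ true) → Encoded
  encode-tree T (acc h) d nw wh with build d nw T stop (λ _ → nothing)
  ... | inj₁ (T′ , eq , d′ , nw′ , lt) = encode-tree T′ (h lt) d′ nw′ λ v → trans (eq v) (wh v)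
  ... | inj₂ b = record { tree = tree ; bounded = bounded ; root = P ; whole = λ v → trans (cong (λ f → f v) set-P) (wh v) ; codes = codes }
    where open Built b

  encoded : CarvingWidthAtMost K G → Encoded
  encoded (C , W) = encode-tree carv (≺-acc (λ T k → I.cost k false T) K carv) disjoint narrow whole
    where open FromCarving.Rooted (FromCarving.rooted G C K W)

theorem1p4 : (k : ℕ) (G : ℕ → Digraph)
    → (∀ i → Eulerian (G i))
    → (∀ i → CarvingWidthAtMost k (G i))
    → ∃[ i ] ∃[ j ] (i < j × StrongImmersion (G i) (G j))
theorem1p4 k G eul cw = conclude (GapTrees.gap-kruskal k N (λ i → _ , E.tree i) E.bounded)
  where
  open Encoding k using (N; immersion)
  module E i = Build.Encoded (Build.encoded (G i) (eul i) k (cw i))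
  conclude : ∃[ i ] ∃[ j ] (i < j × (E.w i , E.tree i) ≼Σ (E.w j , E.tree j)) → ∃[ i ] ∃[ j ] (i < j × StrongImmersion (G i) (G j))
  conclude (i , j , i<j , p) = i , j , i<j , immersion p (E.codes i) (E.codes j) (E.whole i)
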